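{- For an integer $N \geq 1$ and points $x_1, \dots, x_N \in \mathbb{T}$ put $$ A = \frac{2}{N}\int_{0}^{N/2} \left| \frac{1}{N}\, \# \left\{ (m,n): 1 \leq m, n \leq N,\ m \neq n,\ |x_m - x_n| \leq \frac{s}{N} \right\} - 2s \right|^2 ds . $$ There exist absolute constants $C_1, C_2, c > 0$ such that for all integers $N \geq 1$ and all $x_1,\dots,x_N \in \mathbb{T}$, with discrepancy $D_N$: (i) $A \leq C_1 N^2 D_N^2$; (ii) if $D_N \geq C_2 N^{ -1/3}$, then $A \geq c\, N^2 D_N^5$.
   Context: $\mathbb{T} = \mathbb{R}/\mathbb{Z}$ is the one-dimensional torus, identified with $[0,1]$ with endpoints glued. For $x,y \in \mathbb{T}$, $|x-y|$ denotes the distance on the torus, i.e. the distance from $x-y$ to the nearest integer. Pairs $(m,n)$ are ordered, and points are counted by index. The discrepancy of $x_1,\dots,x_N$ is $$ D_N = \sup_{I \subset \mathbb{T}} \left| \frac{\#\{1 \leq n \leq N : x_n \in I\}}{N} - |I| \right|, $$ where the supremum ranges over all intervals (arcs) $I \subset \mathbb{T}$ and $|I|$ is the length of $I$. -}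

module Defs where

open import Algebra.Bundles using (CommutativeRing)
open import Algebra.Core using (Op₁; Op₂)
open import Algebra.Structures using (IsCommutativeRing)
import Algebra.Construct.NaturalChoice.Max as Max
import Algebra.Construct.NaturalChoice.Min as Min
import Algebra.Properties.Semiring.Exp as Exp
import Algebra.Properties.Semiring.Mult as Mult
open import Data.Fin.Base using (Fin)
open import Data.Fin.Properties using (_≟_)
open import Data.List.Base using (allFin; cartesianProduct; filter; length)
open import Data.Nat.Base using (ℕ)
open import Data.Product.Base using (∃; ∃-syntax; _×_; _,_)
open import Data.Sum.Base using (_⊎_)
open import Data.Unit.Polymorphic.Base using (⊤)
open import Level using (Level; suc; _⊔_)
open import Relation.Binary.Bundles using (DecTotalOrder; StrictTotalOrder)
open import Relation.Binary.Core using (Rel)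
open import Relation.Binary.PropositionalEquality.Core using (_≢_)
import Relation.Binary.Properties.DecTotalOrder as OrderProperties
open import Relation.Binary.Structures using (IsDecTotalOrder)
open import Relation.Nullary.Decidable.Core using (Dec; map′; _×-dec_; _⊎-dec_; ¬?)
open import Relation.Nullary.Negation.Core using (¬_)
open import Relation.Unary using (Pred; Decidable)

module _ {a ℓ} {A : Set a} (_≤_ : Rel A ℓ) where

  IsUpperBound : ∀ {p} → Pred A p → Pred A (a ⊔ ℓ ⊔ p)
  IsUpperBound P u = ∀ x → P x → x ≤ u

  IsSupremum : ∀ {p} → Pred A p → Pred A (a ⊔ ℓ ⊔ p)
  IsSupremum P s = IsUpperBound P s × (∀ u → IsUpperBound P u → s ≤ u)

-- The classical real numbers, axiomatised as a Dedekind-complete ordered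
-- field (unique up to isomorphism). The order is decidable, as it is for the
-- classical reals; this is what makes the counts below natural numbers.
record CompleteOrderedField (c ℓ₁ ℓ₂ : Level) : Set (suc (c ⊔ ℓ₁ ⊔ ℓ₂)) where
  infix  8 _⁻¹ -_
  infixl 7 _*_
  infixl 6 _+_
  infix  4 _≈_ _≤_
  field
    Carrier           : Set c
    _≈_               : Rel Carrier ℓ₁
    _≤_               : Rel Carrier ℓ₂
    _+_ _*_           : Op₂ Carrier
    -_                : Op₁ Carrier
    0# 1#             : Carrier
    -- Total for convenience; unspecified at 0#.
    _⁻¹               : Op₁ Carrier
    isCommutativeRing : IsCommutativeRing _≈_ _+_ _*_ -_ 0# 1#
    isDecTotalOrder   : IsDecTotalOrder _≈_ _≤_
    1≉0               : ¬ 1# ≈ 0#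
    ⁻¹-inverseʳ       : ∀ x → ¬ x ≈ 0# → x * x ⁻¹ ≈ 1#
    +-monoˡ-≤         : ∀ z {x y} → x ≤ y → x + z ≤ y + z
    *-nonNegative     : ∀ {x y} → 0# ≤ x → 0# ≤ y → 0# ≤ x * y
    complete          : (P : Pred Carrier (c ⊔ ℓ₁ ⊔ ℓ₂)) →
                        ∃ P → ∃ (IsUpperBound _≤_ P) → ∃ (IsSupremum _≤_ P)

  commutativeRing : CommutativeRing c ℓ₁
  commutativeRing = record { isCommutativeRing = isCommutativeRing }

  decTotalOrder : DecTotalOrder c ℓ₁ ℓ₂
  decTotalOrder = record { isDecTotalOrder = isDecTotalOrder }

module Real {c ℓ₁ ℓ₂} (R : CompleteOrderedField c ℓ₁ ℓ₂) where

  open CompleteOrderedField R public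
    using (Carrier; _≈_; _≤_; _+_; _*_; -_; 0#; 1#; _⁻¹)
  open CommutativeRing (CompleteOrderedField.commutativeRing R) public
    using (_-_; semiring)
  open DecTotalOrder (CompleteOrderedField.decTotalOrder R) public
    using (_≤?_; totalOrder)
  open OrderProperties (CompleteOrderedField.decTotalOrder R) public
    using (_<_; <-strictTotalOrder)
  open StrictTotalOrder <-strictTotalOrder public
    using (_<?_)
  open Exp semiring public using (_^_)
  open Mult semiring using () renaming (_×_ to _·_)
  open Max totalOrder public using () renaming (_⊔_ to max)
  open Min totalOrder public using () renaming (_⊓_ to min)

  infix  4 _∈ᴬ_ _∈ᴬ?_
  infixl 7 _/_

  _/_ : Op₂ Carrier
  x / y = x * y ⁻¹

  ∣_∣ : Op₁ Carrier
  ∣ x ∣ = max x (- x)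

  fromℕ : ℕ → Carrier
  fromℕ n = n · 1#

  -- r = y ^ (1/3), for y ≥ 0.
  IsCubeRoot : Carrier → Carrier → Set (ℓ₁ ⊔ ℓ₂)
  IsCubeRoot y r = 0# ≤ r × r ^ 3 ≈ y

  -- Partitions of [a , b] into consecutive intervals, each with a tag in it.
  data TaggedPartition : Carrier → Carrier → Set (c ⊔ ℓ₁ ⊔ ℓ₂) where
    end  : ∀ {a b} → a ≈ b → TaggedPartition a b
    step : ∀ {a b} (m tag : Carrier) → a ≤ tag → tag ≤ m →
           TaggedPartition m b → TaggedPartition a b

  MeshBelow : Carrier → ∀ {a b} → TaggedPartition a b → Set (ℓ₁ ⊔ ℓ₂)
  MeshBelow δ (end _)              = ⊤
  MeshBelow δ (step {a} m _ _ _ P) = m - a < δ × MeshBelow δ P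

  riemannSum : (Carrier → Carrier) → ∀ {a b} → TaggedPartition a b → Carrier
  riemannSum f (end _)                = 0#
  riemannSum f (step {a} m tag _ _ P) = f tag * (m - a) + riemannSum f P

  -- f is Riemann integrable on [a , b] with integral v.
  IsIntegral : Carrier → Carrier → (Carrier → Carrier) → Carrier →
               Set (c ⊔ ℓ₁ ⊔ ℓ₂)
  IsIntegral a b f v =
    ∀ ε → 0# < ε → ∃[ δ ] 0# < δ ×
      (∀ (P : TaggedPartition a b) → MeshBelow δ P → ∣ riemannSum f P - v ∣ < ε)

  -- ℝ/ℤ, each class being given by its representative in [0 , 1).
  record 𝕋 : Set (c ⊔ ℓ₁ ⊔ ℓ₂) where
    field
      rep   : Carrier
      0≤rep : 0# ≤ rep
      rep<1 : rep < 1#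

  open 𝕋 public

  -- The difference of representatives lies in (-1 , 1), so the integer
  -- nearest to it is -1, 0 or 1.
  dist : 𝕋 → 𝕋 → Carrier
  dist x y = min ∣ d ∣ (min ∣ d - 1# ∣ ∣ d + 1# ∣)
    where d = rep x - rep y

  data Endpoint : Set where
    included excluded : Endpoint

  data Precedes (x y : Carrier) : Endpoint → Set (ℓ₁ ⊔ ℓ₂) where
    weakly   : x ≤ y → Precedes x y included
    strictly : x < y → Precedes x y excluded

  precedes? : ∀ x y e → Dec (Precedes x y e)
  precedes? x y included = map′ weakly (λ { (weakly p) → p }) (x ≤? y)
  precedes? x y excluded = map′ strictly (λ { (strictly p) → p }) (x <? y)

  -- The image in ℝ/ℤ of a real interval from rep start to rep start + ∣I∣,
  -- where each endpoint may or may not belong to the interval.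
  record Arc : Set (c ⊔ ℓ₁ ⊔ ℓ₂) where
    field
      start         : 𝕋
      arcLength     : Carrier
      0≤arcLength   : 0# ≤ arcLength
      arcLength≤1   : arcLength ≤ 1#
      left right    : Endpoint

  open Arc public

  InLift : Arc → Carrier → Set (ℓ₁ ⊔ ℓ₂)
  InLift I t = Precedes (rep (start I)) t (left I) ×
               Precedes t (rep (start I) + arcLength I) (right I)

  inLift? : ∀ I t → Dec (InLift I t)
  inLift? I t = precedes? _ _ (left I) ×-dec precedes? _ _ (right I)

  -- The real interval lies in [0 , 2), so only these two lifts can meet it.
  _∈ᴬ_ : 𝕋 → Arc → Set (ℓ₁ ⊔ ℓ₂)
  x ∈ᴬ I = InLift I (rep x) ⊎ InLift I (rep x + 1#)

  _∈ᴬ?_ : ∀ x I → Dec (x ∈ᴬ I)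
  x ∈ᴬ? I = inLift? I (rep x) ⊎-dec inLift? I (rep x + 1#)

  module _ {N : ℕ} (x : Fin N → 𝕋) where

    #In : Arc → ℕ
    #In I = length (filter (λ n → x n ∈ᴬ? I) (allFin N))

    arcDeviation : Arc → Carrier
    arcDeviation I = ∣ fromℕ (#In I) / fromℕ N - arcLength I ∣

    IsDiscrepancy : Carrier → Set (c ⊔ ℓ₁ ⊔ ℓ₂)
    IsDiscrepancy = IsSupremum _≤_ (λ y → ∃[ I ] y ≈ arcDeviation I)

    ClosePair : Carrier → Pred (Fin N × Fin N) ℓ₂
    ClosePair s (m , n) = m ≢ n × dist (x m) (x n) ≤ s / fromℕ N

    closePair? : ∀ s → Decidable (ClosePair s)
    closePair? s (m , n) =
      ¬? (m ≟ n) ×-dec (dist (x m) (x n) ≤? s / fromℕ N)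

    #ClosePairs : Carrier → ℕ
    #ClosePairs s =
      length (filter (closePair? s) (cartesianProduct (allFin N) (allFin N)))

    integrand : Carrier → Carrier
    integrand s =
      ∣ 1# / fromℕ N * fromℕ (#ClosePairs s) - fromℕ 2 * s ∣ ^ 2

    -- A = (2/N) ∫₀^{N/2} integrand
    IsMeanSquareDeviation : Carrier → Set (c ⊔ ℓ₁ ⊔ ℓ₂)
    IsMeanSquareDeviation A =
      ∃[ v ] IsIntegral 0# (fromℕ N / fromℕ 2) integrand v ×
             A ≈ fromℕ 2 / fromℕ N * v

{-# OPTIONS --safe #-}
-- Part (i): the number of points within r/N of a given point is the number of
-- points in an arc of length 2r/N, hence 2r up to N D; summing over the points
-- gives |F(r)/N − 2r| ≤ N D + 1 ≤ 2 N D.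
--
-- Part (ii): let f be the primitive of (counting measure − N × length), which
-- is well defined on the circle, and let Q(w) = ∫ (f(x + w) − f(x))² dx. The
-- derivative of Q at w is the pair-correlation deviation at distance w (up to
-- the diagonal), so a small A makes Q(w)/w small for every w. Comparing the
-- means of f over windows of length w and 2w costs at most √(Q(w)/w), and these
-- costs decay geometrically away from the scale w ~ D. Telescoping up to the
-- whole circle, where the mean no longer depends on the position of the window,
-- shows that the means of f at scale D almost agree. As f decreases at a bounded
-- rate, f itself then varies by less than N D / 2, which contradicts the
-- definition of D. The integrals are replaced by sums over a fine grid, to which
-- the points are rounded down.
module Submission where

open import Defs
open import Algebra.Bundles using (CommutativeRing)
import Algebra.Construct.NaturalChoice.MaxOp as MaxOp
import Algebra.Construct.NaturalChoice.MinOp as MinOp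
import Algebra.Construct.NaturalChoice.Max as Max
import Algebra.Construct.NaturalChoice.Min as Min
import Algebra.Properties.Ring as RingProperties
import Algebra.Properties.AbelianGroup as AbelianGroupProperties
import Algebra.Properties.Semiring.Mult as Mult
import Algebra.Properties.Semiring.Mult.TCOptimised as Mult′
import Algebra.Properties.Semiring.Sum as Sum
import Algebra.Properties.CommutativeMonoid.Sum as CommutativeMonoidSum
open import Algebra.Solver.Ring.AlmostCommutativeRing
  using (_-Raw-AlmostCommutative⟶_; fromCommutativeRing)
import Algebra.Solver.Ring as RingSolver
open import Data.Bool.Base using (if_then_else_)
open import Data.Empty using (⊥)
open import Data.Fin.Base as Fin using (Fin; toℕ)
import Data.Fin.Properties as Fin
open import Data.Integer.Base as ℤ using (ℤ; +_; -[1+_])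
import Data.Integer.Properties as ℤ
open import Data.List.Base as List using (List)
import Data.List.Properties as List
open import Data.Maybe.Base using (Maybe; just; nothing)
open import Data.Nat.Base as ℕ using (ℕ; zero; suc; z≤n; s≤s)
open import Data.Nat.DivMod using (_%_; [m+n]%n≡m%n; m<n⇒m%n≡m; m≡m%n+[m/n]*n; m<n*o⇒m/o<n)
import Data.Nat.DivMod as ℕ using (_/_)
import Data.Nat.Properties as ℕ
import Data.Nat.Solver as ℕ-Solver
open import Data.Product.Base using (∃-syntax; _×_; _,_; proj₁; proj₂)
open import Data.Sum.Base using (_⊎_; inj₁; inj₂; [_,_]′)
open import Data.Unit.Polymorphic.Base using (tt)
open import Function.Base using (_∘_; id)
open import Level using (Lift; lift; _⊔_)
open import Relation.Binary.Bundles using (DecTotalOrder)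
open import Relation.Binary.PropositionalEquality.Core as ≡ using (_≡_)
import Relation.Binary.Properties.DecTotalOrder as OrderProperties
import Relation.Binary.Reasoning.PartialOrder as PartialOrderReasoning
open import Relation.Nullary.Decidable.Core using (Dec; does; yes; no; decidable-stable)
open import Relation.Nullary.Negation.Core using (¬_; contradiction)
open import Relation.Unary using (Pred; Decidable)

-- The exponents come from one balance. Let `Y` be the sum of the squared deviations over the grid.
-- By Cauchy-Schwarz, Q(w)/w is of order M² N √(Y/w), so the cost √(Q(w)/w) falls like 2^(-k/4)
-- along the doublings, and a geometric ratio between 2^(-1/4) and 1 dominates it; 7/8 is one. The
-- costs add up to the order of M N D if the first one, at w of order D M, is of that order, which
-- asks for `Y` of order M N² D⁵: hence D⁵. The diagonal and the rounding add at most 2 to each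
-- deviation. This is absorbed while the deviation granted at scale k, N e² ρ^(2k), is at least 8; N
-- e³ ≥ 4 ensures it at every scale, hence the threshold N^(-1/3). Only upper bounds for Q are
-- wanted, so rounding may be one-sided: cells that differ by at most w hold points at distance at
-- most (w + 1)/M. Constants: e = D/64. The geometric sum and the descent of f over two windows each
-- give 8 M N e, so f rises by at most 16 M N e; rounding the ends of an arc adds as much again, and
-- 32 e = D/2 contradicts that D is the supremum.

module IntegerCoefficients {c ℓ} (R : CommutativeRing c ℓ) where

  open CommutativeRing R
  open RingProperties ring using (-‿distribˡ-*; -‿distribʳ-*)
  open AbelianGroupProperties +-abelianGroup
    using () renaming (⁻¹-involutive to -‿involutive; ε⁻¹≈ε to -0≈0; ⁻¹-∙-comm to -‿+-comm)
  open Mult′ semiring using (×-homo-+; ×1-homo-*; 1+×) renaming (_×_ to _·′_)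
  open import Relation.Binary.Reasoning.Setoid setoid

  -- With these optimised multiples `fromℤ (+ 1)` and `fromℤ (+ 2)` compute to `1#` and `1# + 1#`,
  -- so solver constants agree definitionally with `1#` and `2#`. In contrast `fromℕ 2` computes to
  -- `1# + (1# + 0#)` and is spelled out in that form in solver calls.
  fromℤ : ℤ → Carrier
  fromℤ (+ n)    = n ·′ 1#
  fromℤ -[1+ n ] = - (suc n ·′ 1#)

  fromℤ-⊖ : ∀ m n → fromℤ (m ℤ.⊖ n) ≈ m ·′ 1# - n ·′ 1#
  fromℤ-⊖ m zero = sym (trans (+-congˡ -0≈0) (+-identityʳ _))
  fromℤ-⊖ zero (suc n) = sym (+-identityˡ _)
  fromℤ-⊖ (suc m) (suc n) = begin
    fromℤ (suc m ℤ.⊖ suc n)                ≡⟨ ≡.cong fromℤ (ℤ.[1+m]⊖[1+n]≡m⊖n m n) ⟩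
    fromℤ (m ℤ.⊖ n)                        ≈⟨ fromℤ-⊖ m n ⟩
    m ·′ 1# - n ·′ 1#                      ≈⟨ +-congʳ (sym (trans (+-congʳ (-‿inverseʳ 1#)) (+-identityˡ _))) ⟩
    ((1# - 1#) + m ·′ 1#) - n ·′ 1#        ≈⟨ +-congʳ (trans (+-assoc _ _ _) (trans (+-congˡ (+-comm _ _)) (sym (+-assoc _ _ _)))) ⟩
    ((1# + m ·′ 1#) - 1#) - n ·′ 1#        ≈⟨ +-assoc _ _ _ ⟩
    (1# + m ·′ 1#) + (- 1# - n ·′ 1#)      ≈⟨ +-congˡ (-‿+-comm _ _) ⟩
    (1# + m ·′ 1#) - (1# + n ·′ 1#)        ≈⟨ +-cong (sym (1+× m 1#)) (-‿cong (sym (1+× n 1#))) ⟩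
    suc m ·′ 1# - suc n ·′ 1#              ∎

  fromℤ-neg : ∀ i → fromℤ (ℤ.- i) ≈ - fromℤ i
  fromℤ-neg (+ zero)   = sym -0≈0
  fromℤ-neg (+ suc n)  = refl
  fromℤ-neg -[1+ n ]   = sym (-‿involutive _)

  fromℤ-+ : ∀ i j → fromℤ (i ℤ.+ j) ≈ fromℤ i + fromℤ j
  fromℤ-+ (+ m) (+ n)       = ×-homo-+ 1# m n
  fromℤ-+ (+ m) -[1+ n ]    = fromℤ-⊖ m (suc n)
  fromℤ-+ -[1+ m ] (+ n)    = trans (fromℤ-⊖ n (suc m)) (+-comm _ _)
  fromℤ-+ -[1+ m ] -[1+ n ] = begin
    - (suc (suc (m ℕ.+ n)) ·′ 1#)      ≡⟨ ≡.cong (λ k → - (suc k ·′ 1#)) (≡.sym (ℕ.+-suc m n)) ⟩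
    - ((suc m ℕ.+ suc n) ·′ 1#)        ≈⟨ -‿cong (×-homo-+ 1# (suc m) (suc n)) ⟩
    - (suc m ·′ 1# + suc n ·′ 1#)      ≈⟨ sym (-‿+-comm _ _) ⟩
    - (suc m ·′ 1#) - suc n ·′ 1#      ∎

  fromℤ-pos-* : ∀ m n → fromℤ (+ m ℤ.* + n) ≈ fromℤ (+ m) * fromℤ (+ n)
  fromℤ-pos-* m n = trans (reflexive (≡.cong fromℤ (≡.sym (ℤ.pos-* m n)))) (×1-homo-* m n)

  fromℤ-* : ∀ i j → fromℤ (i ℤ.* j) ≈ fromℤ i * fromℤ j
  fromℤ-* (+ m) (+ n) = fromℤ-pos-* m n
  fromℤ-* (+ m) -[1+ n ] = begin
    fromℤ (+ m ℤ.* ℤ.- (+ suc n))      ≡⟨ ≡.cong fromℤ (≡.sym (ℤ.neg-distribʳ-* (+ m) (+ suc n))) ⟩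
    fromℤ (ℤ.- (+ m ℤ.* + suc n))      ≈⟨ fromℤ-neg (+ m ℤ.* + suc n) ⟩
    - fromℤ (+ m ℤ.* + suc n)          ≈⟨ -‿cong (fromℤ-pos-* m (suc n)) ⟩
    - (m ·′ 1# * suc n ·′ 1#)          ≈⟨ -‿distribʳ-* _ _ ⟩
    m ·′ 1# * - (suc n ·′ 1#)          ∎
  fromℤ-* -[1+ m ] j = begin
    fromℤ (ℤ.- (+ suc m) ℤ.* j)        ≡⟨ ≡.cong fromℤ (≡.sym (ℤ.neg-distribˡ-* (+ suc m) j)) ⟩
    fromℤ (ℤ.- (+ suc m ℤ.* j))        ≈⟨ fromℤ-neg (+ suc m ℤ.* j) ⟩
    - fromℤ (+ suc m ℤ.* j)            ≈⟨ -‿cong (lemma j) ⟩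
    - (suc m ·′ 1# * fromℤ j)          ≈⟨ -‿distribˡ-* _ _ ⟩
    - (suc m ·′ 1#) * fromℤ j          ∎
    where
    lemma : ∀ j → fromℤ (+ suc m ℤ.* j) ≈ fromℤ (+ suc m) * fromℤ j
    lemma (+ n)    = fromℤ-* (+ suc m) (+ n)
    lemma -[1+ n ] = fromℤ-* (+ suc m) -[1+ n ]

  morphism : ℤ.+-*-rawRing -Raw-AlmostCommutative⟶ fromCommutativeRing R
  morphism = record
    { ⟦_⟧    = fromℤ
    ; +-homo = fromℤ-+
    ; *-homo = fromℤ-*
    ; -‿homo = fromℤ-neg
    ; 0-homo = refl
    ; 1-homo = refl
    }

  fromℤ-≟ : ∀ i j → Maybe (fromℤ i ≈ fromℤ j)
  fromℤ-≟ i j with i ℤ.≟ j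
  ... | yes i≡j = just (reflexive (≡.cong fromℤ i≡j))
  ... | no _    = nothing

  open RingSolver ℤ.+-*-rawRing (fromCommutativeRing R) morphism fromℤ-≟ public
    using (solve; _:=_; con) renaming (_:+_ to infixl 6 _⊕_; _:*_ to infixl 7 _⊗_; _:-_ to infixl 6 _⊖_; :-_ to infix 8 ⊝_)

-- Arithmetic, counting and finite sums in the complete ordered field.

module OrderedField {c ℓ₁ ℓ₂} (R : CompleteOrderedField c ℓ₁ ℓ₂) where

  open CompleteOrderedField R public
    using (commutativeRing; decTotalOrder; 1≉0; ⁻¹-inverseʳ; +-monoˡ-≤; *-nonNegative; complete)
  open Real R public
  open CommutativeRing commutativeRing public
    using ( +-cong; +-congˡ; +-congʳ; *-cong; *-congˡ; *-congʳ; -‿cong; +-comm; *-comm; +-assoc; *-assoc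
          ; +-identityˡ; +-identityʳ; *-identityˡ; *-identityʳ; zeroˡ; zeroʳ; -‿inverseʳ; distribˡ; distribʳ; +-commutativeMonoid)
    renaming (refl to ≈-refl; sym to ≈-sym; trans to ≈-trans; reflexive to ≈-reflexive)
  open DecTotalOrder decTotalOrder public
    using (poset; antisym) renaming (refl to ≤-refl; trans to ≤-trans; total to ≤-total; reflexive to ≤-reflexive)
  open OrderProperties decTotalOrder public
    using (≰⇒>; <⇒≱)
  open IntegerCoefficients commutativeRing public
  open PartialOrderReasoning poset public hiding (start; stop; step-≈)
  open Mult semiring public using (×-homo-+; ×1-homo-*)
  open Sum semiring public using (sum; sum-cong-≋; *-distribˡ-sum; *-distribʳ-sum)
  open CommutativeMonoidSum +-commutativeMonoid public using (∑-distrib-+; ∑-comm)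

  <⇒≤ : ∀ {x y} → x < y → x ≤ y
  <⇒≤ = proj₁

  2# : Carrier
  2# = 1# + 1#

  ≤-by : ∀ {x y p} → 0# ≤ p → y ≈ x + p → x ≤ y
  ≤-by {x} {y} {p} 0≤p y≈x+p = begin
    x       ≈⟨ +-identityˡ x ⟨
    0# + x  ≤⟨ +-monoˡ-≤ x 0≤p ⟩
    p + x   ≈⟨ +-comm p x ⟩
    x + p   ≈⟨ y≈x+p ⟨
    y       ∎

  ⟨_⟩ : ∀ {x y} → x ≤ y → 0# ≤ y - x
  ⟨_⟩ {x} {y} x≤y = begin
    0#     ≈⟨ -‿inverseʳ x ⟨
    x - x  ≤⟨ +-monoˡ-≤ (- x) x≤y ⟩
    y - x  ∎

  0≤+ : ∀ {x y} → 0# ≤ x → 0# ≤ y → 0# ≤ x + y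
  0≤+ {x} {y} 0≤x 0≤y = ≤-trans 0≤y (≤-by 0≤x (+-comm x y))

  +-mono-≤ : ∀ {x y u v} → x ≤ y → u ≤ v → x + u ≤ y + v
  +-mono-≤ {x} {y} {u} {v} x≤y u≤v = ≤-by (0≤+ ⟨ x≤y ⟩ ⟨ u≤v ⟩)
    (solve 4 (λ x y u v → y ⊕ v := (x ⊕ u) ⊕ ((y ⊖ x) ⊕ (v ⊖ u))) ≈-refl x y u v)

  *-monoˡ-≤ : ∀ {z x y} → 0# ≤ z → x ≤ y → z * x ≤ z * y
  *-monoˡ-≤ {z} {x} {y} 0≤z x≤y = ≤-by (*-nonNegative 0≤z ⟨ x≤y ⟩)
    (solve 3 (λ x y z → z ⊗ y := z ⊗ x ⊕ z ⊗ (y ⊖ x)) ≈-refl x y z)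

  *-monoʳ-≤ : ∀ {z x y} → 0# ≤ z → x ≤ y → x * z ≤ y * z
  *-monoʳ-≤ {z} {x} {y} 0≤z x≤y = begin
    x * z  ≈⟨ *-comm x z ⟩
    z * x  ≤⟨ *-monoˡ-≤ 0≤z x≤y ⟩
    z * y  ≈⟨ *-comm z y ⟩
    y * z  ∎

  *-mono-≤ : ∀ {x y u v} → 0# ≤ x → 0# ≤ u → x ≤ y → u ≤ v → x * u ≤ y * v
  *-mono-≤ 0≤x 0≤u x≤y u≤v = ≤-trans (*-monoʳ-≤ 0≤u x≤y) (*-monoˡ-≤ (≤-trans 0≤x x≤y) u≤v)

  neg-mono-≤ : ∀ {x y} → x ≤ y → - y ≤ - x
  neg-mono-≤ {x} {y} x≤y = ≤-by ⟨ x≤y ⟩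
    (solve 2 (λ x y → ⊝ x := ⊝ y ⊕ (y ⊖ x)) ≈-refl x y)

  0≤x² : ∀ x → 0# ≤ x * x
  0≤x² x with ≤-total 0# x
  ... | inj₁ 0≤x = *-nonNegative 0≤x 0≤x
  ... | inj₂ x≤0 = ≤-trans (*-nonNegative ⟨ x≤0 ⟩ ⟨ x≤0 ⟩)
    (≤-reflexive (solve 1 (λ x → (con (+ 0) ⊖ x) ⊗ (con (+ 0) ⊖ x) := x ⊗ x) ≈-refl x))

  0≤1 : 0# ≤ 1#
  0≤1 = ≤-trans (0≤x² 1#) (≤-reflexive (*-identityˡ 1#))

  0<1 : 0# < 1#
  0<1 = 0≤1 , λ 0≈1 → 1≉0 (≈-sym 0≈1)

  0≤2 : 0# ≤ 2#
  0≤2 = 0≤+ 0≤1 0≤1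

  0<+ : ∀ {x y} → 0# < x → 0# ≤ y → 0# < x + y
  0<+ {x} {y} 0<x 0≤y = ≰⇒> λ x+y≤0 → <⇒≱ 0<x (≤-trans (≤-by 0≤y ≈-refl) x+y≤0)

  0<2 : 0# < 2#
  0<2 = 0<+ 0<1 0≤1

  0<y-x : ∀ {x y} → x < y → 0# < y - x
  0<y-x {x} {y} x<y = ≰⇒> λ y-x≤0 → <⇒≱ x<y (≤-by ⟨ y-x≤0 ⟩
    (solve 2 (λ x y → x := y ⊕ (con (+ 0) ⊖ (y ⊖ x))) ≈-refl x y))

  <-by : ∀ {x y p} → 0# < p → y ≈ x + p → x < y
  <-by {x} {y} {p} 0<p y≈x+p = ≰⇒> λ y≤x → <⇒≱ 0<p (≤-by ⟨ y≤x ⟩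
    (≈-trans (solve 2 (λ x p → con (+ 0) := p ⊕ (x ⊖ (x ⊕ p))) ≈-refl x p)
             (+-congˡ (+-congˡ (-‿cong (≈-sym y≈x+p))))))

  <-≤-trans : ∀ {x y z} → x < y → y ≤ z → x < z
  <-≤-trans x<y y≤z = ≰⇒> λ z≤x → <⇒≱ x<y (≤-trans y≤z z≤x)

  ≤-<-trans : ∀ {x y z} → x ≤ y → y < z → x < z
  ≤-<-trans x≤y y<z = ≰⇒> λ z≤x → <⇒≱ y<z (≤-trans z≤x x≤y)

  >⇒≉0 : ∀ {x} → 0# < x → ¬ x ≈ 0#
  >⇒≉0 0<x x≈0 = proj₂ 0<x (≈-sym x≈0)

  *-inverseʳ : ∀ {x} → 0# < x → x * x ⁻¹ ≈ 1#
  *-inverseʳ 0<x = ⁻¹-inverseʳ _ (>⇒≉0 0<x)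

  0<⁻¹ : ∀ {x} → 0# < x → 0# < x ⁻¹
  0<⁻¹ {x} 0<x = ≰⇒> λ x⁻¹≤0 → <⇒≱ 0<1 (begin
    1#         ≈⟨ *-inverseʳ 0<x ⟨
    x * x ⁻¹   ≤⟨ *-monoˡ-≤ (<⇒≤ 0<x) x⁻¹≤0 ⟩
    x * 0#     ≈⟨ zeroʳ x ⟩
    0#         ∎)

  *-cancelˡ-≤ : ∀ {z x y} → 0# < z → z * x ≤ z * y → x ≤ y
  *-cancelˡ-≤ {z} {x} {y} 0<z zx≤zy = begin
    x               ≈⟨ lemma x ⟩
    z ⁻¹ * (z * x)  ≤⟨ *-monoˡ-≤ (<⇒≤ (0<⁻¹ 0<z)) zx≤zy ⟩
    z ⁻¹ * (z * y)  ≈⟨ lemma y ⟨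
    y               ∎
    where
    lemma : ∀ x → x ≈ z ⁻¹ * (z * x)
    lemma x = begin-equality
      x               ≈⟨ *-identityˡ x ⟨
      1# * x          ≈⟨ *-congʳ (*-inverseʳ 0<z) ⟨
      (z * z ⁻¹) * x  ≈⟨ solve 3 (λ z w x → (z ⊗ w) ⊗ x := w ⊗ (z ⊗ x)) ≈-refl z (z ⁻¹) x ⟩
      z ⁻¹ * (z * x)  ∎

  0<* : ∀ {x y} → 0# < x → 0# < y → 0# < x * y
  0<* {x} {y} 0<x 0<y = ≰⇒> λ xy≤0 → <⇒≱ 0<y (*-cancelˡ-≤ 0<x (≤-trans xy≤0 (≤-reflexive (≈-sym (zeroʳ x)))))

  *-cancelˡ-< : ∀ {z x y} → 0# ≤ z → z * x < z * y → x < y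
  *-cancelˡ-< 0≤z zx<zy = ≰⇒> λ y≤x → <⇒≱ zx<zy (*-monoˡ-≤ 0≤z y≤x)

  *-monoˡ-< : ∀ {z x y} → 0# < z → x < y → z * x < z * y
  *-monoˡ-< 0<z x<y = ≰⇒> λ zy≤zx → <⇒≱ x<y (*-cancelˡ-≤ 0<z zy≤zx)

  /-*-cancel : ∀ {n} → 0# < n → ∀ x → n * (x / n) ≈ x
  /-*-cancel {n} 0<n x = begin-equality
    n * (x * n ⁻¹)  ≈⟨ solve 3 (λ n x m → n ⊗ (x ⊗ m) := (n ⊗ m) ⊗ x) ≈-refl n x (n ⁻¹) ⟩
    (n * n ⁻¹) * x  ≈⟨ *-congʳ (*-inverseʳ 0<n) ⟩
    1# * x          ≈⟨ *-identityˡ x ⟩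
    x               ∎

  open Max totalOrder using (maxOperator)
  open Min totalOrder using (minOperator)
  open MaxOp maxOperator public using () renaming (⊔-sel to max-sel)
  open MinOp minOperator public using (x⊓y≤x; x⊓y≤y) renaming (⊓-sel to min-sel)

  x≤∣x∣ : ∀ x → x ≤ ∣ x ∣
  x≤∣x∣ x = MaxOp.x≤x⊔y maxOperator x (- x)

  -x≤∣x∣ : ∀ x → - x ≤ ∣ x ∣
  -x≤∣x∣ x = MaxOp.x≤y⊔x maxOperator x (- x)

  ∣∣-sel : ∀ x → (∣ x ∣ ≈ x) ⊎ (∣ x ∣ ≈ - x)
  ∣∣-sel x = max-sel x (- x)

  ∣x∣≤ : ∀ {x y} → x ≤ y → - x ≤ y → ∣ x ∣ ≤ y
  ∣x∣≤ {x} x≤y -x≤y with ∣∣-sel x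
  ... | inj₁ e = ≤-trans (≤-reflexive e) x≤y
  ... | inj₂ e = ≤-trans (≤-reflexive e) -x≤y

  x^2≈x*x : ∀ x → x ^ 2 ≈ x * x
  x^2≈x*x x = *-congˡ (*-identityʳ x)

  ∣x∣^2≈x*x : ∀ x → ∣ x ∣ ^ 2 ≈ x * x
  ∣x∣^2≈x*x x with ∣∣-sel x
  ... | inj₁ e = ≈-trans (x^2≈x*x ∣ x ∣) (*-cong e e)
  ... | inj₂ e = ≈-trans (x^2≈x*x ∣ x ∣) (≈-trans (*-cong e e)
    (solve 1 (λ x → (⊝ x) ⊗ (⊝ x) := x ⊗ x) ≈-refl x))

  fromℕ-+ : ∀ m n → fromℕ (m ℕ.+ n) ≈ fromℕ m + fromℕ n
  fromℕ-+ = ×-homo-+ 1#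

  fromℕ-* : ∀ m n → fromℕ (m ℕ.* n) ≈ fromℕ m * fromℕ n
  fromℕ-* = ×1-homo-*

  fromℕ-1 : fromℕ 1 ≈ 1#
  fromℕ-1 = +-identityʳ 1#

  fromℕ-2 : fromℕ 2 ≈ 2#
  fromℕ-2 = +-congˡ fromℕ-1

  0≤fromℕ : ∀ n → 0# ≤ fromℕ n
  0≤fromℕ zero    = ≤-refl
  0≤fromℕ (suc n) = 0≤+ 0≤1 (0≤fromℕ n)

  0<fromℕ : ∀ {n} → 1 ℕ.≤ n → 0# < fromℕ n
  0<fromℕ {suc n} _ = 0<+ 0<1 (0≤fromℕ n)

  fromℕ-mono : ∀ {m n} → m ℕ.≤ n → fromℕ m ≤ fromℕ n
  fromℕ-mono {n = n} z≤n = 0≤fromℕ n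
  fromℕ-mono (s≤s m≤n)   = +-mono-≤ ≤-refl (fromℕ-mono m≤n)

  fromℕ-cancel-< : ∀ {m n} → fromℕ m < fromℕ n → m ℕ.< n
  fromℕ-cancel-< m<n = ℕ.≰⇒> λ n≤m → <⇒≱ m<n (fromℕ-mono n≤m)

  -- If the naturals were bounded they would have a supremum s; as n + 1 ≤ s for every n, s - 1
  -- would be a smaller upper bound. `Lift` only adjusts the universe level to the one that
  -- `complete` asks for.
  ¬¬-archimedean : ∀ x → ¬ (∀ n → fromℕ n ≤ x)
  ¬¬-archimedean x bounded = <⇒≱ (<-by 0<1 (solve 1 (λ s → s := s ⊖ con (+ 1) ⊕ con (+ 1)) ≈-refl s)) (least (s - 1#) upper)
    where
    IsNatural : Pred Carrier (c ⊔ ℓ₁ ⊔ ℓ₂)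
    IsNatural y = Lift (c ⊔ ℓ₂) (∃[ n ] y ≈ fromℕ n)

    sup = complete IsNatural (0# , lift (0 , ≈-refl)) (x , λ { y (lift (n , e)) → ≤-trans (≤-reflexive e) (bounded n) })
    s = proj₁ sup
    least = proj₂ (proj₂ sup)

    upper : ∀ y → IsNatural y → y ≤ s - 1#
    upper y (lift (n , y≈n)) = ≤-by ⟨ proj₁ (proj₂ sup) (fromℕ (suc n)) (lift (suc n , ≈-refl)) ⟩
      (≈-trans (solve 2 (λ s n → s ⊖ con (+ 1) := n ⊕ (s ⊖ (con (+ 1) ⊕ n))) ≈-refl s (fromℕ n))
        (+-congʳ (≈-sym y≈n)))

  -- The explicit bound `K` makes this a descent along decidable comparisons. So floors are actual
  -- numbers, although the archimedean property is available only as a refutation.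
  floor : ∀ K y → 0# ≤ y → y < fromℕ K → ∃[ i ] i ℕ.< K × fromℕ i ≤ y × y < fromℕ (suc i)
  floor zero    y 0≤y y<0 = contradiction 0≤y (<⇒≱ y<0)
  floor (suc K) y 0≤y y<K with fromℕ K ≤? y
  ... | yes K≤y = K , ℕ.≤-refl , K≤y , y<K
  ... | no  K≰y with floor K y 0≤y (≰⇒> K≰y)
  ...   | i , i<K , i≤y , y<1+i = i , ℕ.m<n⇒m<1+n i<K , i≤y , y<1+i

  indicator : ∀ {p} {P : Set p} → Dec P → Carrier
  indicator P? = if does P? then 1# else 0#

  0≤indicator : ∀ {p} {P : Set p} (P? : Dec P) → 0# ≤ indicator P?
  0≤indicator (yes _) = 0≤1
  0≤indicator (no  _) = ≤-refl

  indicator≤1 : ∀ {p} {P : Set p} (P? : Dec P) → indicator P? ≤ 1#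
  indicator≤1 (yes _) = ≤-refl
  indicator≤1 (no  _) = 0≤1

  indicator-mono : ∀ {p q} {P : Set p} {Q : Set q} (P? : Dec P) (Q? : Dec Q) →
                   (P → Q) → indicator P? ≤ indicator Q?
  indicator-mono (no _)  Q?      _   = 0≤indicator Q?
  indicator-mono (yes _) (yes _) _   = ≤-refl
  indicator-mono (yes p) (no ¬q) P⇒Q = contradiction (P⇒Q p) ¬q

  sum-mono : ∀ {n} {f g : Fin n → Carrier} → (∀ i → f i ≤ g i) → sum f ≤ sum g
  sum-mono {zero}  f≤g = ≤-refl
  sum-mono {suc n} f≤g = +-mono-≤ (f≤g Fin.zero) (sum-mono (f≤g ∘ Fin.suc))

  sum-const : ∀ n x → sum {n} (λ _ → x) ≈ fromℕ n * x
  sum-const zero    x = ≈-sym (zeroˡ x)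
  sum-const (suc n) x = ≈-trans (+-congˡ (sum-const n x))
    (solve 2 (λ n x → x ⊕ n ⊗ x := (con (+ 1) ⊕ n) ⊗ x) ≈-refl (fromℕ n) x)

  0≤sum : ∀ {n} {f : Fin n → Carrier} → (∀ i → 0# ≤ f i) → 0# ≤ sum f
  0≤sum {zero}  0≤f = ≤-refl
  0≤sum {suc n} 0≤f = 0≤+ (0≤f Fin.zero) (0≤sum (0≤f ∘ Fin.suc))

  sum-term : ∀ {k} {g : Fin k → Carrier} → (∀ b → 0# ≤ g b) → ∀ a → g a ≤ sum g
  sum-term 0≤g Fin.zero    = ≤-by (0≤sum (0≤g ∘ Fin.suc)) ≈-refl
  sum-term 0≤g (Fin.suc a) = ≤-trans (sum-term (0≤g ∘ Fin.suc) a) (≤-by (0≤g Fin.zero) (+-comm _ _))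

  sum-diagonal : ∀ {n} (a : Fin n) → sum (λ b → indicator (a Fin.≟ b)) ≈ 1#
  sum-diagonal {suc n} Fin.zero = ≈-trans (+-congˡ (≈-trans (sum-const n 0#) (zeroʳ _))) (+-identityʳ 1#)
  sum-diagonal (Fin.suc a) = ≈-trans (+-identityˡ _) (sum-diagonal a)

  sum-indicator : ∀ {a p} {A : Set a} {P : Pred A p} (P? : Decidable P) {n} (g : Fin n → A) →
                  fromℕ (List.length (List.filter P? (List.tabulate g))) ≈ sum (λ i → indicator (P? (g i)))
  sum-indicator P? {zero}  g = ≈-refl
  sum-indicator P? {suc n} g with P? (g Fin.zero)
  ... | yes _ = +-congˡ (sum-indicator P? (g ∘ Fin.suc))
  ... | no  _ = ≈-trans (sum-indicator P? (g ∘ Fin.suc)) (≈-sym (+-identityˡ _))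

  sum-indicator₂ : ∀ {a p} {A B : Set a} {P : Pred (A × B) p} (P? : Decidable P)
                   {m n} (g : Fin m → A) (h : Fin n → B) →
                   fromℕ (List.length (List.filter P? (List.cartesianProduct (List.tabulate g) (List.tabulate h))))
                   ≈ sum (λ i → sum (λ j → indicator (P? (g i , h j))))
  sum-indicator₂ P? {zero}  g h = ≈-refl
  sum-indicator₂ P? {suc m} {n} g h = begin-equality
    fromℕ (len (row List.++ rest))             ≡⟨ ≡.cong (fromℕ ∘ List.length) (List.filter-++ P? row rest) ⟩
    fromℕ (List.length (List.filter P? row List.++ List.filter P? rest))
                                               ≡⟨ ≡.cong fromℕ (List.length-++ (List.filter P? row)) ⟩
    fromℕ (len row ℕ.+ len rest)               ≈⟨ fromℕ-+ (len row) (len rest) ⟩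
    fromℕ (len row) + fromℕ (len rest)         ≡⟨ ≡.cong (λ l → fromℕ (len l) + fromℕ (len rest)) (List.map-tabulate h (g Fin.zero ,_)) ⟩
    fromℕ (len (List.tabulate (λ j → g Fin.zero , h j))) + fromℕ (len rest)
                                               ≈⟨ +-cong (sum-indicator P? (λ j → g Fin.zero , h j)) (sum-indicator₂ P? (g ∘ Fin.suc) h) ⟩
    _                                          ∎
    where
    len = λ l → List.length (List.filter P? l)
    row = List.map (g Fin.zero ,_) (List.tabulate h)
    rest = List.cartesianProduct (List.tabulate (g ∘ Fin.suc)) (List.tabulate h)

-- Sums over initial segments of ℕ.

module RangeSums {c ℓ₁ ℓ₂} (R : CompleteOrderedField c ℓ₁ ℓ₂) where

  open OrderedField R

  Σ< : ℕ → (ℕ → Carrier) → Carrier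
  Σ< n f = sum {n} (f ∘ toℕ)

  Σ<-cong : ∀ n {f g} → (∀ x → x ℕ.< n → f x ≈ g x) → Σ< n f ≈ Σ< n g
  Σ<-cong n f≈g = sum-cong-≋ {n} λ i → f≈g (toℕ i) (Fin.toℕ<n i)

  Σ<-mono : ∀ n {f g} → (∀ x → x ℕ.< n → f x ≤ g x) → Σ< n f ≤ Σ< n g
  Σ<-mono n f≤g = sum-mono {n} λ i → f≤g (toℕ i) (Fin.toℕ<n i)

  sum-sub : ∀ {n} (f g : Fin n → Carrier) → sum (λ i → f i - g i) ≈ sum f - sum g
  sum-sub {zero}  f g = solve 0 (con (+ 0) := con (+ 0) ⊖ con (+ 0)) ≈-refl
  sum-sub {suc n} f g = ≈-trans (+-congˡ (sum-sub (f ∘ Fin.suc) (g ∘ Fin.suc)))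
    (solve 4 (λ a b u v → (a ⊖ b) ⊕ (u ⊖ v) := (a ⊕ u) ⊖ (b ⊕ v)) ≈-refl
      (f Fin.zero) (g Fin.zero) (sum (f ∘ Fin.suc)) (sum (g ∘ Fin.suc)))

  Σ<-++ : ∀ m n f → Σ< (m ℕ.+ n) f ≈ Σ< m f + Σ< n (λ x → f (m ℕ.+ x))
  Σ<-++ zero    n f = ≈-sym (+-identityˡ _)
  Σ<-++ (suc m) n f = ≈-trans (+-congˡ (Σ<-++ m n (f ∘ suc))) (≈-sym (+-assoc _ _ _))

  Σ<-last : ∀ n f → Σ< (suc n) f ≈ Σ< n f + f n
  Σ<-last zero    f = +-comm _ _
  Σ<-last (suc n) f = ≈-trans (+-congˡ (Σ<-last n (f ∘ suc))) (≈-sym (+-assoc _ _ _))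

  Σ<-δ : ∀ n j (h : ℕ → Carrier) → j ℕ.< n → Σ< n (λ x → indicator (x ℕ.≟ j) * h x) ≈ h j
  Σ<-δ (suc n) zero h _ = begin-equality
    1# * h 0 + Σ< n (λ x → 0# * h (suc x))  ≈⟨ +-cong (*-identityˡ _) (≈-trans (Σ<-cong n (λ x _ → zeroˡ (h (suc x)))) (≈-trans (sum-const n 0#) (zeroʳ _))) ⟩
    h 0 + 0#                                ≈⟨ +-identityʳ _ ⟩
    h 0                                     ∎
  Σ<-δ (suc n) (suc j) h (s≤s j<n) = begin-equality
    0# * h 0 + Σ< n (λ x → indicator (x ℕ.≟ j) * h (suc x))  ≈⟨ +-cong (zeroˡ _) (Σ<-δ n j (h ∘ suc) j<n) ⟩
    0# + h (suc j)                                           ≈⟨ +-identityˡ _ ⟩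
    h (suc j)                                                ∎

  -- A shift by one drops f 0 and adds f M, which are equal.
  Σ<-shift : ∀ {M} f → (∀ x → f (x ℕ.+ M) ≈ f x) → ∀ k → Σ< M (λ x → f (k ℕ.+ x)) ≈ Σ< M f
  Σ<-shift f periodic zero = ≈-refl
  Σ<-shift {M} f periodic (suc k) = ≈-trans (Σ<-shift (f ∘ suc) (periodic ∘ suc) k) (begin-equality
    Σ< M (f ∘ suc)                 ≈⟨ solve 2 (λ a s → s := (a ⊕ s) ⊖ a) ≈-refl (f 0) (Σ< M (f ∘ suc)) ⟩
    Σ< (suc M) f - f 0             ≈⟨ +-cong (Σ<-last M f) (-‿cong (≈-sym (periodic 0))) ⟩
    (Σ< M f + f M) - f M           ≈⟨ solve 2 (λ a s → (s ⊕ a) ⊖ a := s) ≈-refl (f M) (Σ< M f) ⟩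
    Σ< M f                         ∎)

-- Quadratic increments and window means of a periodic sequence.

module PeriodicFunction {c ℓ₁ ℓ₂} (R : CompleteOrderedField c ℓ₁ ℓ₂) (M : ℕ)
  (f : ℕ → CompleteOrderedField.Carrier R)
  (periodic : ∀ x → CompleteOrderedField._≈_ R (f (x ℕ.+ M)) (f x)) where

  open OrderedField R
  open RangeSums R

  increment : ℕ → ℕ → Carrier
  increment w x = f (w ℕ.+ x) - f x

  Q : ℕ → Carrier
  Q w = Σ< M (λ x → increment w x * increment w x)

  correlation : ℕ → Carrier
  correlation w = Σ< M (λ x → f x * f (w ℕ.+ x))

  periodic-+ : ∀ k x → f (k ℕ.+ (x ℕ.+ M)) ≈ f (k ℕ.+ x)
  periodic-+ k x = ≈-trans (≈-reflexive (≡.cong f (≡.sym (ℕ.+-assoc k x M)))) (periodic (k ℕ.+ x))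

  Q≈correlation : ∀ w → Q w ≈ 2# * Σ< M (λ x → f x * f x) - 2# * correlation w
  Q≈correlation w = begin-equality
    Q w  ≈⟨ Σ<-cong M (λ x _ → solve 2 (λ a b → (a ⊖ b) ⊗ (a ⊖ b)
          := a ⊗ a ⊕ (b ⊗ b ⊖ con (+ 2) ⊗ (b ⊗ a))) ≈-refl (f (w ℕ.+ x)) (f x)) ⟩
    Σ< M (λ x → f (w ℕ.+ x) * f (w ℕ.+ x) + (f x * f x - 2# * (f x * f (w ℕ.+ x))))
      ≈⟨ ∑-distrib-+ {M} _ _ ⟩
    Σ< M (λ x → f (w ℕ.+ x) * f (w ℕ.+ x)) + Σ< M (λ x → f x * f x - 2# * (f x * f (w ℕ.+ x)))
      ≈⟨ +-cong (Σ<-shift (λ x → f x * f x) (λ x → *-cong (periodic x) (periodic x)) w)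
                (≈-trans (sum-sub {M} _ _) (+-congˡ (-‿cong (≈-sym (*-distribˡ-sum {M} 2# _))))) ⟩
    S + (S - 2# * correlation w)
      ≈⟨ solve 2 (λ s c → s ⊕ (s ⊖ con (+ 2) ⊗ c) := con (+ 2) ⊗ s ⊖ con (+ 2) ⊗ c) ≈-refl S (correlation w) ⟩
    2# * S - 2# * correlation w  ∎
    where S = Σ< M (λ x → f x * f x)

  -- Here `v` stands for -w modulo M. The four products on the right are, after shifts, the
  -- correlations at w, w + 1, w + 1 and w, so the right side is twice the drop of the correlation.
  -- The point of the form is the factor `increment 1`: for a primitive it is the measure itself, so
  -- the sum turns into an evaluation at the points.
  Q-step : ∀ {v w} → v ℕ.+ w ≡ M →
           Q (suc w) - Q w ≈ Σ< M (λ x → increment 1 x * (f (suc w ℕ.+ x) - f (v ℕ.+ x)))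
  Q-step {v} {w} v+w≡M = ≈-sym (begin-equality
    Σ< M (λ x → increment 1 x * (f (suc w ℕ.+ x) - f (v ℕ.+ x)))
      ≈⟨ Σ<-cong M (λ x _ → solve 4 (λ a b g h → (a ⊖ b) ⊗ (g ⊖ h) := (a ⊗ g ⊖ b ⊗ g) ⊖ (a ⊗ h ⊖ b ⊗ h)) ≈-refl
           (f (suc x)) (f x) (f (suc w ℕ.+ x)) (f (v ℕ.+ x))) ⟩
    Σ< M (λ x → (f (suc x) * f (suc w ℕ.+ x) - f x * f (suc w ℕ.+ x)) - (f (suc x) * f (v ℕ.+ x) - f x * f (v ℕ.+ x)))
      ≈⟨ ≈-trans (sum-sub {M} _ _) (+-cong (sum-sub {M} _ _) (-‿cong (sum-sub {M} _ _))) ⟩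
    (Σ< M (λ x → f (suc x) * f (suc w ℕ.+ x)) - correlation (suc w)) - (Σ< M (λ x → f (suc x) * f (v ℕ.+ x)) - correlation v)
      ≈⟨ +-cong (+-congʳ shift₁) (-‿cong (+-cong shift₂ (-‿cong shift₃))) ⟩
    (correlation w - correlation (suc w)) - (correlation (suc w) - correlation w)
      ≈⟨ solve 3 (λ s a b → (a ⊖ b) ⊖ (b ⊖ a) := (con (+ 2) ⊗ s ⊖ con (+ 2) ⊗ b) ⊖ (con (+ 2) ⊗ s ⊖ con (+ 2) ⊗ a)) ≈-refl
           S (correlation w) (correlation (suc w)) ⟩
    (2# * S - 2# * correlation (suc w)) - (2# * S - 2# * correlation w)
      ≈⟨ +-cong (≈-sym (Q≈correlation (suc w))) (-‿cong (≈-sym (Q≈correlation w))) ⟩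
    Q (suc w) - Q w  ∎)
    where
    S = Σ< M (λ x → f x * f x)

    product-periodic : ∀ j k x → f (j ℕ.+ (x ℕ.+ M)) * f (k ℕ.+ (x ℕ.+ M)) ≈ f (j ℕ.+ x) * f (k ℕ.+ x)
    product-periodic j k x = *-cong (periodic-+ j x) (periodic-+ k x)

    f-v+w : ∀ x → f (v ℕ.+ (w ℕ.+ x)) ≈ f x
    f-v+w x = ≈-trans (≈-reflexive (≡.cong f (≡.trans (≡.sym (ℕ.+-assoc v w x)) (≡.trans (≡.cong (ℕ._+ x) v+w≡M) (ℕ.+-comm M x))))) (periodic x)

    shift₁ : Σ< M (λ x → f (suc x) * f (suc w ℕ.+ x)) ≈ correlation w
    shift₁ = ≈-trans (Σ<-cong M (λ x _ → *-congˡ {f (suc x)} (≈-reflexive (≡.cong f (≡.sym (ℕ.+-suc w x))))))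
      (Σ<-shift (λ x → f x * f (w ℕ.+ x)) (product-periodic 0 w) 1)

    shift₂ : Σ< M (λ x → f (suc x) * f (v ℕ.+ x)) ≈ correlation (suc w)
    shift₂ = ≈-trans (≈-sym (Σ<-shift (λ x → f (suc x) * f (v ℕ.+ x)) (product-periodic 1 v) w))
      (Σ<-cong M (λ x _ → ≈-trans (*-congˡ {f (suc w ℕ.+ x)} (f-v+w x)) (*-comm _ (f x))))

    shift₃ : correlation v ≈ correlation w
    shift₃ = ≈-trans (≈-sym (Σ<-shift (λ x → f x * f (v ℕ.+ x)) (product-periodic 0 v) w))
      (Σ<-cong M (λ x _ → ≈-trans (*-congˡ {f (w ℕ.+ x)} (f-v+w x)) (*-comm _ (f x))))

  window : ℕ → ℕ → Carrier
  window w p = Σ< w (λ x → f (p ℕ.+ x))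

  window-halves : ∀ w p → window (w ℕ.+ w) p ≈ window w p + Σ< w (λ x → f (w ℕ.+ (p ℕ.+ x)))
  window-halves w p = ≈-trans (Σ<-++ w w (λ x → f (p ℕ.+ x)))
    (+-congˡ (Σ<-cong w (λ x _ → ≈-reflexive {f (p ℕ.+ (w ℕ.+ x))} (≡.cong f (lemma x)))))
    where
    lemma : ∀ x → p ℕ.+ (w ℕ.+ x) ≡ w ℕ.+ (p ℕ.+ x)
    lemma x = ≡.trans (≡.sym (ℕ.+-assoc p w x)) (≡.trans (≡.cong (ℕ._+ x) (ℕ.+-comm p w)) (ℕ.+-assoc w p x))

  increments≤Q : ∀ {w} → w ℕ.≤ M → ∀ p →
                 Σ< w (λ x → increment w (p ℕ.+ x) * increment w (p ℕ.+ x)) ≤ Q w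
  increments≤Q {w} w≤M p = begin
    Σ< w g                     ≤⟨ ≤-by (0≤sum {M ℕ.∸ w} (λ x → 0≤x² _)) (Σ<-++ w (M ℕ.∸ w) g) ⟩
    Σ< (w ℕ.+ (M ℕ.∸ w)) g     ≡⟨ ≡.cong (λ n → Σ< n g) (ℕ.m+[n∸m]≡n w≤M) ⟩
    Σ< M g                     ≈⟨ Σ<-shift (λ x → increment w x * increment w x) square-periodic p ⟩
    Q w                        ∎
    where
    g = λ x → increment w (p ℕ.+ x) * increment w (p ℕ.+ x)
    square-periodic : ∀ x → increment w (x ℕ.+ M) * increment w (x ℕ.+ M) ≈ increment w x * increment w x
    square-periodic x = *-cong e e
      where e = +-cong (periodic-+ w x) (-‿cong (periodic x))

  -- s is a sign, so that both signs of the difference are bounded at once.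
  doubling : ∀ {s} → s * s ≈ 1# → ∀ {σ} → 0# < σ → ∀ {w} → w ℕ.≤ M → Q w ≤ fromℕ w * (σ * σ) → ∀ p →
             s * (2# * window w p - window (w ℕ.+ w) p) ≤ fromℕ w * σ
  doubling {s} ss≈1 {σ} 0<σ {w} w≤M Q≤ p = *-cancelˡ-≤ (0<* 0<2 0<σ) (begin
    (2# * σ) * (s * (2# * window w p - window (w ℕ.+ w) p))
      ≈⟨ *-congˡ (*-congˡ (≈-trans (+-congˡ (-‿cong (window-halves w p)))
           (≈-trans (solve 2 (λ a b → con (+ 2) ⊗ a ⊖ (a ⊕ b)
                 := a ⊖ b) ≈-refl (window w p) (Σ< w (λ x → f (w ℕ.+ (p ℕ.+ x)))))
             (≈-sym (sum-sub {w} _ _))))) ⟩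
    (2# * σ) * (s * Σ< w (λ x → f (p ℕ.+ x) - f (w ℕ.+ (p ℕ.+ x))))
      ≈⟨ ≈-trans (≈-sym (*-assoc _ _ _)) (*-distribˡ-sum {w} _ _) ⟩
    Σ< w (λ x → ((2# * σ) * s) * (f (p ℕ.+ x) - f (w ℕ.+ (p ℕ.+ x))))
      ≤⟨ Σ<-mono w (λ x _ → pointwise (f (p ℕ.+ x)) (f (w ℕ.+ (p ℕ.+ x)))) ⟩
    Σ< w (λ x → increment w (p ℕ.+ x) * increment w (p ℕ.+ x) + σ * σ)
      ≈⟨ ≈-trans (∑-distrib-+ {w} _ _) (+-congˡ (sum-const w (σ * σ))) ⟩
    Σ< w (λ x → increment w (p ℕ.+ x) * increment w (p ℕ.+ x)) + fromℕ w * (σ * σ)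
      ≤⟨ +-mono-≤ (≤-trans (increments≤Q w≤M p) Q≤) ≤-refl ⟩
    fromℕ w * (σ * σ) + fromℕ w * (σ * σ)
      ≈⟨ solve 2 (λ w σ → w ⊗ (σ ⊗ σ) ⊕ w ⊗ (σ ⊗ σ) := (con (+ 2) ⊗ σ) ⊗ (w ⊗ σ)) ≈-refl (fromℕ w) σ ⟩
    (2# * σ) * (fromℕ w * σ)  ∎)
    where
    -- This is (σ - s (a - b))² ≥ 0 with s² = 1. Summed over the window it does the work of
    -- Cauchy-Schwarz without square roots.
    pointwise : ∀ a b → ((2# * σ) * s) * (a - b) ≤ (b - a) * (b - a) + σ * σ
    pointwise a b = ≤-by (0≤x² (σ - s * (a - b))) (≈-trans
      (+-congʳ (≈-sym (≈-trans (*-congʳ ss≈1) (*-identityˡ _))))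
      (solve 4 (λ s σ a b → (s ⊗ s) ⊗ ((b ⊖ a) ⊗ (b ⊖ a)) ⊕ σ ⊗ σ
        := ((con (+ 2) ⊗ σ) ⊗ s) ⊗ (a ⊖ b) ⊕ (σ ⊖ s ⊗ (a ⊖ b)) ⊗ (σ ⊖ s ⊗ (a ⊖ b))) ≈-refl s σ a b))

  -- For window means, the doubling of 2^i W costs at most σ i / 2. The inequality is the sum of
  -- these costs, multiplied by 2 · 2^J W to clear all denominators.
  telescope : ∀ {s} → s * s ≈ 1# → ∀ W (σ : ℕ → Carrier) → (∀ i → 0# < σ i) → ∀ J →
              (∀ i → i ℕ.< J → 2 ℕ.^ i ℕ.* W ℕ.≤ M × Q (2 ℕ.^ i ℕ.* W) ≤ fromℕ (2 ℕ.^ i ℕ.* W) * (σ i * σ i)) → ∀ p →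
              2# * (s * (fromℕ (2 ℕ.^ J) * window W p - window (2 ℕ.^ J ℕ.* W) p)) ≤ fromℕ (2 ℕ.^ J ℕ.* W) * Σ< J σ
  telescope {s} ss≈1 W σ 0<σ zero Q≤ p = ≤-reflexive (begin-equality
    2# * (s * (fromℕ 1 * window W p - window (1 ℕ.* W) p))
      ≈⟨ *-congˡ (*-congˡ (+-cong (*-congʳ fromℕ-1) (-‿cong (≈-reflexive (≡.cong (λ w → window w p) (ℕ.*-identityˡ W)))))) ⟩
    2# * (s * (1# * window W p - window W p))
      ≈⟨ solve 3 (λ s w n → con (+ 2) ⊗ (s ⊗ (con (+ 1) ⊗ w ⊖ w)) := n ⊗ con (+ 0)) ≈-refl s (window W p) (fromℕ (1 ℕ.* W)) ⟩
    fromℕ (1 ℕ.* W) * 0#  ∎)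
  telescope {s} ss≈1 W σ 0<σ (suc J) Q≤ p = begin
    2# * (s * (fromℕ (2 ℕ.^ suc J) * window W p - window (2 ℕ.^ suc J ℕ.* W) p))
      ≈⟨ *-congˡ (*-congˡ (+-cong (*-congʳ (≈-trans (fromℕ-* 2 (2 ℕ.^ J)) (*-congʳ fromℕ-2)))
           (-‿cong (≈-reflexive (≡.cong (λ w → window w p) double))))) ⟩
    2# * (s * ((2# * k) * window W p - window (w ℕ.+ w) p))
      ≈⟨ solve 5 (λ s k a b c → con (+ 2) ⊗ (s ⊗ ((con (+ 2) ⊗ k) ⊗ a ⊖ c))
           := con (+ 2) ⊗ (con (+ 2) ⊗ (s ⊗ (k ⊗ a ⊖ b))) ⊕ con (+ 2) ⊗ (s ⊗ (con (+ 2) ⊗ b ⊖ c))) ≈-refl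
           s k (window W p) (window w p) (window (w ℕ.+ w) p) ⟩
    2# * (2# * (s * (k * window W p - window w p))) + 2# * (s * (2# * window w p - window (w ℕ.+ w) p))
      ≤⟨ +-mono-≤ (*-monoˡ-≤ 0≤2 (telescope ss≈1 W σ 0<σ J (λ i i<J → Q≤ i (ℕ.m<n⇒m<1+n i<J)) p))
           (*-monoˡ-≤ 0≤2 (doubling ss≈1 (0<σ J) (proj₁ (Q≤ J ℕ.≤-refl)) (proj₂ (Q≤ J ℕ.≤-refl)) p)) ⟩
    2# * (fromℕ w * Σ< J σ) + 2# * (fromℕ w * σ J)
      ≈⟨ solve 3 (λ w t σ → con (+ 2) ⊗ (w ⊗ t) ⊕ con (+ 2) ⊗ (w ⊗ σ) := (w ⊕ w) ⊗ (t ⊕ σ)) ≈-refl (fromℕ w) (Σ< J σ) (σ J) ⟩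
    (fromℕ w + fromℕ w) * (Σ< J σ + σ J)
      ≈⟨ *-cong (≈-trans (≈-sym (fromℕ-+ w w)) (≈-reflexive (≡.cong fromℕ (≡.sym double)))) (≈-sym (Σ<-last J σ)) ⟩
    fromℕ (2 ℕ.^ suc J ℕ.* W) * Σ< (suc J) σ  ∎
    where
    k = fromℕ (2 ℕ.^ J)
    w = 2 ℕ.^ J ℕ.* W
    double : 2 ℕ.^ suc J ℕ.* W ≡ w ℕ.+ w
    double = ≡.trans (ℕ.*-assoc 2 (2 ℕ.^ J) W) (≡.cong (w ℕ.+_) (ℕ.+-identityʳ w))

  full-window : ∀ p → window M p ≈ Σ< M f
  full-window = Σ<-shift f periodic

  -- Telescoping with sign +1 at `p` and -1 at `q` leaves the same full window on both sides, and it
  -- cancels.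
  window-difference : ∀ W (σ : ℕ → Carrier) → (∀ i → 0# < σ i) → ∀ J → 2 ℕ.^ J ℕ.* W ≡ M →
                      (∀ i → i ℕ.< J → 2 ℕ.^ i ℕ.* W ℕ.≤ M × Q (2 ℕ.^ i ℕ.* W) ≤ fromℕ (2 ℕ.^ i ℕ.* W) * (σ i * σ i)) →
                      ∀ p q → fromℕ (2 ℕ.^ J) * (window W p - window W q) ≤ fromℕ M * Σ< J σ
  window-difference W σ 0<σ J ≡.refl Q≤ p q = *-cancelˡ-≤ 0<2 (begin
    2# * (k * (window W p - window W q))
      ≈⟨ solve 4 (λ k a b m → con (+ 2) ⊗ (k ⊗ (a ⊖ b)) :=
           con (+ 2) ⊗ (con (+ 1) ⊗ (k ⊗ a ⊖ m)) ⊕ con (+ 2) ⊗ (⊝ con (+ 1) ⊗ (k ⊗ b ⊖ m))) ≈-refl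
           k (window W p) (window W q) (Σ< M f) ⟩
    2# * (1# * (k * window W p - Σ< M f)) + 2# * (- 1# * (k * window W q - Σ< M f))
      ≈⟨ +-cong (*-congˡ (*-congˡ (+-congˡ (-‿cong (≈-sym (full-window p))))))
                (*-congˡ (*-congˡ (+-congˡ (-‿cong (≈-sym (full-window q)))))) ⟩
    2# * (1# * (k * window W p - window M p)) + 2# * (- 1# * (k * window W q - window M q))
      ≤⟨ +-mono-≤ (telescope (*-identityˡ 1#) W σ 0<σ J Q≤ p)
           (telescope (solve 0 (⊝ con (+ 1) ⊗ ⊝ con (+ 1) := con (+ 1)) ≈-refl) W σ 0<σ J Q≤ q) ⟩
    fromℕ M * Σ< J σ + fromℕ M * Σ< J σ
      ≈⟨ solve 1 (λ x → x ⊕ x := con (+ 2) ⊗ x) ≈-refl (fromℕ M * Σ< J σ) ⟩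
    2# * (fromℕ M * Σ< J σ)  ∎)
    where k = fromℕ (2 ℕ.^ J)

-- The primitive of the signed measure of points on a cyclic grid.

module GridPoints {c ℓ₁ ℓ₂} (R : CompleteOrderedField c ℓ₁ ℓ₂) (M : ℕ) .{{_ : ℕ.NonZero M}}
  (N : ℕ) (i : Fin N → ℕ) (i<M : ∀ n → i n ℕ.< M) where

  open OrderedField R
  open RangeSums R
  open ℕ-Solver.+-*-Solver using (_:+_) renaming (solve to ℕ-solve; con to ℕ-con; _:=_ to _:=ℕ_)

  hit : ℕ → ℕ → Carrier
  hit x j = indicator (x % M ℕ.≟ j)

  -- M N times the signed measure (point mass − length) of the grid cell x.
  ν : ℕ → Carrier
  ν x = fromℕ M * sum (λ n → hit x (i n)) - fromℕ N

  f : ℕ → Carrier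
  f x = Σ< x ν

  -- Counted with multiplicity: a range longer than `M` can meet the same cell twice. Hence the
  -- condition `ℓ ℕ.≤ M` wherever an upper bound is wanted.
  count : ℕ → ℕ → Fin N → Carrier
  count p ℓ n = Σ< ℓ (λ t → hit (p ℕ.+ t) (i n))

  f-difference : ∀ p ℓ → f (p ℕ.+ ℓ) - f p ≈ fromℕ M * sum (count p ℓ) - fromℕ ℓ * fromℕ N
  f-difference p ℓ = begin-equality
    f (p ℕ.+ ℓ) - f p
      ≈⟨ +-congʳ (Σ<-++ p ℓ ν) ⟩
    (f p + Σ< ℓ (λ t → ν (p ℕ.+ t))) - f p
      ≈⟨ solve 2 (λ a b → (a ⊕ b) ⊖ a := b) ≈-refl (f p) (Σ< ℓ (λ t → ν (p ℕ.+ t))) ⟩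
    Σ< ℓ (λ t → ν (p ℕ.+ t))
      ≈⟨ sum-sub {ℓ} _ _ ⟩
    Σ< ℓ (λ t → fromℕ M * sum (λ n → hit (p ℕ.+ t) (i n))) - Σ< ℓ (λ _ → fromℕ N)
      ≈⟨ +-cong (≈-trans (≈-sym (*-distribˡ-sum {ℓ} _ _)) (*-congˡ (∑-comm {ℓ} {N} _))) (-‿cong (sum-const ℓ _)) ⟩
    fromℕ M * sum (count p ℓ) - fromℕ ℓ * fromℕ N  ∎

  hit-periodic : ∀ x j → hit (x ℕ.+ M) j ≈ hit x j
  hit-periodic x j = ≈-reflexive (≡.cong (λ y → indicator (y ℕ.≟ j)) ([m+n]%n≡m%n x M))

  Σ<-hit : ∀ n (h : ℕ → Carrier) → Σ< M (λ x → hit x (i n) * h x) ≈ h (i n)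
  Σ<-hit n h = ≈-trans
    (Σ<-cong M (λ x x<M → *-congʳ {h x} (≈-reflexive (≡.cong (λ y → indicator (y ℕ.≟ i n)) (m<n⇒m%n≡m x<M)))))
    (Σ<-δ M (i n) h (i<M n))

  count-full : ∀ p n → count p M n ≈ 1#
  count-full p n = begin-equality
    count p M n                       ≈⟨ Σ<-shift (λ x → hit x (i n)) (λ x → hit-periodic x (i n)) p ⟩
    Σ< M (λ x → hit x (i n))          ≈⟨ Σ<-cong M (λ x _ → ≈-sym (*-identityʳ (hit x (i n)))) ⟩
    Σ< M (λ x → hit x (i n) * 1#)     ≈⟨ Σ<-hit n (λ _ → 1#) ⟩
    1#                                ∎

  0≤count : ∀ p ℓ n → 0# ≤ count p ℓ n
  0≤count p ℓ n = 0≤sum {ℓ} λ t → 0≤indicator ((p ℕ.+ toℕ t) % M ℕ.≟ i n)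

  count≤1 : ∀ p {ℓ} → ℓ ℕ.≤ M → ∀ n → count p ℓ n ≤ 1#
  count≤1 p {ℓ} ℓ≤M n = begin
    count p ℓ n                  ≤⟨ ≤-by (0≤sum {M ℕ.∸ ℓ} (λ t → 0≤indicator ((p ℕ.+ (ℓ ℕ.+ toℕ t)) % M ℕ.≟ i n)))
                                      (Σ<-++ ℓ (M ℕ.∸ ℓ) (λ t → hit (p ℕ.+ t) (i n))) ⟩
    count p (ℓ ℕ.+ (M ℕ.∸ ℓ)) n  ≡⟨ ≡.cong (λ k → count p k n) (ℕ.m+[n∸m]≡n ℓ≤M) ⟩
    count p M n                  ≈⟨ count-full p n ⟩
    1#                           ∎

  count≤indicator : ∀ p {ℓ} → ℓ ℕ.≤ M → ∀ n {q} {P : Set q} (P? : Dec P) →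
                    (∀ t → t ℕ.< ℓ → (p ℕ.+ t) % M ≡ i n → P) → count p ℓ n ≤ indicator P?
  count≤indicator p ℓ≤M n (yes _) _ = count≤1 p ℓ≤M n
  count≤indicator p {ℓ} ℓ≤M n (no ¬P) hit⇒P = begin
    count p ℓ n       ≤⟨ Σ<-mono ℓ (λ t t<ℓ → indicator-mono ((p ℕ.+ t) % M ℕ.≟ i n) (no ¬P) (hit⇒P t t<ℓ)) ⟩
    Σ< ℓ (λ _ → 0#)   ≈⟨ sum-const ℓ 0# ⟩
    fromℕ ℓ * 0#      ≈⟨ zeroʳ _ ⟩
    0#                ∎

  Σ<-term : ∀ n {g : ℕ → Carrier} → (∀ x → 0# ≤ g x) → ∀ t → t ℕ.< n → g t ≤ Σ< n g
  Σ<-term n {g} 0≤g t t<n = ≡.subst (λ k → g k ≤ Σ< n g) (Fin.toℕ-fromℕ< t<n) (sum-term (λ b → 0≤g (toℕ b)) (Fin.fromℕ< t<n))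

  indicator≤count : ∀ p ℓ n {q} {P : Set q} (P? : Dec P) →
                    (P → ∃[ t ] t ℕ.< ℓ × (p ℕ.+ t) % M ≡ i n) → indicator P? ≤ count p ℓ n
  indicator≤count p ℓ n (no _) _ = 0≤count p ℓ n
  indicator≤count p ℓ n (yes P) P⇒hit with P⇒hit P
  ... | t , t<ℓ , e = ≤-trans
    (indicator-mono (yes P) ((p ℕ.+ t) % M ℕ.≟ i n) (λ _ → e))
    (Σ<-term ℓ (λ t → 0≤indicator ((p ℕ.+ t) % M ℕ.≟ i n)) t t<ℓ)

  f-periodic : ∀ x → f (x ℕ.+ M) ≈ f x
  f-periodic x = begin-equality
    f (x ℕ.+ M)
      ≈⟨ solve 2 (λ a b → a := (a ⊖ b) ⊕ b) ≈-refl (f (x ℕ.+ M)) (f x) ⟩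
    (f (x ℕ.+ M) - f x) + f x
      ≈⟨ +-congʳ (≈-trans (f-difference x M) (+-congʳ (*-congˡ (≈-trans (sum-cong-≋ (count-full x)) (sum-const N 1#))))) ⟩
    (fromℕ M * (fromℕ N * 1#) - fromℕ M * fromℕ N) + f x
      ≈⟨ solve 3 (λ m n a → (m ⊗ (n ⊗ con (+ 1)) ⊖ m ⊗ n) ⊕ a := a) ≈-refl (fromℕ M) (fromℕ N) (f x) ⟩
    f x  ∎

  open PeriodicFunction R M f f-periodic public

  -- Points only raise `f`; the length term lowers it by N per cell.
  f-descent : ∀ p ℓ → f p ≤ f (p ℕ.+ ℓ) + fromℕ ℓ * fromℕ N
  f-descent p ℓ = ≤-by (*-nonNegative (0≤fromℕ M) (0≤sum (0≤count p ℓ))) (begin-equality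
    f (p ℕ.+ ℓ) + fromℕ ℓ * fromℕ N
      ≈⟨ solve 3 (λ a b l → a ⊕ l := (b ⊕ (a ⊖ b)) ⊕ l) ≈-refl (f (p ℕ.+ ℓ)) (f p) (fromℕ ℓ * fromℕ N) ⟩
    (f p + (f (p ℕ.+ ℓ) - f p)) + fromℕ ℓ * fromℕ N
      ≈⟨ +-congʳ (+-congˡ (f-difference p ℓ)) ⟩
    (f p + (fromℕ M * sum (count p ℓ) - fromℕ ℓ * fromℕ N)) + fromℕ ℓ * fromℕ N
      ≈⟨ solve 3 (λ b m l → (b ⊕ (m ⊖ l)) ⊕ l := b ⊕ m) ≈-refl (f p) (fromℕ M * sum (count p ℓ)) (fromℕ ℓ * fromℕ N) ⟩
    f p + fromℕ M * sum (count p ℓ)  ∎)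

  increment-1 : ∀ x → increment 1 x ≈ ν x
  increment-1 x = ≈-trans (+-congʳ (Σ<-last x ν))
    (solve 2 (λ a b → (a ⊕ b) ⊖ a := b) ≈-refl (f x) (ν x))

  Σ<-ν : ∀ h → Σ< M (λ x → ν x * h x) ≈ fromℕ M * sum (λ n → h (i n)) - fromℕ N * Σ< M h
  Σ<-ν h = begin-equality
    Σ< M (λ x → ν x * h x)
      ≈⟨ Σ<-cong M (λ x _ → solve 4 (λ m s n h → (m ⊗ s ⊖ n) ⊗ h := m ⊗ (s ⊗ h) ⊖ n ⊗ h) ≈-refl
           (fromℕ M) (sum (λ n → hit x (i n))) (fromℕ N) (h x)) ⟩
    Σ< M (λ x → fromℕ M * (sum (λ n → hit x (i n)) * h x) - fromℕ N * h x)
      ≈⟨ ≈-trans (sum-sub {M} _ _) (+-cong (≈-sym (*-distribˡ-sum {M} _ _)) (-‿cong (≈-sym (*-distribˡ-sum {M} _ _)))) ⟩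
    fromℕ M * Σ< M (λ x → sum (λ n → hit x (i n)) * h x) - fromℕ N * Σ< M h
      ≈⟨ +-congʳ (*-congˡ (begin-equality
           Σ< M (λ x → sum (λ n → hit x (i n)) * h x)
             ≈⟨ Σ<-cong M (λ x _ → *-distribʳ-sum (h x) (λ n → hit x (i n))) ⟩
           Σ< M (λ x → sum (λ n → hit x (i n) * h x))
             ≈⟨ ∑-comm {M} {N} _ ⟩
           sum (λ n → Σ< M (λ x → hit x (i n) * h x))
             ≈⟨ sum-cong-≋ (λ n → Σ<-hit n h) ⟩
           sum (λ n → h (i n))  ∎)) ⟩
    fromℕ M * sum (λ n → h (i n)) - fromℕ N * Σ< M h  ∎

  -- In `Q-step` the second factor h(x) is the signed measure of the 2w + 1 cells from x - w to x +
  -- w, and the first factor is `ν`. The point masses of `ν` evaluate h at the points, which counts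
  -- pairs of points whose cells differ cyclically by at most w; the constant part -N contributes
  -- nothing, since h is a difference of two shifts of `f` and sums to zero.
  Q-step-count : ∀ {v w} → v ℕ.+ w ≡ M →
    Q (suc w) - Q w ≈ fromℕ M * (fromℕ M * sum (λ m → sum (count (v ℕ.+ i m) (suc (w ℕ.+ w))))
                                - fromℕ N * (fromℕ (suc (w ℕ.+ w)) * fromℕ N))
  Q-step-count {v} {w} v+w≡M = begin-equality
    Q (suc w) - Q w
      ≈⟨ Q-step {v} {w} v+w≡M ⟩
    Σ< M (λ x → increment 1 x * h x)
      ≈⟨ Σ<-cong M (λ x _ → *-congʳ {h x} (increment-1 x)) ⟩
    Σ< M (λ x → ν x * h x)
      ≈⟨ Σ<-ν h ⟩
    fromℕ M * sum (λ m → h (i m)) - fromℕ N * Σ< M h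
      ≈⟨ +-cong (*-congˡ (≈-trans (sum-cong-≋ h≈count) (≈-trans (sum-sub {N} _ _)
                  (+-cong (≈-sym (*-distribˡ-sum {N} _ _)) (-‿cong (sum-const N _))))))
           (-‿cong (*-congˡ (≈-trans (sum-sub {M} _ _) (+-cong (Σ<-shift f f-periodic (suc w)) (-‿cong (Σ<-shift f f-periodic v)))))) ⟩
    fromℕ M * (fromℕ M * S - fromℕ N * (fromℕ (suc (w ℕ.+ w)) * fromℕ N)) - fromℕ N * (Σ< M f - Σ< M f)
      ≈⟨ solve 3 (λ a n t → a ⊖ n ⊗ (t ⊖ t) := a) ≈-refl
           (fromℕ M * (fromℕ M * S - fromℕ N * (fromℕ (suc (w ℕ.+ w)) * fromℕ N))) (fromℕ N) (Σ< M f) ⟩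
    fromℕ M * (fromℕ M * S - fromℕ N * (fromℕ (suc (w ℕ.+ w)) * fromℕ N))  ∎
    where
    h = λ x → f (suc w ℕ.+ x) - f (v ℕ.+ x)
    S = sum (λ m → sum (count (v ℕ.+ i m) (suc (w ℕ.+ w))))

    -- The range that starts at j - w, represented by v + j, ends one full turn after j + w + 1.
    arithmetic : ∀ j → (v ℕ.+ j) ℕ.+ suc (w ℕ.+ w) ≡ (suc w ℕ.+ j) ℕ.+ M
    arithmetic j = ≡.trans
      (ℕ-solve 3 (λ v w j → (v :+ j) :+ (one :+ (w :+ w)) :=ℕ ((one :+ w) :+ j) :+ (v :+ w)) ≡.refl v w j)
      (≡.cong ((suc w ℕ.+ j) ℕ.+_) v+w≡M)
      where one = ℕ-con 1

    h≈count : ∀ m → h (i m) ≈ fromℕ M * sum (count (v ℕ.+ i m) (suc (w ℕ.+ w))) - fromℕ (suc (w ℕ.+ w)) * fromℕ N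
    h≈count m = ≈-trans
      (+-congʳ (≈-trans (≈-sym (f-periodic (suc w ℕ.+ i m))) (≈-reflexive (≡.cong f (≡.sym (arithmetic (i m)))))))
      (f-difference (v ℕ.+ i m) (suc (w ℕ.+ w)))

-- The geometric weights along the dyadic scales.

module GeometricRatio {c ℓ₁ ℓ₂} (R : CompleteOrderedField c ℓ₁ ℓ₂) where

  open OrderedField R
  open RangeSums R

  0≤con : ∀ n → 0# ≤ fromℤ (+ n)
  0≤con zero          = ≤-refl
  0≤con (suc zero)    = 0≤1
  0≤con (suc (suc n)) = 0≤+ (0≤con (suc n)) 0≤1

  0<con : ∀ n → 0# < fromℤ (+ suc n)
  0<con zero    = 0<1
  0<con (suc n) = <-≤-trans (0<con n) (≤-by 0≤1 ≈-refl)

  8# : Carrier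
  8# = fromℤ (+ 8)

  -- The ratio of the costs at consecutive scales: all that matters is ρ < 1 and 2ρ⁴ ≥ 1.
  ρ : Carrier
  ρ = fromℤ (+ 7) * 8# ⁻¹

  8ρ≈7 : 8# * ρ ≈ fromℤ (+ 7)
  8ρ≈7 = /-*-cancel (0<con 7) _

  0<ρ : 0# < ρ
  0<ρ = 0<* (0<con 6) (0<⁻¹ (0<con 7))

  ρ^ : ℕ → Carrier
  ρ^ n = ρ ^ n

  0<ρ^ : ∀ n → 0# < ρ^ n
  0<ρ^ zero    = 0<1
  0<ρ^ (suc n) = 0<* 0<ρ (0<ρ^ n)

  -- The value 8 is 1/(1 - ρ); keeping the remainder term makes the induction exact.
  geometric-sum : ∀ n → Σ< n ρ^ + 8# * ρ^ n ≈ 8#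
  geometric-sum zero    = solve 0 (con (+ 0) ⊕ con (+ 8) ⊗ con (+ 1) := con (+ 8)) ≈-refl
  geometric-sum (suc n) = begin-equality
    Σ< (suc n) ρ^ + 8# * (ρ * ρ^ n)
      ≈⟨ +-cong (Σ<-last n ρ^) (≈-trans (≈-sym (*-assoc _ _ _)) (*-congʳ 8ρ≈7)) ⟩
    (Σ< n ρ^ + ρ^ n) + fromℤ (+ 7) * ρ^ n
      ≈⟨ solve 2 (λ s r → (s ⊕ r) ⊕ con (+ 7) ⊗ r := s ⊕ con (+ 8) ⊗ r) ≈-refl (Σ< n ρ^) (ρ^ n) ⟩
    Σ< n ρ^ + 8# * ρ^ n
      ≈⟨ geometric-sum n ⟩
    8#  ∎

  Σρ≤8 : ∀ n → Σ< n ρ^ ≤ 8#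
  Σρ≤8 n = ≤-by (*-nonNegative (0≤con 8) (<⇒≤ (0<ρ^ n))) (≈-sym (geometric-sum n))

  1≤2ρ² : 1# ≤ 2# * (ρ * ρ)
  1≤2ρ² = *-cancelˡ-≤ (0<con 63) (≤-by (0≤con 34) (begin-equality
    fromℤ (+ 64) * (2# * (ρ * ρ))
      ≈⟨ solve 1 (λ r → con (+ 64) ⊗ (con (+ 2) ⊗ (r ⊗ r)) := con (+ 2) ⊗ ((con (+ 8) ⊗ r) ⊗ (con (+ 8) ⊗ r))) ≈-refl ρ ⟩
    2# * ((8# * ρ) * (8# * ρ))
      ≈⟨ *-congˡ (*-cong 8ρ≈7 8ρ≈7) ⟩
    2# * (fromℤ (+ 7) * fromℤ (+ 7))
      ≈⟨ solve 0 (con (+ 2) ⊗ (con (+ 7) ⊗ con (+ 7)) := con (+ 64) ⊗ con (+ 1) ⊕ con (+ 34)) ≈-refl ⟩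
    fromℤ (+ 64) * 1# + fromℤ (+ 34)  ∎))

  -- Since ρ² = 49/64 is at least 3/4, the right side is at least 18/16.
  1≤2ρ⁴ : 1# ≤ 2# * ((ρ * ρ) * (ρ * ρ))
  1≤2ρ⁴ = *-cancelˡ-≤ (0<con 15) (begin
    fromℤ (+ 16) * 1#
      ≤⟨ ≤-by (0≤con 2) (solve 0 (con (+ 18) := con (+ 16) ⊗ con (+ 1) ⊕ con (+ 2)) ≈-refl) ⟩
    fromℤ (+ 18)
      ≈⟨ solve 0 (con (+ 18) := con (+ 2) ⊗ (con (+ 3) ⊗ con (+ 3))) ≈-refl ⟩
    2# * (fromℤ (+ 3) * fromℤ (+ 3))
      ≤⟨ *-monoˡ-≤ 0≤2 (*-mono-≤ (0≤con 3) (0≤con 3) 3≤4ρ² 3≤4ρ²) ⟩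
    2# * ((fromℤ (+ 4) * (ρ * ρ)) * (fromℤ (+ 4) * (ρ * ρ)))
      ≈⟨ solve 1 (λ r → con (+ 2) ⊗ ((con (+ 4) ⊗ (r ⊗ r)) ⊗ (con (+ 4) ⊗ (r ⊗ r)))
            := con (+ 16) ⊗ (con (+ 2) ⊗ ((r ⊗ r) ⊗ (r ⊗ r)))) ≈-refl ρ ⟩
    fromℤ (+ 16) * (2# * ((ρ * ρ) * (ρ * ρ)))  ∎)
    where
    3≤4ρ² : fromℤ (+ 3) ≤ fromℤ (+ 4) * (ρ * ρ)
    3≤4ρ² = *-cancelˡ-≤ (0<con 15) (≤-by 0≤1 (begin-equality
      fromℤ (+ 16) * (fromℤ (+ 4) * (ρ * ρ))
        ≈⟨ solve 1 (λ r → con (+ 16) ⊗ (con (+ 4) ⊗ (r ⊗ r)) := (con (+ 8) ⊗ r) ⊗ (con (+ 8) ⊗ r)) ≈-refl ρ ⟩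
      (8# * ρ) * (8# * ρ)
        ≈⟨ *-cong 8ρ≈7 8ρ≈7 ⟩
      fromℤ (+ 7) * fromℤ (+ 7)
        ≈⟨ solve 0 (con (+ 7) ⊗ con (+ 7) := con (+ 16) ⊗ con (+ 3) ⊕ con (+ 1)) ≈-refl ⟩
      fromℤ (+ 16) * fromℤ (+ 3) + 1#  ∎))

  2^ : ℕ → Carrier
  2^ n = fromℕ (2 ℕ.^ n)

  2^-suc : ∀ n → 2^ (suc n) ≈ 2# * 2^ n
  2^-suc n = ≈-trans (fromℕ-* 2 (2 ℕ.^ n)) (*-congʳ fromℕ-2)

  0<2^ : ∀ n → 0# < 2^ n
  0<2^ n = 0<fromℕ (ℕ.^-monoʳ-≤ 2 {0} {n} z≤n)

  1≤2^ρ² : ∀ n → 1# ≤ 2^ n * (ρ^ n * ρ^ n)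
  1≤2^ρ² zero    = ≤-reflexive (≈-sym (≈-trans (*-congʳ fromℕ-1) (solve 0 (con (+ 1) ⊗ (con (+ 1) ⊗ con (+ 1))
        := con (+ 1)) ≈-refl)))
  1≤2^ρ² (suc n) = begin
    1#                                                  ≈⟨ *-identityˡ 1# ⟨
    1# * 1#                                             ≤⟨ *-mono-≤ 0≤1 0≤1 1≤2ρ² (1≤2^ρ² n) ⟩
    (2# * (ρ * ρ)) * (2^ n * (ρ^ n * ρ^ n))             ≈⟨ solve 3 (λ r t q → (con (+ 2) ⊗ (r ⊗ r)) ⊗ (t ⊗ (q ⊗ q))
          := (con (+ 2) ⊗ t) ⊗ ((r ⊗ q) ⊗ (r ⊗ q))) ≈-refl ρ (2^ n) (ρ^ n) ⟩
    (2# * 2^ n) * (ρ^ (suc n) * ρ^ (suc n))             ≈⟨ *-congʳ (2^-suc n) ⟨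
    2^ (suc n) * (ρ^ (suc n) * ρ^ (suc n))              ∎

  1≤2^ρ⁴ : ∀ n → 1# ≤ 2^ n * ((ρ^ n * ρ^ n) * (ρ^ n * ρ^ n))
  1≤2^ρ⁴ zero    = ≤-reflexive (≈-sym (≈-trans (*-congʳ fromℕ-1) (solve 0 (con (+ 1) ⊗ ((con (+ 1) ⊗ con (+ 1)) ⊗ (con (+ 1) ⊗ con (+ 1)))
        := con (+ 1)) ≈-refl)))
  1≤2^ρ⁴ (suc n) = begin
    1#       ≈⟨ *-identityˡ 1# ⟨
    1# * 1#  ≤⟨ *-mono-≤ 0≤1 0≤1 1≤2ρ⁴ (1≤2^ρ⁴ n) ⟩
    (2# * ((ρ * ρ) * (ρ * ρ))) * (2^ n * ((ρ^ n * ρ^ n) * (ρ^ n * ρ^ n)))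
      ≈⟨ solve 3 (λ r t q → (con (+ 2) ⊗ ((r ⊗ r) ⊗ (r ⊗ r))) ⊗ (t ⊗ ((q ⊗ q) ⊗ (q ⊗ q)))
           := (con (+ 2) ⊗ t) ⊗ (((r ⊗ q) ⊗ (r ⊗ q)) ⊗ ((r ⊗ q) ⊗ (r ⊗ q)))) ≈-refl ρ (2^ n) (ρ^ n) ⟩
    (2# * 2^ n) * ((ρ^ (suc n) * ρ^ (suc n)) * (ρ^ (suc n) * ρ^ (suc n)))  ≈⟨ *-congʳ (2^-suc n) ⟨
    2^ (suc n) * ((ρ^ (suc n) * ρ^ (suc n)) * (ρ^ (suc n) * ρ^ (suc n)))   ∎

-- From a small sum of squared deviations to a small rise of the primitive.

-- y w stands for the pair-correlation deviation at distance (w + 1) / M.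
module DiscreteBound {c ℓ₁ ℓ₂} (R : CompleteOrderedField c ℓ₁ ℓ₂) (M : ℕ) .{{_ : ℕ.NonZero M}}
  (N : ℕ) (i : Fin N → ℕ) (i<M : ∀ n → i n ℕ.< M) (1≤N : 1 ℕ.≤ N) (N≤M : N ℕ.≤ M)
  (H : ℕ) (H+H≡M : H ℕ.+ H ≡ M) (y : ℕ → CompleteOrderedField.Carrier R) where

  open OrderedField R
  open RangeSums R
  open GeometricRatio R
  open GridPoints R M N i i<M

  private
    m = fromℕ M
    n = fromℕ N

  -- If F pairs lie within (w + 1)/M, the definition of the deviation gives M F = M N y + 2 (w + 1)
  -- N²; the separate summand `n` is for the diagonal. As a hypothesis it keeps the grid argument
  -- apart from the geometry of the circle.
  CountBound : Set ℓ₂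
  CountBound = ∀ v w → v ℕ.+ w ≡ M → w ℕ.< H →
    m * sum (λ k → sum (count (v ℕ.+ i k) (suc (w ℕ.+ w)))) ≤ m * (n + n * y w) + (2# * fromℕ (suc w)) * (n * n)

  Y : Carrier
  Y = Σ< H (λ k → y k * y k)

  0<m : 0# < m
  0<m = 0<fromℕ (ℕ.≤-trans 1≤N N≤M)

  0<n : 0# < n
  0<n = 0<fromℕ 1≤N

  module _ (bound : CountBound) where

    -- The main terms 2 (w + 1) N² and (2w + 1) N² leave a surplus N² ≤ M N. This surplus and the
    -- diagonal each add 1 to the deviation, whence the 2.
    Q-increment≤ : ∀ w → w ℕ.< H → Q (suc w) - Q w ≤ (m * m * n) * (y w + 2#)
    Q-increment≤ w w<H = begin
      Q (suc w) - Q w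
        ≈⟨ Q-step-count {v} {w} v+w≡M ⟩
      m * (m * S - n * (fromℕ (suc (w ℕ.+ w)) * n))
        ≤⟨ *-monoˡ-≤ (0≤fromℕ M) (+-mono-≤ (bound v w v+w≡M w<H) ≤-refl) ⟩
      m * ((m * (n + n * y w) + (2# * fromℕ (suc w)) * (n * n)) - n * (fromℕ (suc (w ℕ.+ w)) * n))
        ≈⟨ *-congˡ (+-congˡ (-‿cong (*-congˡ (*-congʳ (+-congˡ (fromℕ-+ w w)))))) ⟩
      m * ((m * (n + n * y w) + (2# * (1# + fromℕ w)) * (n * n)) - n * ((1# + (fromℕ w + fromℕ w)) * n))
        ≤⟨ ≤-by (*-nonNegative (*-nonNegative (0≤fromℕ M) (0≤fromℕ N)) ⟨ fromℕ-mono N≤M ⟩)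
             (solve 4 (λ m n w y → (m ⊗ m ⊗ n) ⊗ (y ⊕ con (+ 2)) :=
               m ⊗ ((m ⊗ (n ⊕ n ⊗ y) ⊕ (con (+ 2) ⊗ (con (+ 1) ⊕ w)) ⊗ (n ⊗ n)) ⊖ n ⊗ ((con (+ 1) ⊕ (w ⊕ w)) ⊗ n))
               ⊕ (m ⊗ n) ⊗ (m ⊖ n)) ≈-refl m n (fromℕ w) (y w)) ⟩
      (m * m * n) * (y w + 2#)  ∎
      where
      v = M ℕ.∸ w
      v+w≡M : v ℕ.+ w ≡ M
      v+w≡M = ℕ.m∸n+n≡m (ℕ.≤-trans (ℕ.<⇒≤ w<H) (ℕ.≤-trans (ℕ.m≤m+n H H) (ℕ.≤-reflexive H+H≡M)))
      S = sum (λ k → sum (count (v ℕ.+ i k) (suc (w ℕ.+ w))))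

    Q-zero : Q 0 ≈ 0#
    Q-zero = ≈-trans (Σ<-cong M (λ x _ → solve 1 (λ a → (a ⊖ a) ⊗ (a ⊖ a) := con (+ 0)) ≈-refl (f x)))
      (≈-trans (sum-const M 0#) (zeroʳ _))

    Q≤ : ∀ w → w ℕ.≤ H → Q w ≤ (m * m * n) * Σ< w (λ k → y k + 2#)
    Q≤ zero    _   = ≤-reflexive (≈-trans Q-zero (≈-sym (zeroʳ _)))
    Q≤ (suc w) w<H = begin
      Q (suc w)
        ≈⟨ solve 2 (λ a b → a := b ⊕ (a ⊖ b)) ≈-refl (Q (suc w)) (Q w) ⟩
      Q w + (Q (suc w) - Q w)
        ≤⟨ +-mono-≤ (Q≤ w (ℕ.<⇒≤ w<H)) (Q-increment≤ w w<H) ⟩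
      (m * m * n) * Σ< w (λ k → y k + 2#) + (m * m * n) * (y w + 2#)
        ≈⟨ ≈-trans (≈-sym (distribˡ _ _ _)) (*-congˡ (≈-sym (Σ<-last w (λ k → y k + 2#)))) ⟩
      (m * m * n) * Σ< (suc w) (λ k → y k + 2#)  ∎

    -- Termwise 2 τ y ≤ y² + τ². The parameter τ stays free, to be tuned to the scale w.
    Σy≤Y : ∀ τ w → w ℕ.≤ H → (2# * τ) * Σ< w (λ k → y k + 2#) ≤ Y + fromℕ w * (τ * τ + fromℤ (+ 4) * τ)
    Σy≤Y τ w w≤H = begin
      (2# * τ) * Σ< w (λ k → y k + 2#)
        ≈⟨ *-distribˡ-sum {w} _ _ ⟩
      Σ< w (λ k → (2# * τ) * (y k + 2#))
        ≤⟨ Σ<-mono w (λ k _ → ≤-by (0≤x² (y k - τ)) (solve 2 (λ y τ → y ⊗ y ⊕ (τ ⊗ τ ⊕ con (+ 4) ⊗ τ)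
             := (con (+ 2) ⊗ τ) ⊗ (y ⊕ con (+ 2)) ⊕ (y ⊖ τ) ⊗ (y ⊖ τ)) ≈-refl (y k) τ)) ⟩
      Σ< w (λ k → y k * y k + (τ * τ + fromℤ (+ 4) * τ))
        ≈⟨ ≈-trans (∑-distrib-+ {w} _ _) (+-congˡ (sum-const w _)) ⟩
      Σ< w (λ k → y k * y k) + fromℕ w * (τ * τ + fromℤ (+ 4) * τ)
        ≤⟨ +-mono-≤ (≤-by (0≤sum {H ℕ.∸ w} (λ k → 0≤x² _))
             (≈-trans (≈-reflexive (≡.cong (λ h → Σ< h (λ k → y k * y k)) (≡.sym (ℕ.m+[n∸m]≡n w≤H)))) (Σ<-++ w (H ℕ.∸ w) (λ k → y k * y k)))) ≤-refl ⟩
      Y + fromℕ w * (τ * τ + fromℤ (+ 4) * τ)  ∎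

    -- The hypotheses bound both 2 Y and 8 w τ by w τ²; together with the 2 w τ² already present
    -- this makes the 4 w τ² that is allowed.
    Q≤τ : ∀ τ → 8# ≤ τ → ∀ w → w ℕ.≤ H → 2# * Y ≤ fromℕ w * (τ * τ) → Q w ≤ fromℕ w * (m * m * n * τ)
    Q≤τ τ 8≤τ w w≤H 2Y≤ = *-cancelˡ-≤ (0<* 0<4 0<τ) (begin
      (fromℤ (+ 4) * τ) * Q w
        ≤⟨ *-monoˡ-≤ (<⇒≤ (0<* 0<4 0<τ)) (Q≤ w w≤H) ⟩
      (fromℤ (+ 4) * τ) * ((m * m * n) * Σ< w (λ k → y k + 2#))
        ≈⟨ solve 3 (λ τ a s → (con (+ 4) ⊗ τ) ⊗ (a ⊗ s)
              := (con (+ 2) ⊗ a) ⊗ ((con (+ 2) ⊗ τ) ⊗ s)) ≈-refl τ (m * m * n) (Σ< w (λ k → y k + 2#)) ⟩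
      (2# * (m * m * n)) * ((2# * τ) * Σ< w (λ k → y k + 2#))
        ≤⟨ *-monoˡ-≤ (*-nonNegative 0≤2 0≤mmn) (Σy≤Y τ w w≤H) ⟩
      (2# * (m * m * n)) * (Y + fromℕ w * (τ * τ + fromℤ (+ 4) * τ))
        ≤⟨ ≤-by (*-nonNegative 0≤mmn (0≤+ ⟨ 2Y≤ ⟩ (*-nonNegative (*-nonNegative (0≤fromℕ w) (<⇒≤ 0<τ)) ⟨ 8≤τ ⟩)))
             (solve 4 (λ a w τ Y → (con (+ 4) ⊗ τ) ⊗ (w ⊗ (a ⊗ τ)) :=
               (con (+ 2) ⊗ a) ⊗ (Y ⊕ w ⊗ (τ ⊗ τ ⊕ con (+ 4) ⊗ τ))
               ⊕ a ⊗ ((w ⊗ (τ ⊗ τ) ⊖ con (+ 2) ⊗ Y) ⊕ (w ⊗ τ) ⊗ (τ ⊖ con (+ 8)))) ≈-refl (m * m * n) (fromℕ w) τ Y) ⟩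
      (fromℤ (+ 4) * τ) * (fromℕ w * (m * m * n * τ))  ∎)
      where
      0<4 = 0<con 3
      0<τ = <-≤-trans (0<con 7) 8≤τ
      0≤mmn = *-nonNegative (*-nonNegative (0≤fromℕ M) (0≤fromℕ M)) (0≤fromℕ N)

    module _ (W J : ℕ) (2^J*W≡M : 2 ℕ.^ J ℕ.* W ≡ M)
      (e : Carrier) (0<e : 0# < e) (J-small : (2# * e) * 2^ J ≤ 1#) (J-large : 1# ≤ (fromℤ (+ 4) * e) * 2^ J)
      (N-large : fromℤ (+ 4) ≤ n * (e * (e * e))) (Y-small : Y ≤ m * (n * n) * (e * (e * e) * (e * e))) where

      -- `σ k` is the cost granted at scale 2^k W, and `τ k` is the mean deviation that accounts for
      -- it: M² N τ = σ². The first cost M N e is of the size of the rise to be proved.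
      τ σ : ℕ → Carrier
      τ k = n * ((e * ρ^ k) * (e * ρ^ k))
      σ k = (m * n * e) * ρ^ k

      0<σ : ∀ k → 0# < σ k
      0<σ k = 0<* (0<* (0<* 0<m 0<n) 0<e) (0<ρ^ k)

      2^-mono : ∀ {k} → k ℕ.≤ J → 2^ k ≤ 2^ J
      2^-mono k≤J = fromℕ-mono (ℕ.^-monoʳ-≤ 2 k≤J)

      -- After multiplication by e 2^k, which is at most 1/2, the left side is at most 4, while the
      -- right side is N e³ times 2^k ρ^(2k) ≥ 1. The largeness of the discrepancy enters the
      -- argument here.
      8≤τ : ∀ k → k ℕ.< J → 8# ≤ τ k
      8≤τ k k<J = *-cancelˡ-≤ (0<* 0<e (0<2^ k)) (begin
        (e * 2^ k) * 8#
          ≈⟨ solve 2 (λ e t → (e ⊗ t) ⊗ con (+ 8) := con (+ 4) ⊗ ((con (+ 2) ⊗ e) ⊗ t)) ≈-refl e (2^ k) ⟩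
        fromℤ (+ 4) * ((2# * e) * 2^ k)
          ≤⟨ *-monoˡ-≤ (0≤con 4) (≤-trans (*-monoˡ-≤ (*-nonNegative 0≤2 (<⇒≤ 0<e)) (2^-mono (ℕ.<⇒≤ k<J))) J-small) ⟩
        fromℤ (+ 4) * 1#
          ≤⟨ *-mono-≤ (0≤con 4) 0≤1 N-large (1≤2^ρ² k) ⟩
        (n * (e * (e * e))) * (2^ k * (ρ^ k * ρ^ k))
          ≈⟨ solve 4 (λ n e t r → (n ⊗ (e ⊗ (e ⊗ e))) ⊗ (t ⊗ (r ⊗ r))
                := (e ⊗ t) ⊗ (n ⊗ ((e ⊗ r) ⊗ (e ⊗ r)))) ≈-refl n e (2^ k) (ρ^ k) ⟩
        (e * 2^ k) * τ k  ∎)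

      m≈ : m ≈ 2^ J * fromℕ W
      m≈ = ≈-trans (≈-reflexive (≡.cong fromℕ (≡.sym 2^J*W≡M))) (fromℕ-* (2 ℕ.^ J) W)

      2em≤W : (2# * e) * m ≤ fromℕ W
      2em≤W = begin
        (2# * e) * m                   ≈⟨ *-congˡ m≈ ⟩
        (2# * e) * (2^ J * fromℕ W)    ≈⟨ *-assoc _ _ _ ⟨
        ((2# * e) * 2^ J) * fromℕ W    ≤⟨ *-monoʳ-≤ (0≤fromℕ W) J-small ⟩
        1# * fromℕ W                   ≈⟨ *-identityˡ _ ⟩
        fromℕ W                        ∎

      W≤4em : fromℕ W ≤ (fromℤ (+ 4) * e) * m
      W≤4em = begin
        fromℕ W                                  ≈⟨ *-identityˡ _ ⟨
        1# * fromℕ W                             ≤⟨ *-monoʳ-≤ (0≤fromℕ W) J-large ⟩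
        ((fromℤ (+ 4) * e) * 2^ J) * fromℕ W     ≈⟨ *-assoc _ _ _ ⟩
        (fromℤ (+ 4) * e) * (2^ J * fromℕ W)     ≈⟨ *-congˡ m≈ ⟨
        (fromℤ (+ 4) * e) * m                    ∎

      -- The growth 2^k of the scale outweighs the decay ρ^(4k) of τ², so the first scale is
      -- decisive; there W ≥ 2 e M yields 2 M N² e⁵, twice the bound on `Y`.
      2Y≤wττ : ∀ k → 2# * Y ≤ fromℕ (2 ℕ.^ k ℕ.* W) * (τ k * τ k)
      2Y≤wττ k = begin
        2# * Y
          ≤⟨ *-monoˡ-≤ 0≤2 Y-small ⟩
        2# * (m * (n * n) * (e * (e * e) * (e * e)))
          ≈⟨ solve 3 (λ m n e → con (+ 2) ⊗ (m ⊗ (n ⊗ n) ⊗ (e ⊗ (e ⊗ e) ⊗ (e ⊗ e)))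
                := (((con (+ 2) ⊗ e) ⊗ m) ⊗ ((n ⊗ n) ⊗ ((e ⊗ e) ⊗ (e ⊗ e)))) ⊗ con (+ 1)) ≈-refl m n e ⟩
        (((2# * e) * m) * E) * 1#
          ≤⟨ *-mono-≤ (*-nonNegative (*-nonNegative (*-nonNegative 0≤2 (<⇒≤ 0<e)) (0≤fromℕ M)) 0≤E) 0≤1 (*-monoʳ-≤ 0≤E 2em≤W) (1≤2^ρ⁴ k) ⟩
        (fromℕ W * E) * (2^ k * ((ρ^ k * ρ^ k) * (ρ^ k * ρ^ k)))
          ≈⟨ solve 5 (λ w n e t r → (w ⊗ ((n ⊗ n) ⊗ ((e ⊗ e) ⊗ (e ⊗ e)))) ⊗ (t ⊗ ((r ⊗ r) ⊗ (r ⊗ r)))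
               := (t ⊗ w) ⊗ ((n ⊗ ((e ⊗ r) ⊗ (e ⊗ r))) ⊗ (n ⊗ ((e ⊗ r) ⊗ (e ⊗ r))))) ≈-refl (fromℕ W) n e (2^ k) (ρ^ k) ⟩
        (2^ k * fromℕ W) * (τ k * τ k)
          ≈⟨ *-congʳ (≈-sym (fromℕ-* (2 ℕ.^ k) W)) ⟩
        fromℕ (2 ℕ.^ k ℕ.* W) * (τ k * τ k)  ∎
        where
        E = (n * n) * ((e * e) * (e * e))
        0≤E = *-nonNegative (0≤x² n) (0≤x² (e * e))

      scale≤H : ∀ k → k ℕ.< J → 2 ℕ.^ k ℕ.* W ℕ.≤ H
      scale≤H k k<J = ℕ.*-cancelˡ-≤ 2 (ℕ.≤-trans (ℕ.≤-reflexive (≡.sym (ℕ.*-assoc 2 (2 ℕ.^ k) W)))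
        (ℕ.≤-trans (ℕ.*-monoˡ-≤ W (ℕ.^-monoʳ-≤ 2 k<J))
          (ℕ.≤-reflexive (≡.trans 2^J*W≡M (≡.trans (≡.sym H+H≡M) (≡.cong (H ℕ.+_) (≡.sym (ℕ.+-identityʳ H))))))))

      Q≤σ² : ∀ k → k ℕ.< J → 2 ℕ.^ k ℕ.* W ℕ.≤ M × Q (2 ℕ.^ k ℕ.* W) ≤ fromℕ (2 ℕ.^ k ℕ.* W) * (σ k * σ k)
      Q≤σ² k k<J = ℕ.≤-trans (scale≤H k k<J) (ℕ.≤-trans (ℕ.m≤m+n H H) (ℕ.≤-reflexive H+H≡M)) ,
        ≤-trans (Q≤τ (τ k) (8≤τ k k<J) (2 ℕ.^ k ℕ.* W) (scale≤H k k<J) (2Y≤wττ k))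
          (≤-reflexive (*-congˡ (solve 4 (λ m n e r → m ⊗ m ⊗ n ⊗ (n ⊗ ((e ⊗ r) ⊗ (e ⊗ r)))
                := ((m ⊗ n ⊗ e) ⊗ r) ⊗ ((m ⊗ n ⊗ e) ⊗ r)) ≈-refl m n e (ρ^ k))))

      window-difference≤ : ∀ p q → 2^ J * (window W p - window W q) ≤ m * ((m * n * e) * 8#)
      window-difference≤ p q = ≤-trans (window-difference W σ 0<σ J 2^J*W≡M Q≤σ² p q)
        (*-monoˡ-≤ (0≤fromℕ M) (begin
          Σ< J σ                     ≈⟨ *-distribˡ-sum {J} _ _ ⟨
          (m * n * e) * Σ< J ρ^      ≤⟨ *-monoˡ-≤ (*-nonNegative (*-nonNegative (0≤fromℕ M) (0≤fromℕ N)) (<⇒≤ 0<e)) (Σρ≤8 J) ⟩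
          (m * n * e) * 8#           ∎))

      W≤M : W ℕ.≤ M
      W≤M = ℕ.≤-trans (ℕ.m≤n*m W (2 ℕ.^ J) {{ℕ.m^n≢0 2 J}}) (ℕ.≤-reflexive 2^J*W≡M)

      -- By the bounded descent, `f` is at least f b - W N on the window that begins at b and at
      -- most f a + W N on the window that ends at a. The two means differ by at most 8 M N e, and 2
      -- W N ≤ 8 M N e because W ≤ 4 e M.
      f-rise≤ : ∀ a b → f b - f a ≤ fromℤ (+ 16) * (m * n * e)
      f-rise≤ a b = *-cancelˡ-≤ 0<m (begin
        m * (f b - f a)
          ≈⟨ ≈-trans (*-congʳ m≈) (solve 5 (λ t w b a n → (t ⊗ w) ⊗ (b ⊖ a)
                := t ⊗ (w ⊗ (b ⊖ w ⊗ n) ⊖ w ⊗ (a ⊕ w ⊗ n)) ⊕ (t ⊗ w) ⊗ (con (+ 2) ⊗ (w ⊗ n))) ≈-refl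
               (2^ J) (fromℕ W) (f b) (f a) n) ⟩
        2^ J * (fromℕ W * (f b - fromℕ W * n) - fromℕ W * (f a + fromℕ W * n)) + (2^ J * fromℕ W) * (2# * (fromℕ W * n))
          ≤⟨ +-mono-≤ (*-monoˡ-≤ (0≤fromℕ (2 ℕ.^ J)) (+-mono-≤ window-b (neg-mono-≤ window-a))) ≤-refl ⟩
        2^ J * (window W b - window W q) + (2^ J * fromℕ W) * (2# * (fromℕ W * n))
          ≤⟨ +-mono-≤ (window-difference≤ b q) (*-mono-≤ (*-nonNegative (0≤fromℕ (2 ℕ.^ J)) (0≤fromℕ W)) (*-nonNegative 0≤2 (*-nonNegative (0≤fromℕ W) (0≤fromℕ N)))
               (≤-reflexive (≈-sym m≈)) (*-monoˡ-≤ 0≤2 (*-monoʳ-≤ (0≤fromℕ N) W≤4em))) ⟩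
        m * ((m * n * e) * 8#) + m * (2# * (((fromℤ (+ 4) * e) * m) * n))
          ≈⟨ solve 3 (λ m n e → m ⊗ ((m ⊗ n ⊗ e) ⊗ con (+ 8)) ⊕ m ⊗ (con (+ 2) ⊗ (((con (+ 4) ⊗ e) ⊗ m) ⊗ n))
                := m ⊗ (con (+ 16) ⊗ (m ⊗ n ⊗ e))) ≈-refl m n e ⟩
        m * (fromℤ (+ 16) * (m * n * e))  ∎)
        where
        -- This is a - W modulo M, the start of the window that ends at a.
        q = a ℕ.+ (M ℕ.∸ W)

        window-b : fromℕ W * (f b - fromℕ W * n) ≤ window W b
        window-b = ≤-trans (≤-reflexive (≈-sym (sum-const W _))) (Σ<-mono W λ x x<W → begin
          f b - fromℕ W * n
            ≤⟨ +-mono-≤ (f-descent b x) (neg-mono-≤ (*-monoʳ-≤ (0≤fromℕ N) (fromℕ-mono (ℕ.<⇒≤ x<W)))) ⟩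
          (f (b ℕ.+ x) + fromℕ x * n) - fromℕ x * n
            ≈⟨ solve 2 (λ a c → (a ⊕ c) ⊖ c := a) ≈-refl (f (b ℕ.+ x)) (fromℕ x * n) ⟩
          f (b ℕ.+ x)  ∎)

        window-a : window W q ≤ fromℕ W * (f a + fromℕ W * n)
        window-a = ≤-trans (Σ<-mono W λ x x<W → begin
          f (q ℕ.+ x)
            ≤⟨ f-descent (q ℕ.+ x) (W ℕ.∸ x) ⟩
          f ((q ℕ.+ x) ℕ.+ (W ℕ.∸ x)) + fromℕ (W ℕ.∸ x) * n
            ≤⟨ +-mono-≤ (≤-reflexive (≈-trans (≈-reflexive (≡.cong f (arithmetic x (ℕ.<⇒≤ x<W)))) (f-periodic a)))
                 (*-monoʳ-≤ (0≤fromℕ N) (fromℕ-mono (ℕ.m∸n≤m W x))) ⟩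
          f a + fromℕ W * n  ∎) (≤-reflexive (sum-const W _))
          where
          arithmetic : ∀ x → x ℕ.≤ W → (q ℕ.+ x) ℕ.+ (W ℕ.∸ x) ≡ a ℕ.+ M
          arithmetic x x≤W = ≡.trans (ℕ.+-assoc q x (W ℕ.∸ x)) (≡.trans (≡.cong (q ℕ.+_) (ℕ.m+[n∸m]≡n x≤W))
            (≡.trans (ℕ.+-assoc a (M ℕ.∸ W) W) (≡.cong (a ℕ.+_) (ℕ.m∸n+n≡m W≤M))))

module TorusDistance {c ℓ₁ ℓ₂} (R : CompleteOrderedField c ℓ₁ ℓ₂) where

  open OrderedField R

  dist≤₀ : ∀ x y {t} → ∣ rep x - rep y ∣ ≤ t → dist x y ≤ t
  dist≤₀ x y = ≤-trans (x⊓y≤x _ _)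

  dist≤₋ : ∀ x y {t} → ∣ rep x - rep y - 1# ∣ ≤ t → dist x y ≤ t
  dist≤₋ x y = ≤-trans (≤-trans (x⊓y≤y _ _) (x⊓y≤x _ _))

  dist≤₊ : ∀ x y {t} → ∣ rep x - rep y + 1# ∣ ≤ t → dist x y ≤ t
  dist≤₊ x y = ≤-trans (≤-trans (x⊓y≤y _ _) (x⊓y≤y _ _))

-- Rounding the points and arcs of the circle to the grid.

-- i n = ⌊M x n⌋ is the grid cell of the point x n.
module Discretization {c ℓ₁ ℓ₂} (R : CompleteOrderedField c ℓ₁ ℓ₂) {N : ℕ} (x : Fin N → Real.𝕋 R) (1≤N : 1 ℕ.≤ N)
  (M : ℕ) .{{_ : ℕ.NonZero M}} where

  open OrderedField R
  open TorusDistance R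
  open ℕ-Solver.+-*-Solver using (_:+_) renaming (solve to ℕ-solve; _:=_ to _:=ℕ_)

  m n : Carrier
  m = fromℕ M
  n = fromℕ N

  0<m : 0# < m
  0<m = 0<fromℕ (ℕ.>-nonZero⁻¹ M)

  0<n : 0# < n
  0<n = 0<fromℕ 1≤N

  cell : ∀ k → ∃[ i ] i ℕ.< M × fromℕ i ≤ m * rep (x k) × m * rep (x k) < fromℕ (suc i)
  cell k = floor M (m * rep (x k)) (*-nonNegative (<⇒≤ 0<m) (0≤rep (x k)))
    (<-≤-trans (*-monoˡ-< 0<m (rep<1 (x k))) (≤-reflexive (*-identityʳ m)))

  i : Fin N → ℕ
  i k = proj₁ (cell k)

  i<M : ∀ k → i k ℕ.< M
  i<M k = proj₁ (proj₂ (cell k))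

  i≤ : ∀ k → fromℕ (i k) ≤ m * rep (x k)
  i≤ k = proj₁ (proj₂ (proj₂ (cell k)))

  <1+i : ∀ k → m * rep (x k) < fromℕ (suc (i k))
  <1+i k = proj₂ (proj₂ (proj₂ (cell k)))

  open GridPoints R M N i i<M public

  -- The value of the integration variable for which the distance threshold s/N is k/M.
  s : ℕ → Carrier
  s k = fromℕ k * (n / m)

  ms≈ : ∀ k → m * s k ≈ fromℕ k * n
  ms≈ k = ≈-trans (solve 3 (λ m k h → m ⊗ (k ⊗ h) := k ⊗ (m ⊗ h)) ≈-refl m (fromℕ k) (n / m)) (*-congˡ (/-*-cancel 0<m n))

  scaled≤ : ∀ {z k} → m * z ≤ fromℕ k → z ≤ s k / n
  scaled≤ {z} {k} mz≤k = *-cancelˡ-≤ (0<* 0<m 0<n) (begin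
    (m * n) * z            ≈⟨ solve 3 (λ m n z → (m ⊗ n) ⊗ z := (m ⊗ z) ⊗ n) ≈-refl m n z ⟩
    (m * z) * n            ≤⟨ *-monoʳ-≤ (<⇒≤ 0<n) mz≤k ⟩
    fromℕ k * n            ≈⟨ ms≈ k ⟨
    m * s k                ≈⟨ *-congˡ (/-*-cancel 0<n (s k)) ⟨
    m * (n * (s k / n))    ≈⟨ *-assoc _ _ _ ⟨
    (m * n) * (s k / n)    ∎)

  division : ∀ z {j} → z % M ≡ j → z ≡ j ℕ.+ z ℕ./ M ℕ.* M
  division z ≡.refl = m≡m%n+[m/n]*n z M

  quotient : ∀ z {j} → z % M ≡ j → fromℕ z ≈ fromℕ j + fromℕ (z ℕ./ M) * m
  quotient z {j} hit≡ = ≈-trans (≈-reflexive (≡.cong fromℕ (division z hit≡)))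
    (≈-trans (fromℕ-+ j _) (+-congˡ (fromℕ-* (z ℕ./ M) M)))

  module _ (H : ℕ) (H+H≡M : H ℕ.+ H ≡ M) where

    -- Rounding down changes the scaled difference of the two points by less than 1, and w - t has
    -- modulus at most w; together w + 1. The shift κ by whole turns is the same for cells and for
    -- representatives.
    near : ∀ a b w t κ → t ℕ.≤ w ℕ.+ w → (fromℕ (i a) - fromℕ (i b)) + κ * m ≈ fromℕ w - fromℕ t →
           ∀ {z} → z ≈ (rep (x a) - rep (x b)) + κ → ∣ z ∣ ≤ s (suc w) / n
    near a b w t κ t≤2w e {z} z≈ = ∣x∣≤
      (scaled≤ {z} {suc w} (≤-by (0≤+ (0≤+ (<⇒≤ (0<y-x (<1+i a))) ⟨ i≤ b ⟩) (0≤fromℕ t))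
        (≈-trans
          (≈-trans (solve 2 (λ w t → con (+ 1) ⊕ w
                := (con (+ 1) ⊕ (w ⊖ t)) ⊕ t) ≈-refl (fromℕ w) (fromℕ t)) (+-congʳ (+-congˡ (≈-sym e))))
          (≈-trans (solve 7 (λ m ra rb ia ib κ t → (con (+ 1) ⊕ ((ia ⊖ ib) ⊕ κ ⊗ m)) ⊕ t :=
            m ⊗ ((ra ⊖ rb) ⊕ κ) ⊕ ((((con (+ 1) ⊕ ia) ⊖ m ⊗ ra) ⊕ (m ⊗ rb ⊖ ib)) ⊕ t)) ≈-refl
            m (rep (x a)) (rep (x b)) (fromℕ (i a)) (fromℕ (i b)) κ (fromℕ t)) (+-congʳ (*-congˡ (≈-sym z≈)))))))
      (scaled≤ { - z} {suc w} (≤-by (0≤+ (0≤+ (<⇒≤ (0<y-x (<1+i b))) ⟨ i≤ a ⟩) ⟨ fromℕ-mono t≤2w ⟩)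
        (≈-trans
          (≈-trans (solve 2 (λ w t → con (+ 1) ⊕ w := (con (+ 1) ⊖ (w ⊖ t)) ⊕ ((w ⊕ w) ⊖ t)) ≈-refl (fromℕ w) (fromℕ t))
            (+-cong (+-congˡ (-‿cong (≈-sym e))) (+-congʳ (≈-sym (fromℕ-+ w w)))))
          (≈-trans (solve 7 (λ m ra rb ia ib κ u → (con (+ 1) ⊖ ((ia ⊖ ib) ⊕ κ ⊗ m)) ⊕ u :=
            m ⊗ (⊝ ((ra ⊖ rb) ⊕ κ)) ⊕ ((((con (+ 1) ⊕ ib) ⊖ m ⊗ rb) ⊕ (m ⊗ ra ⊖ ia)) ⊕ u)) ≈-refl
            m (rep (x a)) (rep (x b)) (fromℕ (i a)) (fromℕ (i b)) κ (fromℕ (w ℕ.+ w) - fromℕ t)) (+-congʳ (*-congˡ (-‿cong (≈-sym z≈))))))))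

    -- Dividing v + i a + t by M leaves i b with quotient q equal to 0, 1 or 2. As v already
    -- contains one turn, the points differ by 1 - q turns, and the three values of q select the
    -- three terms of `dist`.
    hit⇒close : ∀ {v w} → v ℕ.+ w ≡ M → w ℕ.< H → ∀ a b t → t ℕ.< suc (w ℕ.+ w) →
                ((v ℕ.+ i a) ℕ.+ t) % M ≡ i b → dist (x a) (x b) ≤ s (suc w) / n
    hit⇒close {v} {w} v+w≡M w<H a b t (s≤s t≤2w) hit≡ =
      cases (z ℕ./ M) (m<n*o⇒m/o<n z<3M) (quotient z hit≡)
      where
      z = (v ℕ.+ i a) ℕ.+ t

      z<3M : z ℕ.< 3 ℕ.* M
      z<3M = ℕ.≤-<-trans (ℕ.+-monoʳ-≤ (v ℕ.+ i a) t≤2w) (ℕ.<-≤-trans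
        (ℕ.≤-<-trans (ℕ.≤-reflexive rearrange) (ℕ.+-mono-<-≤ (ℕ.+-monoʳ-< M (i<M a)) (ℕ.≤-trans (ℕ.<⇒≤ w<H) (ℕ.≤-trans (ℕ.m≤m+n H H) (ℕ.≤-reflexive H+H≡M)))))
        (ℕ.≤-reflexive (≡.trans (ℕ.+-assoc M M M) (≡.cong (λ k → M ℕ.+ (M ℕ.+ k)) (≡.sym (ℕ.+-identityʳ M))))))
        where
        rearrange : (v ℕ.+ i a) ℕ.+ (w ℕ.+ w) ≡ (M ℕ.+ i a) ℕ.+ w
        rearrange = ≡.trans (ℕ-solve 3 (λ v w j → (v :+ j) :+ (w :+ w) :=ℕ ((v :+ w) :+ j) :+ w) ≡.refl v w (i a))
          (≡.cong (λ k → (k ℕ.+ i a) ℕ.+ w) v+w≡M)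

      z≈ : fromℕ z ≈ ((m - fromℕ w) + fromℕ (i a)) + fromℕ t
      z≈ = ≈-trans (fromℕ-+ (v ℕ.+ i a) t) (+-congʳ (≈-trans (fromℕ-+ v (i a)) (+-congʳ (begin-equality
        fromℕ v                          ≈⟨ solve 2 (λ v w → v := (v ⊕ w) ⊖ w) ≈-refl (fromℕ v) (fromℕ w) ⟩
        (fromℕ v + fromℕ w) - fromℕ w    ≈⟨ +-congʳ (≈-trans (≈-sym (fromℕ-+ v w)) (≈-reflexive (≡.cong fromℕ v+w≡M))) ⟩
        m - fromℕ w                      ∎))))

      difference : ∀ q → fromℕ z ≈ fromℕ (i b) + fromℕ q * m →
                   (fromℕ (i a) - fromℕ (i b)) + (1# - fromℕ q) * m ≈ fromℕ w - fromℕ t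
      difference q e = begin-equality
        (ia - ib) + (1# - fromℕ q) * m
          ≈⟨ solve 6 (λ m ia ib q w t → (ia ⊖ ib) ⊕ (con (+ 1) ⊖ q) ⊗ m
                := (w ⊖ t) ⊕ ((((m ⊖ w) ⊕ ia) ⊕ t) ⊖ (ib ⊕ q ⊗ m))) ≈-refl m ia ib (fromℕ q) (fromℕ w) (fromℕ t) ⟩
        (fromℕ w - fromℕ t) + ((((m - fromℕ w) + ia) + fromℕ t) - (ib + fromℕ q * m))
          ≈⟨ +-congˡ (+-cong (≈-sym z≈) (-‿cong (≈-sym e))) ⟩
        (fromℕ w - fromℕ t) + (fromℕ z - fromℕ z)
          ≈⟨ solve 2 (λ u z → u ⊕ (z ⊖ z) := u) ≈-refl (fromℕ w - fromℕ t) (fromℕ z) ⟩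
        fromℕ w - fromℕ t  ∎
        where
        ia = fromℕ (i a)
        ib = fromℕ (i b)

      cases : ∀ q → q ℕ.< 3 → fromℕ z ≈ fromℕ (i b) + fromℕ q * m → dist (x a) (x b) ≤ s (suc w) / n
      cases 0 _ e = dist≤₊ (x a) (x b) (near a b w t _ t≤2w (difference 0 e)
        (solve 1 (λ d → d ⊕ con (+ 1) := d ⊕ (con (+ 1) ⊖ con (+ 0))) ≈-refl (rep (x a) - rep (x b))))
      cases 1 _ e = dist≤₀ (x a) (x b) (near a b w t _ t≤2w (difference 1 e)
        (solve 1 (λ d → d := d ⊕ (con (+ 1) ⊖ (con (+ 1) ⊕ con (+ 0)))) ≈-refl (rep (x a) - rep (x b))))
      cases 2 _ e = dist≤₋ (x a) (x b) (near a b w t _ t≤2w (difference 2 e)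
        (solve 1 (λ d → d ⊖ con (+ 1)
              := d ⊕ (con (+ 1) ⊖ (con (+ 1) ⊕ (con (+ 1) ⊕ con (+ 0))))) ≈-refl (rep (x a) - rep (x b))))
      cases (suc (suc (suc _))) (s≤s (s≤s (s≤s ()))) _

    y : ℕ → Carrier
    y w = 1# / n * fromℕ (#ClosePairs x (s (suc w))) - fromℕ 2 * s (suc w)

    -- A point lies in its own range of cells but is no close pair with itself, hence the diagonal
    -- indicator. Since 2w + 1 ≤ M, the range meets the cell of b at most once.
    count-close : ∀ {v w} → v ℕ.+ w ≡ M → w ℕ.< H → ∀ a b →
                  count (v ℕ.+ i a) (suc (w ℕ.+ w)) b ≤ indicator (a Fin.≟ b) + indicator (closePair? x (s (suc w)) (a , b))
    count-close {v} {w} v+w≡M w<H a b = bound (a Fin.≟ b)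
      where
      2w+1≤M : suc (w ℕ.+ w) ℕ.≤ M
      2w+1≤M = ℕ.≤-trans (ℕ.+-mono-≤ w<H (ℕ.<⇒≤ w<H)) (ℕ.≤-reflexive H+H≡M)

      bound : (a≟b : Dec (a ≡ b)) →
              count (v ℕ.+ i a) (suc (w ℕ.+ w)) b ≤ indicator a≟b + indicator (closePair? x (s (suc w)) (a , b))
      bound (yes _)  = ≤-trans (count≤1 _ 2w+1≤M b) (≤-by (0≤indicator (closePair? x (s (suc w)) (a , b))) ≈-refl)
      bound (no a≢b) = ≤-trans
        (count≤indicator _ 2w+1≤M b (closePair? x (s (suc w)) (a , b)) (λ t t< hit≡ → a≢b , hit⇒close {v} {w} v+w≡M w<H a b t t< hit≡))
        (≤-reflexive (≈-sym (+-identityˡ _)))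

    module _ (N≤M : N ℕ.≤ M) where

      open DiscreteBound R M N i i<M 1≤N N≤M H H+H≡M y public
        using (CountBound; Y; f-rise≤; W≤4em)

      countBound : CountBound
      countBound v w v+w≡M w<H = begin
        m * sum (λ a → sum (count (v ℕ.+ i a) (suc (w ℕ.+ w))))
          ≤⟨ *-monoˡ-≤ (<⇒≤ 0<m) (sum-mono (λ a → sum-mono (count-close {v} {w} v+w≡M w<H a))) ⟩
        m * sum (λ a → sum (λ b → indicator (a Fin.≟ b) + indicator (closePair? x (s (suc w)) (a , b))))
          ≈⟨ *-congˡ (≈-trans (sum-cong-≋ row) (≈-trans (∑-distrib-+ {N} (λ _ → 1#) _)
               (+-cong (sum-const N 1#) (≈-sym (sum-indicator₂ (closePair? x (s (suc w))) {N} {N} id id))))) ⟩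
        m * (n * 1# + F)
          ≈⟨ *-congˡ (+-congˡ (≈-sym (/-*-cancel 0<n F))) ⟩
        m * (n * 1# + n * (F * n ⁻¹))
          ≈⟨ solve 6 (λ m n F n′ k S → m ⊗ (n ⊗ con (+ 1) ⊕ n ⊗ (F ⊗ n′))
                := m ⊗ (n ⊕ n ⊗ (con (+ 1) ⊗ n′ ⊗ F ⊖ (con (+ 1) ⊕ (con (+ 1) ⊕ con (+ 0))) ⊗ S)) ⊕ (con (+ 2) ⊗ n) ⊗ (m ⊗ S)) ≈-refl
               m n F (n ⁻¹) (fromℕ (suc w)) (s (suc w)) ⟩
        m * (n + n * y w) + (2# * n) * (m * s (suc w))
          ≈⟨ +-congˡ (≈-trans (*-congˡ (ms≈ (suc w))) (solve 2 (λ n k → (con (+ 2) ⊗ n) ⊗ (k ⊗ n)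
                := (con (+ 2) ⊗ k) ⊗ (n ⊗ n)) ≈-refl n (fromℕ (suc w)))) ⟩
        m * (n + n * y w) + (2# * fromℕ (suc w)) * (n * n)  ∎
        where
        F = fromℕ (#ClosePairs x (s (suc w)))
        row : ∀ a → sum (λ b → indicator (a Fin.≟ b) + indicator (closePair? x (s (suc w)) (a , b)))
                    ≈ 1# + sum (λ b → indicator (closePair? x (s (suc w)) (a , b)))
        row a = ≈-trans (∑-distrib-+ {N} (λ b → indicator (a Fin.≟ b)) _) (+-congʳ (sum-diagonal a))

  -- Arcs compared with ranges of cells.

  module ArcCells (I : Arc) (p q : ℕ) (p<M : p ℕ.< M)
    (p≤ : fromℕ p ≤ m * rep (start I)) (<1+p : m * rep (start I) < fromℕ (suc p))
    (q≤ : fromℕ q ≤ m * (rep (start I) + arcLength I)) (<1+q : m * (rep (start I) + arcLength I) < fromℕ (suc q)) where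

    private
      a₀ = rep (start I)
      L  = arcLength I
      #I = fromℕ (#In x I)

      precedes⇒≤ : ∀ {u v e} → Precedes u v e → u ≤ v
      precedes⇒≤ (weakly u≤v)   = u≤v
      precedes⇒≤ (strictly u<v) = <⇒≤ u<v

      <⇒precedes : ∀ {u v} e → u < v → Precedes u v e
      <⇒precedes included u<v = weakly (<⇒≤ u<v)
      <⇒precedes excluded u<v = strictly u<v

      #I≈ : #I ≈ sum (λ k → indicator (x k ∈ᴬ? I))
      #I≈ = sum-indicator (λ k → x k ∈ᴬ? I) id

      lift-hit : ∀ k j u → fromℕ j ≤ m * u → m * u < fromℕ (suc j) → j % M ≡ i k → InLift I u →
                 ∃[ t ] t ℕ.< suc q ℕ.∸ p × (p ℕ.+ t) % M ≡ i k
      lift-hit k j u j≤ <1+j j%M (a₀≤u , u≤) = j ℕ.∸ p , ℕ.∸-monoˡ-< (s≤s j≤q) p≤j , ≡.trans (≡.cong (_% M) (ℕ.m+[n∸m]≡n p≤j)) j%M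
        where
        p≤j : p ℕ.≤ j
        p≤j = ℕ.≤-pred (fromℕ-cancel-< (≤-<-trans (≤-trans p≤ (*-monoˡ-≤ (<⇒≤ 0<m) (precedes⇒≤ a₀≤u))) <1+j))
        j≤q : j ℕ.≤ q
        j≤q = ℕ.≤-pred (fromℕ-cancel-< (≤-<-trans (≤-trans j≤ (*-monoˡ-≤ (<⇒≤ 0<m) (precedes⇒≤ u≤))) <1+q))

      m[u+1]≈ : ∀ u → m * (u + 1#) ≈ m * u + m
      m[u+1]≈ u = solve 2 (λ m u → m ⊗ (u ⊕ con (+ 1)) := m ⊗ u ⊕ m) ≈-refl m u

      i+M≤ : ∀ k → fromℕ (i k ℕ.+ M) ≤ m * (rep (x k) + 1#)
      i+M≤ k = ≤-trans (≤-reflexive (fromℕ-+ (i k) M)) (≤-trans (+-mono-≤ (i≤ k) ≤-refl) (≤-reflexive (≈-sym (m[u+1]≈ _))))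

      <1+i+M : ∀ k → m * (rep (x k) + 1#) < fromℕ (suc (i k ℕ.+ M))
      <1+i+M k = <-by (0<y-x (<1+i k)) (≈-trans (+-congˡ (fromℕ-+ (i k) M))
        (solve 3 (λ m u i → con (+ 1) ⊕ (i ⊕ m)
              := m ⊗ (u ⊕ con (+ 1)) ⊕ ((con (+ 1) ⊕ i) ⊖ m ⊗ u)) ≈-refl m (rep (x k)) (fromℕ (i k))))

      ∈⇒hit : ∀ k → x k ∈ᴬ I → ∃[ t ] t ℕ.< suc q ℕ.∸ p × (p ℕ.+ t) % M ≡ i k
      ∈⇒hit k (inj₁ in-I) = lift-hit k (i k) (rep (x k)) (i≤ k) (<1+i k) (m<n⇒m%n≡m (i<M k)) in-I
      ∈⇒hit k (inj₂ in-I) = lift-hit k (i k ℕ.+ M) (rep (x k) + 1#) (i+M≤ k) (<1+i+M k)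
        (≡.trans ([m+n]%n≡m%n (i k) M) (m<n⇒m%n≡m (i<M k))) in-I

      inside : ∀ j u → suc p ℕ.≤ j → suc j ℕ.≤ q → fromℕ j ≤ m * u → m * u < fromℕ (suc j) → InLift I u
      inside j u p<j j<q j≤ <1+j =
        <⇒precedes (left I) (*-cancelˡ-< (<⇒≤ 0<m) (<-≤-trans <1+p (≤-trans (fromℕ-mono p<j) j≤))) ,
        <⇒precedes (right I) (*-cancelˡ-< (<⇒≤ 0<m) (<-≤-trans <1+j (≤-trans (fromℕ-mono j<q) q≤)))

      q≤p+M : q ℕ.≤ p ℕ.+ M
      q≤p+M = ℕ.≤-pred (fromℕ-cancel-< (≤-<-trans q≤ (<-≤-trans
        (<-by {y = fromℕ (suc p) + m} (0<+ (0<y-x <1+p) (*-nonNegative (<⇒≤ 0<m) ⟨ arcLength≤1 I ⟩))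
          (solve 4 (λ m a l p → p ⊕ m := m ⊗ (a ⊕ l) ⊕ ((p ⊖ m ⊗ a) ⊕ m ⊗ (con (+ 1) ⊖ l))) ≈-refl m a₀ L (fromℕ (suc p))))
        (≤-reflexive (≈-sym (fromℕ-+ (suc p) M))))))

      hit⇒∈ : ∀ k t → t ℕ.< q ℕ.∸ suc p → (suc p ℕ.+ t) % M ≡ i k → x k ∈ᴬ I
      hit⇒∈ k t t< hit≡ = cases (z ℕ./ M) (m<n*o⇒m/o<n z<2M) (division z hit≡)
        where
        z = suc p ℕ.+ t

        z<q : z ℕ.< q
        z<q = ℕ.<-≤-trans (ℕ.+-monoʳ-< (suc p) t<) (ℕ.≤-reflexive (ℕ.m+[n∸m]≡n (ℕ.<⇒≤ (ℕ.m∸n≢0⇒n<m {q} {suc p} λ q∸p≡0 → ℕ.n≮0 (≡.subst (t ℕ.<_) q∸p≡0 t<)))))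

        z<2M : z ℕ.< 2 ℕ.* M
        z<2M = ℕ.<-≤-trans z<q (ℕ.≤-trans q≤p+M (ℕ.≤-trans (ℕ.+-monoˡ-≤ M (ℕ.<⇒≤ p<M)) (ℕ.≤-reflexive (≡.cong (M ℕ.+_) (≡.sym (ℕ.+-identityʳ M))))))

        cases : ∀ d → d ℕ.< 2 → z ≡ i k ℕ.+ d ℕ.* M → x k ∈ᴬ I
        cases 0 _ e = inj₁ (inside (i k) (rep (x k)) (ℕ.≤-trans (ℕ.m≤m+n (suc p) t) (ℕ.≤-reflexive e′)) (≡.subst (ℕ._< q) e′ z<q) (i≤ k) (<1+i k))
          where e′ = ≡.trans e (ℕ.+-identityʳ (i k))
        cases 1 _ e = inj₂ (inside (i k ℕ.+ M) (rep (x k) + 1#) (ℕ.≤-trans (ℕ.m≤m+n (suc p) t) (ℕ.≤-reflexive e′)) (≡.subst (ℕ._< q) e′ z<q) (i+M≤ k) (<1+i+M k))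
          where e′ = ≡.trans e (≡.cong (i k ℕ.+_) (ℕ.+-identityʳ M))
        cases (suc (suc _)) (s≤s (s≤s ())) _

    -- The cells from p to q cover the arc, and there are fewer than M L + 2 of them; the two extra
    -- cells cost 2 N.
    excess-rise : ∃[ a ] ∃[ b ] (m * #I - m * L * n) - 2# * n ≤ f b - f a
    excess-rise = p , p ℕ.+ (suc q ℕ.∸ p) , (begin
      (m * #I - m * L * n) - 2# * n
        ≤⟨ +-mono-≤ (+-mono-≤ (*-monoˡ-≤ (<⇒≤ 0<m) (≤-trans (≤-reflexive #I≈) (sum-mono (λ k → indicator≤count p (suc q ℕ.∸ p) k (x k ∈ᴬ? I) (∈⇒hit k))))) ≤-refl) ≤-refl ⟩
      (m * sum (count p (suc q ℕ.∸ p)) - m * L * n) - 2# * n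
        ≤⟨ ≤-by (*-nonNegative (<⇒≤ 0<n) (0≤+ ⟨ q≤ ⟩ (<⇒≤ (0<y-x <1+p))))
             (solve 7 (λ C m l n a p q → C ⊖ ((con (+ 1) ⊕ q) ⊖ p) ⊗ n
                   := ((C ⊖ m ⊗ l ⊗ n) ⊖ con (+ 2) ⊗ n) ⊕ n ⊗ ((m ⊗ (a ⊕ l) ⊖ q) ⊕ ((con (+ 1) ⊕ p) ⊖ m ⊗ a))) ≈-refl
               (m * sum (count p (suc q ℕ.∸ p))) m L n a₀ (fromℕ p) (fromℕ q)) ⟩
      m * sum (count p (suc q ℕ.∸ p)) - (fromℕ (suc q) - fromℕ p) * n
        ≈⟨ +-congˡ (-‿cong (*-congʳ length≈)) ⟩
      m * sum (count p (suc q ℕ.∸ p)) - fromℕ (suc q ℕ.∸ p) * n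
        ≈⟨ f-difference p (suc q ℕ.∸ p) ⟨
      f (p ℕ.+ (suc q ℕ.∸ p)) - f p  ∎)
      where
      p≤1+q : p ℕ.≤ suc q
      p≤1+q = ℕ.<⇒≤ (fromℕ-cancel-< (≤-<-trans p≤ (≤-<-trans (*-monoˡ-≤ (<⇒≤ 0<m) (≤-by (0≤arcLength I) ≈-refl)) <1+q)))
      length≈ : fromℕ (suc q) - fromℕ p ≈ fromℕ (suc q ℕ.∸ p)
      length≈ = ≈-trans (+-congʳ (≈-trans (≈-reflexive (≡.cong fromℕ (≡.sym (ℕ.m∸n+n≡m p≤1+q)))) (fromℕ-+ (suc q ℕ.∸ p) p)))
        (solve 2 (λ a b → (a ⊕ b) ⊖ b := a) ≈-refl (fromℕ (suc q ℕ.∸ p)) (fromℕ p))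

    -- The cells strictly between p and q lie inside the arc, whatever its endpoints include, and
    -- there are more than M L - 2 of them.
    deficit-rise-long : suc p ℕ.≤ q → (m * L * n - m * #I) - 2# * n ≤ f (suc p) - f q
    deficit-rise-long p<q = begin
      (m * L * n - m * #I) - 2# * n
        ≤⟨ +-mono-≤ (+-mono-≤ ≤-refl (neg-mono-≤ (*-monoˡ-≤ (<⇒≤ 0<m) (≤-trans
             (sum-mono (λ k → count≤indicator (suc p) ℓ≤M k (x k ∈ᴬ? I) (hit⇒∈ k))) (≤-reflexive (≈-sym #I≈)))))) ≤-refl ⟩
      (m * L * n - m * sum (count (suc p) (q ℕ.∸ suc p))) - 2# * n
        ≤⟨ ≤-by (*-nonNegative (<⇒≤ 0<n) (0≤+ ⟨ p≤ ⟩ (<⇒≤ (0<y-x <1+q))))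
             (solve 7 (λ C m l n a p q → ⊝ (C ⊖ (q ⊖ (con (+ 1) ⊕ p)) ⊗ n)
                   := ((m ⊗ l ⊗ n ⊖ C) ⊖ con (+ 2) ⊗ n) ⊕ n ⊗ ((m ⊗ a ⊖ p) ⊕ ((con (+ 1) ⊕ q) ⊖ m ⊗ (a ⊕ l)))) ≈-refl
               (m * sum (count (suc p) (q ℕ.∸ suc p))) m L n a₀ (fromℕ p) (fromℕ q)) ⟩
      - (m * sum (count (suc p) (q ℕ.∸ suc p)) - (fromℕ q - fromℕ (suc p)) * n)
        ≈⟨ -‿cong (≈-trans (+-congˡ (-‿cong (*-congʳ length≈))) (≈-sym (f-difference (suc p) (q ℕ.∸ suc p)))) ⟩
      - (f (suc p ℕ.+ (q ℕ.∸ suc p)) - f (suc p))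
        ≈⟨ solve 2 (λ a b → ⊝ (a ⊖ b) := b ⊖ a) ≈-refl (f (suc p ℕ.+ (q ℕ.∸ suc p))) (f (suc p)) ⟩
      f (suc p) - f (suc p ℕ.+ (q ℕ.∸ suc p))
        ≡⟨ ≡.cong (λ k → f (suc p) - f k) (ℕ.m+[n∸m]≡n p<q) ⟩
      f (suc p) - f q  ∎
      where
      ℓ≤M : q ℕ.∸ suc p ℕ.≤ M
      ℓ≤M = ℕ.≤-trans (ℕ.∸-monoˡ-≤ (suc p) (ℕ.m≤n⇒m≤1+n q≤p+M)) (ℕ.≤-reflexive (ℕ.m+n∸m≡n (suc p) M))
      length≈ : fromℕ q - fromℕ (suc p) ≈ fromℕ (q ℕ.∸ suc p)
      length≈ = ≈-trans (+-congʳ (≈-trans (≈-reflexive (≡.cong fromℕ (≡.sym (ℕ.m∸n+n≡m p<q)))) (fromℕ-+ (q ℕ.∸ suc p) (suc p))))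
        (solve 2 (λ a b → (a ⊕ b) ⊖ b := a) ≈-refl (fromℕ (q ℕ.∸ suc p)) (fromℕ (suc p)))

    deficit-rise-short : q ℕ.≤ p → (m * L * n - m * #I) - 2# * n ≤ f p - f p
    deficit-rise-short q≤p = ≤-by
      (0≤+ (0≤+ (*-nonNegative (<⇒≤ 0<n) (0≤+ (0≤+ ⟨ p≤ ⟩ (<⇒≤ (0<y-x <1+q))) ⟨ fromℕ-mono q≤p ⟩)) (*-nonNegative (<⇒≤ 0<m) (0≤fromℕ (#In x I)))) (<⇒≤ 0<n))
      (solve 8 (λ F m l n a p q g → g ⊖ g
            := ((m ⊗ l ⊗ n ⊖ m ⊗ F) ⊖ con (+ 2) ⊗ n) ⊕ ((n ⊗ (((m ⊗ a ⊖ p) ⊕ ((con (+ 1) ⊕ q) ⊖ m ⊗ (a ⊕ l))) ⊕ (p ⊖ q)) ⊕ m ⊗ F) ⊕ n)) ≈-refl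
        #I m L n a₀ (fromℕ p) (fromℕ q) (f p))

    deficit-rise : ∃[ a ] ∃[ b ] (m * L * n - m * #I) - 2# * n ≤ f b - f a
    deficit-rise = [ (λ p<q → q , suc p , deficit-rise-long p<q) , (λ q≤p → p , p , deficit-rise-short q≤p) ]′ (ℕ.<-≤-connex p q)

    -- The grid is fine enough that the rounding error 2 N is at most 16 M N e, as much as the rise
    -- itself.
    deviation≤ : ∀ e → 1# ≤ fromℤ (+ 8) * (m * e) → (∀ a b → f b - f a ≤ fromℤ (+ 16) * (m * n * e)) →
                 arcDeviation x I ≤ fromℤ (+ 32) * e
    deviation≤ e 1≤8me rise≤ = ∣x∣≤
      (scaled (bound excess-rise) deviation≈)
      (scaled (bound deficit-rise) (≈-trans (solve 2 (λ a b → a ⊗ (⊝ b) := ⊝ (a ⊗ b)) ≈-refl (m * n) (#I / n - L))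
        (≈-trans (-‿cong deviation≈) (solve 2 (λ a b → ⊝ (a ⊖ b) := b ⊖ a) ≈-refl (m * #I) (m * L * n)))))
      where
      bound : ∀ {u} → ∃[ a ] ∃[ b ] u - 2# * n ≤ f b - f a → u ≤ fromℤ (+ 16) * (m * n * e) + 2# * n
      bound {u} (a , b , rise) = ≤-by ⟨ ≤-trans rise (rise≤ a b) ⟩
        (solve 3 (λ u n c → c ⊕ con (+ 2) ⊗ n := u ⊕ (c ⊖ (u ⊖ con (+ 2) ⊗ n))) ≈-refl u n (fromℤ (+ 16) * (m * n * e)))

      scaled : ∀ {d u} → u ≤ fromℤ (+ 16) * (m * n * e) + 2# * n → (m * n) * d ≈ u → d ≤ fromℤ (+ 32) * e
      scaled {d} {u} u≤ d≈u = *-cancelˡ-≤ (0<* 0<m 0<n) (begin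
        (m * n) * d
          ≈⟨ d≈u ⟩
        u
          ≤⟨ u≤ ⟩
        fromℤ (+ 16) * (m * n * e) + 2# * n
          ≤⟨ ≤-by (*-nonNegative (*-nonNegative 0≤2 (<⇒≤ 0<n)) ⟨ 1≤8me ⟩)
               (solve 3 (λ m n e → (m ⊗ n) ⊗ (con (+ 32) ⊗ e)
                     := (con (+ 16) ⊗ (m ⊗ n ⊗ e) ⊕ con (+ 2) ⊗ n) ⊕ (con (+ 2) ⊗ n) ⊗ (con (+ 8) ⊗ (m ⊗ e) ⊖ con (+ 1))) ≈-refl m n e) ⟩
        (m * n) * (fromℤ (+ 32) * e)  ∎)

      deviation≈ : (m * n) * (#I / n - L) ≈ m * #I - m * L * n
      deviation≈ = ≈-trans (solve 4 (λ m n u l → (m ⊗ n) ⊗ (u ⊖ l) := m ⊗ (n ⊗ u) ⊖ m ⊗ l ⊗ n) ≈-refl m n (#I / n) L)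
        (+-congʳ (*-congˡ (/-*-cancel 0<n #I)))

  arc-deviation≤ : ∀ e → 1# ≤ fromℤ (+ 8) * (m * e) → (∀ a b → f b - f a ≤ fromℤ (+ 16) * (m * n * e)) →
                   ∀ I → arcDeviation x I ≤ fromℤ (+ 32) * e
  arc-deviation≤ e 1≤8me rise≤ I = combine
    (floor M (m * rep (start I)) (*-nonNegative (<⇒≤ 0<m) (0≤rep (start I)))
      (<-≤-trans (*-monoˡ-< 0<m (rep<1 (start I))) (≤-reflexive (*-identityʳ m))))
    (floor (M ℕ.+ M) (m * (rep (start I) + arcLength I))
      (*-nonNegative (<⇒≤ 0<m) (0≤+ (0≤rep (start I)) (0≤arcLength I)))
      (<-≤-trans (*-monoˡ-< 0<m (<-by (0<+ (0<y-x (rep<1 (start I))) ⟨ arcLength≤1 I ⟩)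
          (solve 2 (λ a l → con (+ 2)
                := (a ⊕ l) ⊕ ((con (+ 1) ⊖ a) ⊕ (con (+ 1) ⊖ l))) ≈-refl (rep (start I)) (arcLength I))))
        (≤-reflexive (≈-trans (solve 1 (λ m → m ⊗ con (+ 2) := m ⊕ m) ≈-refl m) (≈-sym (fromℕ-+ M M))))))
    where
    combine : ∃[ p ] p ℕ.< M × fromℕ p ≤ m * rep (start I) × m * rep (start I) < fromℕ (suc p) →
              ∃[ q ] q ℕ.< M ℕ.+ M × fromℕ q ≤ m * (rep (start I) + arcLength I) × m * (rep (start I) + arcLength I) < fromℕ (suc q) →
              arcDeviation x I ≤ fromℤ (+ 32) * e
    combine (p , p<M , p≤ , <1+p) (q , _ , q≤ , <1+q) =
      ArcCells.deviation≤ I p q p<M p≤ <1+p q≤ <1+q e 1≤8me rise≤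

-- Riemann sums with equal steps.

module UniformPartition {c ℓ₁ ℓ₂} (R : CompleteOrderedField c ℓ₁ ℓ₂)
  (h : CompleteOrderedField.Carrier R) (0≤h : CompleteOrderedField._≤_ R (CompleteOrderedField.0# R) h) where

  open OrderedField R
  open RangeSums R

  node : ℕ → Carrier
  node k = fromℕ k * h

  node-suc : ∀ k → node (suc k) ≈ node k + h
  node-suc k = solve 2 (λ k h → (con (+ 1) ⊕ k) ⊗ h := k ⊗ h ⊕ h) ≈-refl (fromℕ k) h

  -- The tags are right ends, because cells that differ by w are charged to the distance (w + 1)/M.
  -- The ends are free up to `_≈_`, since 0 and N/2 are nodes only up to `_≈_`.
  partition : ∀ ℓ k {a b} → a ≈ node k → b ≈ node (k ℕ.+ ℓ) → TaggedPartition a b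
  partition zero    k a≈ b≈ = end (≈-trans a≈ (≈-sym (≈-trans b≈ (≈-reflexive (≡.cong node (ℕ.+-identityʳ k))))))
  partition (suc ℓ) k a≈ b≈ = step (node (suc k)) (node (suc k))
    (≤-by 0≤h (≈-trans (node-suc k) (+-congʳ (≈-sym a≈)))) ≤-refl
    (partition ℓ (suc k) ≈-refl (≈-trans b≈ (≈-reflexive (≡.cong node (ℕ.+-suc k ℓ)))))

  gap≈h : ∀ k {a} → a ≈ node k → node (suc k) - a ≈ h
  gap≈h k {a} a≈ = ≈-trans (+-cong (node-suc k) (-‿cong a≈)) (solve 2 (λ a h → (a ⊕ h) ⊖ a := h) ≈-refl (node k) h)

  mesh : ∀ {δ} → h < δ → ∀ ℓ k {a b} (a≈ : a ≈ node k) (b≈ : b ≈ node (k ℕ.+ ℓ)) → MeshBelow δ (partition ℓ k a≈ b≈)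
  mesh h<δ zero    k a≈ b≈ = tt
  mesh h<δ (suc ℓ) k a≈ b≈ = ≤-<-trans (≤-reflexive (gap≈h k a≈)) h<δ , mesh h<δ ℓ (suc k) ≈-refl _

  riemannSum≈ : ∀ g ℓ k {a b} (a≈ : a ≈ node k) (b≈ : b ≈ node (k ℕ.+ ℓ)) →
                riemannSum g (partition ℓ k a≈ b≈) ≈ Σ< ℓ (λ j → g (node (suc (k ℕ.+ j)))) * h
  riemannSum≈ g zero    k a≈ b≈ = ≈-sym (zeroˡ h)
  riemannSum≈ g (suc ℓ) k {b = b} a≈ b≈ = begin-equality
    g (node (suc k)) * (node (suc k) - _) + riemannSum g (partition ℓ (suc k) ≈-refl b≈′)
      ≈⟨ +-cong (*-congˡ (gap≈h k a≈)) (riemannSum≈ g ℓ (suc k) ≈-refl b≈′) ⟩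
    g (node (suc k)) * h + Σ< ℓ (λ j → g (node (suc (suc k ℕ.+ j)))) * h
      ≈⟨ +-cong (*-congʳ (≈-reflexive (≡.cong (g ∘ node ∘ suc) (≡.sym (ℕ.+-identityʳ k)))))
                (*-congʳ (Σ<-cong ℓ (λ j _ → ≈-reflexive (≡.cong (g ∘ node ∘ suc) (≡.sym (ℕ.+-suc k j)))))) ⟩
    g (node (suc (k ℕ.+ 0))) * h + Σ< ℓ (λ j → g (node (suc (k ℕ.+ suc j)))) * h
      ≈⟨ distribʳ h _ _ ⟨
    Σ< (suc ℓ) (λ j → g (node (suc (k ℕ.+ j)))) * h  ∎
    where
    b≈′ : b ≈ node (suc k ℕ.+ ℓ)
    b≈′ = ≈-trans b≈ (≈-reflexive (≡.cong node (ℕ.+-suc k ℓ)))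

  integral-approximation : ∀ {g v ε δ b} ℓ → b ≈ node ℓ → h < δ →
    (∀ (P : TaggedPartition 0# b) → MeshBelow δ P → ∣ riemannSum g P - v ∣ < ε) →
    ∣ Σ< ℓ (λ j → g (node (suc j))) * h - v ∣ < ε
  integral-approximation {g} {v} {ε} ℓ b≈ h<δ approximates = ≤-<-trans
    (∣x∣≤ (≤-trans (≤-reflexive (+-congʳ (≈-sym sum≈))) (x≤∣x∣ _))
          (≤-trans (≤-reflexive (-‿cong (+-congʳ (≈-sym sum≈)))) (-x≤∣x∣ _)))
    (approximates (partition ℓ 0 0≈ b≈) (mesh h<δ ℓ 0 0≈ b≈))
    where
    0≈ : 0# ≈ node 0
    0≈ = ≈-sym (zeroˡ h)
    sum≈ = riemannSum≈ g ℓ 0 0≈ b≈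

-- Balls as arcs, and the pointwise bound on the integrand.

module DiscrepancyBounds {c ℓ₁ ℓ₂} (R : CompleteOrderedField c ℓ₁ ℓ₂) {N : ℕ} (x : Fin N → Real.𝕋 R) (1≤N : 1 ℕ.≤ N)
  (D : CompleteOrderedField.Carrier R) (D-sup : Real.IsDiscrepancy R x D) where

  open OrderedField R
  open TorusDistance R
  open GeometricRatio R using (0<con; 0≤con)

  n : Carrier
  n = fromℕ N

  0<n : 0# < n
  0<n = 0<fromℕ 1≤N

  deviation≤D : ∀ I → arcDeviation x I ≤ D
  deviation≤D I = proj₁ D-sup _ (I , ≈-refl)

  #In≈ : ∀ I → fromℕ (#In x I) ≈ sum (λ b → indicator (x b ∈ᴬ? I))
  #In≈ I = sum-indicator (λ b → x b ∈ᴬ? I) id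

  indicator-true : ∀ {p} {P : Set p} (P? : Dec P) → P → indicator P? ≈ 1#
  indicator-true (yes _) p = ≈-refl
  indicator-true (no ¬p) p = contradiction p ¬p

  indicator-false : ∀ {p} {P : Set p} (P? : Dec P) → ¬ P → indicator P? ≈ 0#
  indicator-false (yes p) ¬p = contradiction p ¬p
  indicator-false (no _)  ¬p = ≈-refl

  #In≤n : ∀ I → fromℕ (#In x I) ≤ n
  #In≤n I = begin
    fromℕ (#In x I)                      ≈⟨ #In≈ I ⟩
    sum (λ b → indicator (x b ∈ᴬ? I))    ≤⟨ sum-mono (λ b → indicator≤1 (x b ∈ᴬ? I)) ⟩
    sum {N} (λ _ → 1#)                   ≈⟨ sum-const N 1# ⟩
    n * 1#                               ≈⟨ *-identityʳ n ⟩
    n                                    ∎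

  D≤1 : D ≤ 1#
  D≤1 = proj₂ D-sup 1# λ { y (I , y≈) → ≤-trans (≤-reflexive y≈) (∣x∣≤
    (≤-by (0≤+ ⟨ frequency≤1 I ⟩ (0≤arcLength I))
      (solve 2 (λ u l → con (+ 1) := (u ⊖ l) ⊕ ((con (+ 1) ⊖ u) ⊕ l)) ≈-refl (fromℕ (#In x I) / n) (arcLength I)))
    (≤-by (0≤+ ⟨ arcLength≤1 I ⟩ (0≤frequency I))
      (solve 2 (λ u l → con (+ 1) := (⊝ (u ⊖ l)) ⊕ ((con (+ 1) ⊖ l) ⊕ u)) ≈-refl (fromℕ (#In x I) / n) (arcLength I)))) }
    where
    0≤frequency : ∀ I → 0# ≤ fromℕ (#In x I) / n
    0≤frequency I = *-nonNegative (0≤fromℕ (#In x I)) (<⇒≤ (0<⁻¹ 0<n))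
    frequency≤1 : ∀ I → fromℕ (#In x I) / n ≤ 1#
    frequency≤1 I = *-cancelˡ-≤ 0<n (≤-trans (≤-reflexive (/-*-cancel 0<n _)) (≤-trans (#In≤n I) (≤-reflexive (≈-sym (*-identityʳ n)))))

  -- The closed arc of length 0 at one of the points has deviation at least 1/N.
  1≤nD : 1# ≤ n * D
  1≤nD = begin
    1#                                         ≈⟨ indicator-true (x a ∈ᴬ? point) a∈point ⟨
    indicator (x a ∈ᴬ? point)                  ≤⟨ sum-term (λ b → 0≤indicator (x b ∈ᴬ? point)) a ⟩
    sum (λ b → indicator (x b ∈ᴬ? point))      ≈⟨ #In≈ point ⟨
    fromℕ (#In x point)                        ≈⟨ /-*-cancel 0<n _ ⟨
    n * (fromℕ (#In x point) / n)              ≤⟨ *-monoˡ-≤ (<⇒≤ 0<n) (≤-trans (≤-reflexive (solve 1 (λ u → u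
          := u ⊖ con (+ 0)) ≈-refl _))
                                                    (≤-trans (x≤∣x∣ _) (deviation≤D point))) ⟩
    n * D                                      ∎
    where
    a : Fin N
    a = Fin.fromℕ< 1≤N
    point : Arc
    point = record { start = x a; arcLength = 0#; 0≤arcLength = ≤-refl; arcLength≤1 = 0≤1; left = included; right = included }
    a∈point : x a ∈ᴬ point
    a∈point = inj₁ (weakly ≤-refl , weakly (≤-reflexive (≈-sym (+-identityʳ _))))

  0<D : 0# < D
  0<D = *-cancelˡ-< (<⇒≤ 0<n) (≤-<-trans (≤-reflexive (zeroʳ n)) (<-≤-trans 0<1 1≤nD))

  dist≤-cases : ∀ u v {t} → dist u v ≤ t →
    (∣ rep u - rep v ∣ ≤ t) ⊎ (∣ rep u - rep v - 1# ∣ ≤ t) ⊎ (∣ rep u - rep v + 1# ∣ ≤ t)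
  dist≤-cases u v dist≤t with min-sel ∣ rep u - rep v ∣ (min ∣ rep u - rep v - 1# ∣ ∣ rep u - rep v + 1# ∣)
  ... | inj₁ e = inj₁ (≤-trans (≤-reflexive (≈-sym e)) dist≤t)
  ... | inj₂ e with min-sel ∣ rep u - rep v - 1# ∣ ∣ rep u - rep v + 1# ∣
  ...   | inj₁ e′ = inj₂ (inj₁ (≤-trans (≤-reflexive (≈-sym (≈-trans e e′))) dist≤t))
  ...   | inj₂ e′ = inj₂ (inj₂ (≤-trans (≤-reflexive (≈-sym (≈-trans e e′))) dist≤t))

  record Ball (a : 𝕋) (t : Carrier) : Set (c ⊔ ℓ₁ ⊔ ℓ₂) where
    field
      arc     : Arc
      length≈ : arcLength arc ≈ 2# * t
      ∈⇒close : ∀ b → b ∈ᴬ arc → dist a b ≤ t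
      close⇒∈ : ∀ b → dist a b ≤ t → b ∈ᴬ arc

  module _ (a : 𝕋) {t : Carrier} (0≤t : 0# ≤ t) (2t≤1 : 2# * t ≤ 1#) where

    module _ (o : 𝕋) where

      centred : Arc
      centred = record
        { start = o; arcLength = 2# * t; 0≤arcLength = *-nonNegative 0≤2 0≤t; arcLength≤1 = 2t≤1; left = included; right = included }

      inLift⇒ : ∀ {u z} → rep o + t - u ≈ z → InLift centred u → ∣ z ∣ ≤ t
      inLift⇒ {u} {z} z≈ (weakly o≤u , weakly u≤) = ∣x∣≤
        (≤-by ⟨ o≤u ⟩ (≈-trans (solve 3 (λ o t u → t := (o ⊕ t ⊖ u) ⊕ (u ⊖ o)) ≈-refl (rep o) t u) (+-congʳ z≈)))
        (≤-by ⟨ u≤ ⟩ (≈-trans (solve 3 (λ o t u → t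
              := (⊝ (o ⊕ t ⊖ u)) ⊕ ((o ⊕ con (+ 2) ⊗ t) ⊖ u)) ≈-refl (rep o) t u) (+-congʳ (-‿cong z≈))))

      ⇒inLift : ∀ {u z} → rep o + t - u ≈ z → ∣ z ∣ ≤ t → InLift centred u
      ⇒inLift {u} {z} z≈ ∣z∣≤t =
        weakly (≤-by ⟨ ≤-trans (≤-reflexive z≈) (≤-trans (x≤∣x∣ z) ∣z∣≤t) ⟩
          (solve 3 (λ o t u → u := o ⊕ (t ⊖ (o ⊕ t ⊖ u))) ≈-refl (rep o) t u)) ,
        weakly (≤-by ⟨ ≤-trans (≤-reflexive (-‿cong z≈)) (≤-trans (-x≤∣x∣ z) ∣z∣≤t) ⟩
          (solve 3 (λ o t u → o ⊕ con (+ 2) ⊗ t := u ⊕ (t ⊖ ⊝ (o ⊕ t ⊖ u))) ≈-refl (rep o) t u))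

    -- The start a - t has to be reduced to [0, 1), which gives two cases. In each, two of the three
    -- terms of `dist` correspond to the two lifts in the definition of `_∈ᴬ_`, and the third cannot
    -- be at most t: because b < 1 in the first case, because a < t and 2t ≤ 1 in the second.
    ball : Ball a t
    ball with t ≤? rep a
    ... | yes t≤a = record
      { arc     = centred o
      ; length≈ = ≈-refl
      ; ∈⇒close = λ b → [ dist≤₀ a b ∘ inLift⇒ o (e₀ b) , dist≤₋ a b ∘ inLift⇒ o (e₋ b) ]′
      ; close⇒∈ = λ b close → [ inj₁ ∘ ⇒inLift o (e₀ b) , [ inj₂ ∘ ⇒inLift o (e₋ b) , (λ far → contradiction (≤-trans (x≤∣x∣ _) far) (too-far b)) ]′ ]′ (dist≤-cases a b close)
      }
      where
      o : 𝕋
      o = record { rep = rep a - t; 0≤rep = ⟨ t≤a ⟩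
                 ; rep<1 = ≤-<-trans (≤-by 0≤t (solve 2 (λ a t → a := (a ⊖ t) ⊕ t) ≈-refl (rep a) t)) (rep<1 a) }
      e₀ : ∀ b → (rep a - t) + t - rep b ≈ rep a - rep b
      e₀ b = solve 3 (λ a b t → a ⊖ t ⊕ t ⊖ b := a ⊖ b) ≈-refl (rep a) (rep b) t
      e₋ : ∀ b → (rep a - t) + t - (rep b + 1#) ≈ rep a - rep b - 1#
      e₋ b = solve 3 (λ a b t → a ⊖ t ⊕ t ⊖ (b ⊕ con (+ 1)) := a ⊖ b ⊖ con (+ 1)) ≈-refl (rep a) (rep b) t
      too-far : ∀ b → ¬ (rep a - rep b + 1# ≤ t)
      too-far b ≤t = <⇒≱ (rep<1 b) (≤-by (0≤+ ⟨ ≤t ⟩ ⟨ t≤a ⟩)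
        (solve 3 (λ a b t → b := con (+ 1) ⊕ ((t ⊖ (a ⊖ b ⊕ con (+ 1))) ⊕ (a ⊖ t))) ≈-refl (rep a) (rep b) t))
    ... | no t≰a = record
      { arc     = centred o
      ; length≈ = ≈-refl
      ; ∈⇒close = λ b → [ dist≤₊ a b ∘ inLift⇒ o (e₊ b) , dist≤₀ a b ∘ inLift⇒ o (e₀ b) ]′
      ; close⇒∈ = λ b close → [ inj₂ ∘ ⇒inLift o (e₀ b) , [ (λ far → contradiction (≤-trans (-x≤∣x∣ _) far) (too-far b)) , inj₁ ∘ ⇒inLift o (e₊ b) ]′ ]′ (dist≤-cases a b close)
      }
      where
      a<t : rep a < t
      a<t = ≰⇒> t≰a
      o : 𝕋
      o = record { rep = rep a - t + 1#
                 ; 0≤rep = ≤-trans (0≤+ (0≤+ (0≤rep a) ⟨ 2t≤1 ⟩) 0≤t) (≤-reflexive (solve 2 (λ a t → a ⊕ (con (+ 1) ⊖ con (+ 2) ⊗ t) ⊕ t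
                       := a ⊖ t ⊕ con (+ 1)) ≈-refl (rep a) t))
                 ; rep<1 = <-by (0<y-x a<t) (solve 2 (λ a t → con (+ 1) := (a ⊖ t ⊕ con (+ 1)) ⊕ (t ⊖ a)) ≈-refl (rep a) t) }
      e₀ : ∀ b → (rep a - t + 1#) + t - (rep b + 1#) ≈ rep a - rep b
      e₀ b = solve 3 (λ a b t → a ⊖ t ⊕ con (+ 1) ⊕ t ⊖ (b ⊕ con (+ 1)) := a ⊖ b) ≈-refl (rep a) (rep b) t
      e₊ : ∀ b → (rep a - t + 1#) + t - rep b ≈ rep a - rep b + 1#
      e₊ b = solve 3 (λ a b t → a ⊖ t ⊕ con (+ 1) ⊕ t ⊖ b := a ⊖ b ⊕ con (+ 1)) ≈-refl (rep a) (rep b) t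
      too-far : ∀ b → ¬ (- (rep a - rep b - 1#) ≤ t)
      too-far b ≤t = <⇒≱ a<t (≤-by (0≤+ (0≤+ ⟨ ≤t ⟩ ⟨ 2t≤1 ⟩) (0≤rep b))
        (solve 3 (λ a b t → a
              := t ⊕ ((t ⊖ ⊝ (a ⊖ b ⊖ con (+ 1))) ⊕ (con (+ 1) ⊖ con (+ 2) ⊗ t) ⊕ b)) ≈-refl (rep a) (rep b) t))

  module _ (r : Carrier) (0≤r : 0# ≤ r) (2r≤n : 2# * r ≤ n) where

    private
      t = r / n
      0≤t : 0# ≤ t
      0≤t = *-nonNegative 0≤r (<⇒≤ (0<⁻¹ 0<n))
      2t≤1 : 2# * t ≤ 1#
      2t≤1 = *-cancelˡ-≤ 0<n (begin
        n * (2# * t)  ≈⟨ solve 2 (λ n t → n ⊗ (con (+ 2) ⊗ t) := con (+ 2) ⊗ (n ⊗ t)) ≈-refl n t ⟩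
        2# * (n * t)  ≈⟨ *-congˡ (/-*-cancel 0<n r) ⟩
        2# * r        ≤⟨ 2r≤n ⟩
        n             ≈⟨ *-identityʳ n ⟨
        n * 1#        ∎)

      B : ∀ a → Ball (x a) t
      B a = ball (x a) 0≤t 2t≤1

      I : Fin N → Arc
      I a = Ball.arc (B a)

      F = fromℕ (#ClosePairs x r)

    ball-indicator : ∀ a b → indicator (x b ∈ᴬ? I a) ≈ indicator (a Fin.≟ b) + indicator (closePair? x r (a , b))
    ball-indicator a b = cases (a Fin.≟ b)
      where
      cases : (a≟b : Dec (a ≡ b)) → indicator (x b ∈ᴬ? I a) ≈ indicator a≟b + indicator (closePair? x r (a , b))
      cases (yes ≡.refl) = ≈-trans (indicator-true (x b ∈ᴬ? I a) (Ball.close⇒∈ (B a) (x b) (dist≤₀ (x a) (x a) (∣x∣≤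
          (≤-trans (≤-reflexive (-‿inverseʳ _)) 0≤t) (≤-trans (≤-reflexive (solve 1 (λ u → ⊝ (u ⊖ u)
                := con (+ 0)) ≈-refl _)) 0≤t)))))
        (≈-trans (≈-sym (+-identityʳ 1#)) (+-congˡ (≈-sym (indicator-false (closePair? x r (a , b)) λ (a≢a , _) → a≢a ≡.refl))))
      cases (no a≢b) = ≈-trans (antisym
          (indicator-mono (x b ∈ᴬ? I a) (closePair? x r (a , b)) (λ b∈I → a≢b , Ball.∈⇒close (B a) (x b) b∈I))
          (indicator-mono (closePair? x r (a , b)) (x b ∈ᴬ? I a) (λ (_ , close) → Ball.close⇒∈ (B a) (x b) close)))
        (≈-sym (+-identityˡ _))

    -- Each ball contains its centre, which is not a close pair; the N centres are the summand `n`.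
    n+F≈ : n + F ≈ sum (λ a → fromℕ (#In x (I a)))
    n+F≈ = ≈-sym (begin-equality
      sum (λ a → fromℕ (#In x (I a)))
        ≈⟨ sum-cong-≋ row ⟩
      sum (λ a → 1# + sum (λ b → indicator (closePair? x r (a , b))))
        ≈⟨ ∑-distrib-+ {N} (λ _ → 1#) _ ⟩
      sum {N} (λ _ → 1#) + sum (λ a → sum (λ b → indicator (closePair? x r (a , b))))
        ≈⟨ +-cong (≈-trans (sum-const N 1#) (*-identityʳ n)) (≈-sym (sum-indicator₂ (closePair? x r) {N} {N} id id)) ⟩
      n + F  ∎)
      where
      row : ∀ a → fromℕ (#In x (I a)) ≈ 1# + sum (λ b → indicator (closePair? x r (a , b)))
      row a = ≈-trans (#In≈ (I a)) (≈-trans (sum-cong-≋ (ball-indicator a))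
        (≈-trans (∑-distrib-+ {N} (λ b → indicator (a Fin.≟ b)) _) (+-congʳ (sum-diagonal a))))

    nt≈ : ∀ a → n * (fromℕ (#In x (I a)) / n - arcLength (I a)) ≈ fromℕ (#In x (I a)) - 2# * r
    nt≈ a = ≈-trans (solve 3 (λ n u l → n ⊗ (u ⊖ l) := n ⊗ u ⊖ n ⊗ l) ≈-refl n _ _)
      (+-cong (/-*-cancel 0<n _) (-‿cong (≈-trans (*-congˡ (Ball.length≈ (B a)))
        (≈-trans (solve 2 (λ n t → n ⊗ (con (+ 2) ⊗ t) := con (+ 2) ⊗ (n ⊗ t)) ≈-refl n t) (*-congˡ (/-*-cancel 0<n r))))))

    #In≤ : ∀ a → fromℕ (#In x (I a)) ≤ 2# * r + n * D
    #In≤ a = ≤-by ⟨ ≤-trans (≤-reflexive (≈-sym (nt≈ a))) (*-monoˡ-≤ (<⇒≤ 0<n) (≤-trans (x≤∣x∣ _) (deviation≤D (I a)))) ⟩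
      (solve 3 (λ u r d → r ⊕ d := u ⊕ (d ⊖ (u ⊖ r))) ≈-refl (fromℕ (#In x (I a))) (2# * r) (n * D))

    #In≥ : ∀ a → 2# * r - n * D ≤ fromℕ (#In x (I a))
    #In≥ a = ≤-by ⟨ ≤-trans (≤-reflexive (≈-trans (-‿cong (≈-sym (nt≈ a))) (solve 2 (λ n u → ⊝ (n ⊗ u)
          := n ⊗ (⊝ u)) ≈-refl n _)))
                    (*-monoˡ-≤ (<⇒≤ 0<n) (≤-trans (-x≤∣x∣ _) (deviation≤D (I a)))) ⟩
      (solve 3 (λ u r d → u := (r ⊖ d) ⊕ (d ⊖ ⊝ (u ⊖ r))) ≈-refl (fromℕ (#In x (I a))) (2# * r) (n * D))

    n+F≤ : n + F ≤ n * (2# * r + n * D)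
    n+F≤ = ≤-trans (≤-reflexive n+F≈) (≤-trans (sum-mono #In≤) (≤-reflexive (sum-const N _)))

    n+F≥ : n * (2# * r - n * D) ≤ n + F
    n+F≥ = ≤-trans (≤-reflexive (≈-sym (sum-const N _))) (≤-trans (sum-mono #In≥) (≤-reflexive (≈-sym n+F≈)))

    n*deviation≈ : n * (1# / n * F - fromℕ 2 * r) ≈ (n + F) - n * (1# + 2# * r)
    n*deviation≈ = begin-equality
      n * (1# / n * F - fromℕ 2 * r)
        ≈⟨ solve 4 (λ n n′ F r → n ⊗ (con (+ 1) ⊗ n′ ⊗ F ⊖ (con (+ 1) ⊕ (con (+ 1) ⊕ con (+ 0))) ⊗ r)
              := n ⊗ (F ⊗ n′) ⊖ con (+ 2) ⊗ (n ⊗ r)) ≈-refl n (n ⁻¹) F r ⟩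
      n * (F / n) - 2# * (n * r)
        ≈⟨ +-congʳ (/-*-cancel 0<n F) ⟩
      F - 2# * (n * r)
        ≈⟨ solve 3 (λ n F r → F ⊖ con (+ 2) ⊗ (n ⊗ r) := (n ⊕ F) ⊖ n ⊗ (con (+ 1) ⊕ con (+ 2) ⊗ r)) ≈-refl n F r ⟩
      (n + F) - n * (1# + 2# * r)  ∎

    pair-deviation≤ : ∣ 1# / n * F - fromℕ 2 * r ∣ ≤ 2# * (n * D)
    pair-deviation≤ = ∣x∣≤
      (*-cancelˡ-≤ 0<n (begin
        n * (1# / n * F - fromℕ 2 * r)                       ≈⟨ n*deviation≈ ⟩
        (n + F) - n * (1# + 2# * r)                          ≤⟨ +-mono-≤ n+F≤ ≤-refl ⟩
        n * (2# * r + n * D) - n * (1# + 2# * r)             ≤⟨ ≤-by (*-nonNegative (<⇒≤ 0<n) (0≤+ (*-nonNegative (<⇒≤ 0<n) (<⇒≤ 0<D)) 0≤1))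
                                                                  (solve 3 (λ n D r → n ⊗ (con (+ 2) ⊗ (n ⊗ D))
                                                                        := (n ⊗ (con (+ 2) ⊗ r ⊕ n ⊗ D) ⊖ n ⊗ (con (+ 1) ⊕ con (+ 2) ⊗ r)) ⊕ n ⊗ (n ⊗ D ⊕ con (+ 1))) ≈-refl n D r) ⟩
        n * (2# * (n * D))                                   ∎))
      (*-cancelˡ-≤ 0<n (begin
        n * (- (1# / n * F - fromℕ 2 * r))                   ≈⟨ ≈-trans (solve 2 (λ n u → n ⊗ (⊝ u)
              := ⊝ (n ⊗ u)) ≈-refl n _) (-‿cong n*deviation≈) ⟩
        - ((n + F) - n * (1# + 2# * r))                      ≤⟨ neg-mono-≤ (+-mono-≤ n+F≥ ≤-refl) ⟩
        - (n * (2# * r - n * D) - n * (1# + 2# * r))         ≤⟨ ≤-by (*-nonNegative (<⇒≤ 0<n) ⟨ 1≤nD ⟩)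
                                                                  (solve 3 (λ n D r → n ⊗ (con (+ 2) ⊗ (n ⊗ D))
                                                                        := (⊝ (n ⊗ (con (+ 2) ⊗ r ⊖ n ⊗ D) ⊖ n ⊗ (con (+ 1) ⊕ con (+ 2) ⊗ r))) ⊕ n ⊗ (n ⊗ D ⊖ con (+ 1))) ≈-refl n D r) ⟩
        n * (2# * (n * D))                                   ∎))

    integrand≤ : integrand x r ≤ fromℤ (+ 4) * ((n * D) * (n * D))
    integrand≤ = begin
      integrand x r  ≈⟨ x^2≈x*x _ ⟩
      ∣ z ∣ * ∣ z ∣  ≤⟨ *-mono-≤ 0≤∣z∣ 0≤∣z∣ pair-deviation≤ pair-deviation≤ ⟩
      (2# * (n * D)) * (2# * (n * D))  ≈⟨ solve 1 (λ u → (con (+ 2) ⊗ u) ⊗ (con (+ 2) ⊗ u)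
            := con (+ 4) ⊗ (u ⊗ u)) ≈-refl (n * D) ⟩
      fromℤ (+ 4) * ((n * D) * (n * D))  ∎
      where
      z = 1# / n * F - fromℕ 2 * r
      0≤∣z∣ : 0# ≤ ∣ z ∣
      0≤∣z∣ with ≤-total 0# z
      ... | inj₁ 0≤z = ≤-trans 0≤z (x≤∣x∣ z)
      ... | inj₂ z≤0 = ≤-trans (≤-trans (≤-reflexive (solve 0 (con (+ 0)
            := ⊝ con (+ 0)) ≈-refl)) (neg-mono-≤ z≤0)) (-x≤∣x∣ z)

-- Archimedean and dyadic choices of scale.

module Scales {c ℓ₁ ℓ₂} (R : CompleteOrderedField c ℓ₁ ℓ₂) where

  open OrderedField R
  open GeometricRatio R

  -- No k can be exhibited constructively; the continuation form suffices because
  -- the inequalities it serves are decidable, hence stable.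
  archimedean : ∀ x → (∀ k → x < fromℕ k → ⊥) → ⊥
  archimedean x found = ¬¬-archimedean x λ k → decidable-stable (fromℕ k ≤? x) λ k≰x → found k (≰⇒> k≰x)

  k≤2^k : ∀ k → k ℕ.≤ 2 ℕ.^ k
  k≤2^k zero    = z≤n
  k≤2^k (suc k) = ℕ.+-mono-≤ (ℕ.^-monoʳ-≤ 2 {0} {k} z≤n) (ℕ.≤-trans (k≤2^k k) (ℕ.m≤m+n _ 0))

  -- The search descends to the least power with 4 e 2^k ≥ 1; its failure one step lower is the
  -- other inequality. As 4 e < 1, the exponent is a successor, which later makes the grid size
  -- even.
  dyadic-scale : ∀ e → 0# < e → fromℤ (+ 4) * e < 1# →
    (∀ J → (2# * e) * 2^ (suc J) ≤ 1# → 1# ≤ (fromℤ (+ 4) * e) * 2^ (suc J) → ⊥) → ⊥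
  dyadic-scale e 0<e 4e<1 found = archimedean ((fromℤ (+ 4) * e) ⁻¹) λ k <k → search k (begin
    1#                                                 ≈⟨ *-inverseʳ 0<4e ⟨
    (fromℤ (+ 4) * e) * (fromℤ (+ 4) * e) ⁻¹           ≤⟨ *-monoˡ-≤ (<⇒≤ 0<4e) (≤-trans (<⇒≤ <k) (fromℕ-mono (k≤2^k k))) ⟩
    (fromℤ (+ 4) * e) * 2^ k                           ∎)
    where
    0<4e = 0<* (0<con 3) 0<e
    search : ∀ k → 1# ≤ (fromℤ (+ 4) * e) * 2^ k → ⊥
    search zero    1≤ = <⇒≱ 4e<1 (≤-trans 1≤ (≤-reflexive (≈-trans (*-congˡ fromℕ-1) (*-identityʳ _))))
    search (suc k) 1≤ with 1# ≤? (fromℤ (+ 4) * e) * 2^ k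
    ... | yes 1≤′ = search k 1≤′
    ... | no  1≰  = found k (≤-trans (≤-reflexive (≈-trans (*-congˡ (2^-suc k))
        (solve 2 (λ e t → (con (+ 2) ⊗ e) ⊗ (con (+ 2) ⊗ t) := (con (+ 4) ⊗ e) ⊗ t) ≈-refl e (2^ k)))) (<⇒≤ (≰⇒> 1≰))) 1≤

-- The integral, and the two bounds for its mean.

module MeanSquare {c ℓ₁ ℓ₂} (R : CompleteOrderedField c ℓ₁ ℓ₂) {N : ℕ} (x : Fin N → Real.𝕋 R) (1≤N : 1 ℕ.≤ N)
  (D : CompleteOrderedField.Carrier R) (D-sup : Real.IsDiscrepancy R x D)
  (v : CompleteOrderedField.Carrier R) where

  open OrderedField R
  open RangeSums R
  open GeometricRatio R
  open Scales R
  open DiscrepancyBounds R x 1≤N D D-sup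

  0<fromℕ2 : 0# < fromℕ 2
  0<fromℕ2 = 0<fromℕ {2} (s≤s z≤n)

  module Grid (M H : ℕ) (1≤M : 1 ℕ.≤ M) (H+H≡M : H ℕ.+ H ≡ M) where

    m h : Carrier
    m = fromℕ M
    h = n / m

    0<m : 0# < m
    0<m = 0<fromℕ 1≤M

    0≤h : 0# ≤ h
    0≤h = *-nonNegative (<⇒≤ 0<n) (<⇒≤ (0<⁻¹ 0<m))

    open UniformPartition R h 0≤h public

    n/2≈ : n / fromℕ 2 ≈ node H
    n/2≈ = antisym (*-cancelˡ-≤ 0<fromℕ2 (≤-reflexive e)) (*-cancelˡ-≤ 0<fromℕ2 (≤-reflexive (≈-sym e)))
      where
      e : fromℕ 2 * (n / fromℕ 2) ≈ fromℕ 2 * node H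
      e = begin-equality
        fromℕ 2 * (n / fromℕ 2)        ≈⟨ /-*-cancel 0<fromℕ2 n ⟩
        n                              ≈⟨ /-*-cancel 0<m n ⟨
        m * h                          ≈⟨ *-congʳ (≈-trans (≈-reflexive (≡.cong fromℕ (≡.sym H+H≡M))) (fromℕ-+ H H)) ⟩
        (fromℕ H + fromℕ H) * h        ≈⟨ solve 2 (λ a h → (a ⊕ a) ⊗ h
              := (con (+ 1) ⊕ (con (+ 1) ⊕ con (+ 0))) ⊗ (a ⊗ h)) ≈-refl (fromℕ H) h ⟩
        fromℕ 2 * node H               ∎

    2node≤n : ∀ k → k ℕ.≤ H → 2# * node k ≤ n
    2node≤n k k≤H = begin
      2# * node k                ≤⟨ *-monoˡ-≤ 0≤2 (*-monoʳ-≤ 0≤h (fromℕ-mono k≤H)) ⟩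
      2# * node H                ≈⟨ *-cong (≈-sym fromℕ-2) (≈-sym n/2≈) ⟩
      fromℕ 2 * (n / fromℕ 2)    ≈⟨ /-*-cancel 0<fromℕ2 n ⟩
      n                          ∎

    h< : ∀ {δ} → 0# < δ → n / δ < m → h < δ
    h< {δ} 0<δ n/δ<m = *-cancelˡ-< (<⇒≤ 0<m) (≤-<-trans (≤-reflexive (/-*-cancel 0<m n))
      (≤-<-trans (≤-reflexive (≈-sym (/-*-cancel 0<δ n))) (<-≤-trans (*-monoˡ-< 0<δ n/δ<m) (≤-reflexive (*-comm δ m)))))

    S : Carrier
    S = Σ< H (λ j → integrand x (node (suc j))) * h

    S≤ : S ≤ (fromℤ (+ 4) * ((n * D) * (n * D))) * (n / fromℕ 2)
    S≤ = begin
      S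
        ≤⟨ *-monoʳ-≤ 0≤h (Σ<-mono H (λ j j<H → integrand≤ (node (suc j)) (*-nonNegative (0≤fromℕ (suc j)) 0≤h) (2node≤n (suc j) j<H))) ⟩
      Σ< H (λ _ → fromℤ (+ 4) * ((n * D) * (n * D))) * h
        ≈⟨ *-congʳ (sum-const H _) ⟩
      (fromℕ H * (fromℤ (+ 4) * ((n * D) * (n * D)))) * h
        ≈⟨ solve 3 (λ a b c → (a ⊗ b) ⊗ c := b ⊗ (a ⊗ c)) ≈-refl (fromℕ H) (fromℤ (+ 4) * ((n * D) * (n * D))) h ⟩
      (fromℤ (+ 4) * ((n * D) * (n * D))) * node H
        ≈⟨ *-congˡ n/2≈ ⟨
      (fromℤ (+ 4) * ((n * D) * (n * D))) * (n / fromℕ 2)  ∎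

  module _ (integral : IsIntegral 0# (fromℕ N / fromℕ 2) (integrand x) v) where

    -- A number beyond N/δ is obtained only under a double negation, hence the continuation form.
    -- All grids finer than `W` are covered because the lower bound uses a multiple of `W`; `k` is
    -- room for a further demand on `W`, such as W ≥ N.
    approximation : ∀ {ε} → 0# < ε → (k : ℕ) →
      (∀ W → k ℕ.< W →
        (∀ M H (1≤M : 1 ℕ.≤ M) (H+H≡M : H ℕ.+ H ≡ M) → W ℕ.≤ M → ∣ Grid.S M H 1≤M H+H≡M - v ∣ < ε) → ⊥) → ⊥
    approximation {ε} 0<ε k found with integral ε 0<ε
    ... | δ , 0<δ , approximates = archimedean (n / δ + fromℕ k) λ W <W →
      found W (fromℕ-cancel-< (≤-<-trans (≤-by 0≤n/δ (+-comm (n / δ) (fromℕ k))) <W))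
        λ M H 1≤M H+H≡M W≤M → Grid.integral-approximation M H 1≤M H+H≡M H (Grid.n/2≈ M H 1≤M H+H≡M)
          (Grid.h< M H 1≤M H+H≡M 0<δ (≤-<-trans (≤-by (0≤fromℕ k) ≈-refl) (<-≤-trans <W (fromℕ-mono W≤M)))) approximates
      where
      0≤n/δ : 0# ≤ n / δ
      0≤n/δ = *-nonNegative (<⇒≤ 0<n) (<⇒≤ (0<⁻¹ 0<δ))

    n*mean : ∀ u → n * (fromℕ 2 / n * u) ≈ fromℕ 2 * u
    n*mean u = ≈-trans (≈-sym (*-assoc _ _ _)) (*-congʳ (/-*-cancel 0<n (fromℕ 2)))

    -- Were v above the bound, a uniform Riemann sum would come closer to v than the excess, yet
    -- none of these sums exceeds the bound.
    integral≤ : v ≤ (fromℤ (+ 4) * ((n * D) * (n * D))) * (n / fromℕ 2)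
    integral≤ = decidable-stable (v ≤? B) λ v≰B →
      approximation (0<y-x (≰⇒> v≰B)) 0 λ W 1≤W close →
        let 1≤M = ℕ.≤-trans 1≤W (ℕ.m≤m+n W W); S = Grid.S (W ℕ.+ W) W 1≤M ≡.refl in
        <⇒≱ (close (W ℕ.+ W) W 1≤M ≡.refl (ℕ.m≤m+n W W)) (≤-trans
          (≤-by ⟨ Grid.S≤ (W ℕ.+ W) W 1≤M ≡.refl ⟩ (solve 3 (λ v s b → ⊝ (s ⊖ v) := (v ⊖ b) ⊕ (b ⊖ s)) ≈-refl v S B))
          (-x≤∣x∣ (S - v)))
      where B = (fromℤ (+ 4) * ((n * D) * (n * D))) * (n / fromℕ 2)

    upper-bound : ∀ {A} → A ≈ fromℕ 2 / n * v → A ≤ fromℤ (+ 4) * n ^ 2 * D ^ 2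
    upper-bound {A} A≈ = *-cancelˡ-≤ 0<n (begin
      n * A                                                    ≈⟨ ≈-trans (*-congˡ A≈) (n*mean v) ⟩
      fromℕ 2 * v                                              ≤⟨ *-monoˡ-≤ (<⇒≤ 0<fromℕ2) integral≤ ⟩
      fromℕ 2 * ((fromℤ (+ 4) * ((n * D) * (n * D))) * (n / fromℕ 2))
        ≈⟨ solve 3 (λ t b c → t ⊗ (b ⊗ c)
              := b ⊗ (t ⊗ c)) ≈-refl (fromℕ 2) (fromℤ (+ 4) * ((n * D) * (n * D))) (n / fromℕ 2) ⟩
      (fromℤ (+ 4) * ((n * D) * (n * D))) * (fromℕ 2 * (n / fromℕ 2))
        ≈⟨ *-congˡ (/-*-cancel 0<fromℕ2 n) ⟩
      (fromℤ (+ 4) * ((n * D) * (n * D))) * n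
        ≈⟨ solve 2 (λ n d → (con (+ 4) ⊗ ((n ⊗ d) ⊗ (n ⊗ d))) ⊗ n := n ⊗ (con (+ 4) ⊗ (n ⊗ n) ⊗ (d ⊗ d))) ≈-refl n D ⟩
      n * (fromℤ (+ 4) * (n * n) * (D * D))
        ≈⟨ *-congˡ (*-cong (*-congˡ (≈-sym (x^2≈x*x n))) (≈-sym (x^2≈x*x D))) ⟩
      n * (fromℤ (+ 4) * n ^ 2 * D ^ 2)  ∎)

    module _ (e : Carrier) (64e≈D : fromℤ (+ 64) * e ≈ D) (N-large : fromℤ (+ 4) ≤ n * (e * (e * e))) where

      private
        e⁵ = e * (e * e) * (e * e)

      0<e : 0# < e
      0<e = *-cancelˡ-< (0≤con 64) (≤-<-trans (≤-reflexive (zeroʳ _)) (<-≤-trans 0<D (≤-reflexive (≈-sym 64e≈D))))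

      4e<1 : fromℤ (+ 4) * e < 1#
      4e<1 = *-cancelˡ-< (0≤con 16) (≤-<-trans
        (≤-trans (≤-reflexive (≈-trans (solve 1 (λ e → con (+ 16) ⊗ (con (+ 4) ⊗ e) := con (+ 64) ⊗ e) ≈-refl e) 64e≈D)) D≤1)
        (<-by (0<con 14) (solve 0 (con (+ 16) ⊗ con (+ 1) := con (+ 1) ⊕ con (+ 15)) ≈-refl)))

      module _ (v-small : 2# * v ≤ (n * n * n) * e⁵) where

        private
          -- The Riemann sum may reach N³ e⁵: half is for the integral, half for the approximation.
          ε = ((n * n * n) * e⁵) / 2#

        0<ε : 0# < ε
        0<ε = 0<* (0<* (0<* (0<* 0<n 0<n) 0<n) (0<* (0<* 0<e (0<* 0<e 0<e)) (0<* 0<e 0<e))) (0<⁻¹ 0<2)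

        -- The grid has 2^(J + 1) W cells, so that J + 1 doublings of the window `W` fill the circle
        -- exactly. Fineness is then controlled by `W` alone, independently of `J`.
        deviation≤-at-scale : ∀ J → (2# * e) * 2^ (suc J) ≤ 1# → 1# ≤ (fromℤ (+ 4) * e) * 2^ (suc J) →
          ∀ W → N ℕ.≤ W →
          (∀ M H (1≤M : 1 ℕ.≤ M) (H+H≡M : H ℕ.+ H ≡ M) → W ℕ.≤ M → ∣ Grid.S M H 1≤M H+H≡M - v ∣ < ε) →
          ∀ I → arcDeviation x I ≤ fromℤ (+ 32) * e
        deviation≤-at-scale J J-small J-large W N≤W close = arc-deviation≤ e 1≤8me
          (f-rise≤ H H+H≡M N≤M (countBound H H+H≡M N≤M) W (suc J) ≡.refl e 0<e J-small J-large N-large Y-small)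
          where
          M H : ℕ
          M = 2 ℕ.^ suc J ℕ.* W
          H = 2 ℕ.^ J ℕ.* W
          H+H≡M : H ℕ.+ H ≡ M
          H+H≡M = ≡.sym (≡.trans (ℕ.*-assoc 2 (2 ℕ.^ J) W) (≡.cong (H ℕ.+_) (ℕ.+-identityʳ H)))
          W≤M : W ℕ.≤ M
          W≤M = ℕ.m≤n*m W (2 ℕ.^ suc J) {{ℕ.m^n≢0 2 (suc J)}}
          N≤M : N ℕ.≤ M
          N≤M = ℕ.≤-trans N≤W W≤M
          1≤M : 1 ℕ.≤ M
          1≤M = ℕ.≤-trans 1≤N N≤M

          open Discretization R x 1≤N M {{ℕ.>-nonZero 1≤M}} using (arc-deviation≤; f-rise≤; countBound; Y; y; W≤4em)
          open Grid M H 1≤M H+H≡M using (m; h; S; 0<m)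

          S≈ : S ≈ Y H H+H≡M N≤M * h
          S≈ = *-congʳ (Σ<-cong H (λ k _ → ∣x∣^2≈x*x (y H H+H≡M k)))

          S≤n³e⁵ : S ≤ (n * n * n) * e⁵
          S≤n³e⁵ = *-cancelˡ-≤ 0<2 (≤-by
            (0≤+ (0≤+ ⟨ ≤-trans (x≤∣x∣ (S - v)) (<⇒≤ (close M H 1≤M H+H≡M W≤M)) ⟩ ⟨ ≤-trans (x≤∣x∣ (S - v)) (<⇒≤ (close M H 1≤M H+H≡M W≤M)) ⟩) ⟨ v-small ⟩)
            (≈-trans (solve 1 (λ B → con (+ 2) ⊗ B := B ⊕ B) ≈-refl ((n * n * n) * e⁵))
              (≈-trans (+-congʳ (≈-sym (/-*-cancel 0<2 ((n * n * n) * e⁵))))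
                (solve 4 (λ ε B S v → con (+ 2) ⊗ ε ⊕ B
                      := con (+ 2) ⊗ S ⊕ (((ε ⊖ (S ⊖ v)) ⊕ (ε ⊖ (S ⊖ v))) ⊕ (B ⊖ con (+ 2) ⊗ v)))
                      ≈-refl ε ((n * n * n) * e⁵) S v))))

          Y-small : Y H H+H≡M N≤M ≤ m * (n * n) * e⁵
          Y-small = *-cancelˡ-≤ 0<n (begin
            n * Y H H+H≡M N≤M              ≈⟨ *-congʳ (/-*-cancel 0<m n) ⟨
            (m * h) * Y H H+H≡M N≤M        ≈⟨ solve 3 (λ m h Y → (m ⊗ h) ⊗ Y := m ⊗ (Y ⊗ h)) ≈-refl m h (Y H H+H≡M N≤M) ⟩
            m * (Y H H+H≡M N≤M * h)        ≈⟨ *-congˡ S≈ ⟨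
            m * S                        ≤⟨ *-monoˡ-≤ (<⇒≤ 0<m) S≤n³e⁵ ⟩
            m * ((n * n * n) * e⁵)       ≈⟨ solve 3 (λ m n E → m ⊗ ((n ⊗ n ⊗ n) ⊗ E)
                  := n ⊗ (m ⊗ (n ⊗ n) ⊗ E)) ≈-refl m n e⁵ ⟩
            n * (m * (n * n) * e⁵)       ∎)

          1≤8me : 1# ≤ fromℤ (+ 8) * (m * e)
          1≤8me = begin
            1#                            ≤⟨ ≤-trans (≤-reflexive (≈-sym fromℕ-1)) (fromℕ-mono (ℕ.≤-trans 1≤N N≤W)) ⟩
            fromℕ W                       ≤⟨ W≤4em H H+H≡M N≤M (countBound H H+H≡M N≤M) W (suc J) ≡.refl e 0<e J-small J-large N-large Y-small ⟩
            (fromℤ (+ 4) * e) * m         ≤⟨ ≤-by (*-nonNegative (*-nonNegative (0≤con 4) (<⇒≤ 0<e)) (<⇒≤ 0<m))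
                                               (solve 2 (λ e m → con (+ 8) ⊗ (m ⊗ e)
                                                     := (con (+ 4) ⊗ e) ⊗ m ⊕ (con (+ 4) ⊗ e) ⊗ m) ≈-refl e m) ⟩
            fromℤ (+ 8) * (m * e)         ∎

        deviation≤32e : ∀ I → arcDeviation x I ≤ fromℤ (+ 32) * e
        deviation≤32e I = decidable-stable (arcDeviation x I ≤? fromℤ (+ 32) * e) λ large →
          dyadic-scale e 0<e 4e<1 λ J J-small J-large →
          approximation 0<ε N λ W N<W close →
          large (deviation≤-at-scale J J-small J-large W (ℕ.<⇒≤ N<W) close I)

        impossible : ⊥
        impossible = <⇒≱ (0<* (0<con 31) 0<e) (≤-by
          ⟨ ≤-trans (≤-reflexive 64e≈D) (proj₂ D-sup (fromℤ (+ 32) * e) λ { _ (I , y≈) → ≤-trans (≤-reflexive y≈) (deviation≤32e I) }) ⟩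
          (solve 1 (λ e → con (+ 0) := con (+ 32) ⊗ e ⊕ (con (+ 32) ⊗ e ⊖ con (+ 64) ⊗ e)) ≈-refl e))

    -- With e = D q = D/64, a failure of the bound means 2 v = N A ≤ N³ e⁵, which is refuted. The
    -- factor 128 makes e at least twice the cube root of 1/N, so N e³ ≥ 8.
    lower-bound : ∀ {A q r} → A ≈ fromℕ 2 / n * v → fromℤ (+ 64) * q ≈ 1# →
                  IsCubeRoot (n ⁻¹) r → fromℤ (+ 128) * r ≤ D →
                  (q * (q * q) * (q * q)) * n ^ 2 * D ^ 5 ≤ A
    lower-bound {A} {q} {r} A≈ 64q≈1 (0≤r , r³≈) 128r≤D =
      decidable-stable (_ ≤? A) λ large → impossible e 64e≈D N-large (begin
        2# * v              ≈⟨ ≈-trans (*-congʳ (≈-sym fromℕ-2)) (≈-trans (≈-sym (n*mean v)) (*-congˡ (≈-sym A≈))) ⟩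
        n * A               ≤⟨ *-monoˡ-≤ (<⇒≤ 0<n) (<⇒≤ (≰⇒> large)) ⟩
        n * ((q * (q * q) * (q * q)) * n ^ 2 * D ^ 5)
          ≈⟨ solve 3 (λ n q d → n ⊗ ((q ⊗ (q ⊗ q) ⊗ (q ⊗ q)) ⊗ (n ⊗ (n ⊗ con (+ 1))) ⊗ (d ⊗ (d ⊗ (d ⊗ (d ⊗ (d ⊗ con (+ 1)))))))
               := (n ⊗ n ⊗ n) ⊗ ((d ⊗ q) ⊗ ((d ⊗ q) ⊗ (d ⊗ q)) ⊗ ((d ⊗ q) ⊗ (d ⊗ q)))) ≈-refl n q D ⟩
        (n * n * n) * (e * (e * e) * (e * e))  ∎)
      where
      e = D * q

      64e≈D : fromℤ (+ 64) * e ≈ D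
      64e≈D = ≈-trans (solve 2 (λ d q → con (+ 64) ⊗ (d ⊗ q)
            := d ⊗ (con (+ 64) ⊗ q)) ≈-refl D q) (≈-trans (*-congˡ 64q≈1) (*-identityʳ D))

      2r≤e : 2# * r ≤ e
      2r≤e = *-cancelˡ-≤ (0<con 63) (≤-trans (≤-reflexive (solve 1 (λ r → con (+ 64) ⊗ (con (+ 2) ⊗ r)
            := con (+ 128) ⊗ r) ≈-refl r))
        (≤-trans 128r≤D (≤-reflexive (≈-sym 64e≈D))))

      N-large : fromℤ (+ 4) ≤ n * (e * (e * e))
      N-large = begin
        fromℤ (+ 4)
          ≤⟨ ≤-by (0≤con 4) (solve 0 (con (+ 8) := con (+ 4) ⊕ con (+ 4)) ≈-refl) ⟩
        8#
          ≈⟨ ≈-trans (≈-sym (*-identityʳ _)) (*-congˡ (≈-sym (*-inverseʳ 0<n))) ⟩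
        8# * (n * n ⁻¹)
          ≈⟨ *-congˡ (*-congˡ r³≈) ⟨
        8# * (n * r ^ 3)
          ≈⟨ solve 2 (λ n r → con (+ 8) ⊗ (n ⊗ (r ⊗ (r ⊗ (r ⊗ con (+ 1)))))
                := n ⊗ ((con (+ 2) ⊗ r) ⊗ ((con (+ 2) ⊗ r) ⊗ (con (+ 2) ⊗ r)))) ≈-refl n r ⟩
        n * ((2# * r) * ((2# * r) * (2# * r)))
          ≤⟨ *-monoˡ-≤ (<⇒≤ 0<n) (*-mono-≤ 0≤2r (*-nonNegative 0≤2r 0≤2r) 2r≤e (*-mono-≤ 0≤2r 0≤2r 2r≤e 2r≤e)) ⟩
        n * (e * (e * e))  ∎
        where 0≤2r = *-nonNegative 0≤2 0≤r

theorem2 : ∀ {c ℓ₁ ℓ₂} (R : CompleteOrderedField c ℓ₁ ℓ₂) →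
    let open Real R in
    ∃[ C₁ ] ∃[ C₂ ] ∃[ κ ] (0# < C₁ × 0# < C₂ × 0# < κ ×
    (∀ (N : ℕ) → 1 ℕ.≤ N → (x : Fin N → 𝕋) →
    ∀ D A → IsDiscrepancy x D → IsMeanSquareDeviation x A →
    (A ≤ C₁ * fromℕ N ^ 2 * D ^ 2) ×
    (∀ r → IsCubeRoot (fromℕ N ⁻¹) r → C₂ * r ≤ D →
    κ * fromℕ N ^ 2 * D ^ 5 ≤ A)))
theorem2 R = fromℤ (+ 4) , fromℤ (+ 128) , q * (q * q) * (q * q) ,
  0<con 3 , 0<con 127 , 0<* (0<* 0<q (0<* 0<q 0<q)) (0<* 0<q 0<q) ,
  λ { N 1≤N x D A D-sup (v , integral , A≈) →
      MeanSquare.upper-bound R x 1≤N D D-sup v integral A≈ ,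
      λ r → MeanSquare.lower-bound R x 1≤N D D-sup v integral A≈ (*-inverseʳ (0<con 63)) }
  where
  open OrderedField R
  open GeometricRatio R using (0<con)
  q = fromℤ (+ 64) ⁻¹
  0<q = 0<⁻¹ (0<con 63)
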